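{- Let $j_1,j_2$ be join-irreducible elements of the weak order on $B_n$. Then $j_1$ forces $j_2$ if and only if the symmetric arc or symmetric pair corresponding to $j_1$ is a subarc or subarc pair of the symmetric arc or symmetric pair corresponding to $j_2$.
   Context: $B_n$: signed permutations of $\{\pm1,\ldots,\pm n\}$ ($\pi(-i)=-\pi(i)$), long one-line notation $\pi_{ -n}\cdots\pi_{ -1}\pi_1\cdots\pi_n$. Weak order: $\sigma$ covers $\pi$ iff either $\pi_{ -1}<\pi_1$ and $\sigma$ swaps $\pi_{ -1},\pi_1$, or $\pi_i<\pi_{i+1}$ ($1\le i\le n-1$) and $\sigma$ swaps $\pi_i,\pi_{i+1}$ and $\pi_{ -i-1},\pi_{ -i}$; it is a finite lattice. $j$ is join-irreducible if it covers exactly one element $j_*$. A lattice congruence is an equivalence relation $\Theta$ with $x_1\equiv x_2,\ y_1\equiv y_2\Rightarrow x_1\wedge y_1\equiv x_2\wedge y_2$ and $x_1\vee y_1\equiv x_2\vee y_2$; $\Theta$ contracts $j$ if $j\equiv j_*$. $j_1$ forces $j_2$ if every congruence contracting $j_1$ contracts $j_2$. Arcs: $2n$ points on a vertical line labeled $-n,\ldots,-1,1,\ldots,n$ bottom to top, symmetric under the half-turn $x\mapsto -x$ ($i\mapsto -i$). An arc: monotone downward curve from a labeled point to a lower one, touching no other labeled point, passing left or right of each labeled point between; up to combinatorial equivalence. $L(\alpha),R(\alpha)$: labeled points strictly between the endpoints lying left/right of $\alpha$. Arcs are compatible if they intersect at most at a common endpoint and share no upper endpoint and no lower endpoint. A symmetric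 arc is an arc fixed by the half-turn (endpoints $\pm p$); a symmetric pair is a pair $\{\alpha,-\alpha\}$ of distinct compatible arcs exchanged by the half-turn; it is non-overlapping if one arc joins two positive points, overlapping if each joins a negative to a positive point (then one lies to the right of the other). The map $\delta$: for $\pi\in B_n$ and consecutive positions $a,b$ (order $-n<\cdots<-1<1<\cdots<n$) with $\pi_a>\pi_b$, an arc from $\pi_a$ to $\pi_b$ passing right of all $\pi_c$ with $\pi_b<\pi_c<\pi_a$, $c$ before $a$, and left of such $\pi_c$ with $c$ after $b$. For join-irreducible $j$, $\delta(j)$ is a single symmetric arc or single symmetric pair ("the arc/pair corresponding to $j$"), bijectively. Subarcs of a symmetric arc $\alpha$ with endpoints $-p<p$: a subarc is a symmetric arc $\alpha'$ with endpoints $-p'<p'$, $p'\le p$, $R(\alpha')=R(\alpha)\cap(-p',p')$; a subarc pair is a non-overlapping pair $\{\alpha',-\alpha'\}$ with $\alpha'$ having endpoints $0<p'<q'\le p$ and $R(\alpha')=R(\alpha)\cap(p',q')$. Subarcs of a symmetric pair $\{\alpha,-\alpha\}$, $\alpha$ with endpoints $p<q$: a subarc is a symmetric arc $\alpha'$ with endpoints $-p',p'$, $p\le -p'<p'\le q$, and $R(\alpha')=R(\alpha)\cap(-p',p')=R(-\alpha)\cap(-p',p')$. If the pair is overlapping, label so that $\alpha$ is right of $-\alpha$. A subarc pair is a symmetric pair $\{\alpha',-\alpha'\}$, $\alpha'$ with endpoints $p\le p'<q'\le q$ and $R(\alpha')=R(\alpha)\cap(p',q')$, such that if $\{\alpha',-\alpha'\}$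 is overlapping then $\alpha'$ is right of $-\alpha'$. (All intervals denote sets of labeled points.) -}

module Defs where

open import Level using (Level; 0ℓ) renaming (suc to lsuc)
open import Data.Nat as ℕ using (ℕ; zero; suc; _+_)
open import Data.Bool using (Bool; true; false; _∧_; not)
open import Data.Fin as F using (Fin; toℕ; opposite)
open import Data.Fin.Properties using (_<?_)
open import Data.Fin.Permutation.Components using (transpose)
open import Data.Vec using (Vec; lookup; tabulate)
open import Data.Product using (Σ; ∃; _×_; _,_)
open import Data.Sum using (_⊎_)
open import Data.Empty using (⊥)
open import Relation.Nullary using (¬_)
open import Relation.Nullary.Decidable using (⌊_⌋)
open import Relation.Binary.PropositionalEquality using (_≡_; _≢_)
open import Relation.Binary.Construct.Closure.ReflexiveTransitive using (Star)
open import Function.Bundles using (_⇔_)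

-- Conventions.
-- Labeled points / positions / values are elements of Fin (n + n):
-- index k < n stands for the label -(n - k), index k ≥ n for k - n + 1.
-- Thus the Fin order is the order -n < ... < -1 < 1 < ... < n and the
-- half-turn / negation i ↦ -i is `opposite`.

-- a (candidate) element of B_n in long one-line notation:
-- the entry at position k is lookup w k.
Word : ℕ → Set
Word n = Vec (Fin (n + n)) (n + n)

IsSignedPerm : (n : ℕ) → Word n → Set
IsSignedPerm n w =
  (∀ i j → lookup w i ≡ lookup w j → i ≡ j) ×
  (∀ k → lookup w (opposite k) ≡ opposite (lookup w k))

swap : (n : ℕ) → Word n → Fin (n + n) → Fin (n + n) → Word n
swap n w a b = tabulate (λ c → lookup w (transpose a b c))

data Cov (n : ℕ) (π : Word n) : Word n → Set where
  -- swap π_{-1}, π_1 (positions n-1, n) when π_{-1} < π_1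
  cov-mid : (a b : Fin (n + n)) → suc (toℕ a) ≡ n → toℕ b ≡ n →
            lookup π a F.< lookup π b → Cov n π (swap n π a b)
  -- swap π_i, π_{i+1} (1 ≤ i ≤ n-1, positions a, b ≥ n) and their mirrors
  cov-pair : (a b : Fin (n + n)) → n ℕ.≤ toℕ a → toℕ b ≡ suc (toℕ a) →
             lookup π a F.< lookup π b →
             Cov n π (swap n (swap n π a b) (opposite b) (opposite a))

LeW : (n : ℕ) → Word n → Word n → Set
LeW n = Star (Cov n)

IsMeet : (n : ℕ) → Word n → Word n → Word n → Set
IsMeet n x y m = IsSignedPerm n m × LeW n m x × LeW n m y ×
  (∀ z → IsSignedPerm n z → LeW n z x → LeW n z y → LeW n z m)

IsJoin : (n : ℕ) → Word n → Word n → Word n → Set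
IsJoin n x y m = IsSignedPerm n m × LeW n x m × LeW n y m ×
  (∀ z → IsSignedPerm n z → LeW n x z → LeW n y z → LeW n m z)

JoinIrr : (n : ℕ) → Word n → Set
JoinIrr n j = IsSignedPerm n j ×
  Σ (Word n) (λ j* → Cov n j* j × (∀ y → Cov n y j → y ≡ j*))

-- lattice congruence on the weak order of B_n (a relation on words,
-- only its restriction to signed permutations is constrained/used)
record IsCongruence (n : ℕ) (Θ : Word n → Word n → Set) : Set where
  field
    refl′  : ∀ x → IsSignedPerm n x → Θ x x
    sym′   : ∀ x y → IsSignedPerm n x → IsSignedPerm n y → Θ x y → Θ y x
    trans′ : ∀ x y z → IsSignedPerm n x → IsSignedPerm n y → IsSignedPerm n z →
             Θ x y → Θ y z → Θ x z
    meet′  : ∀ x₁ x₂ y₁ y₂ m₁ m₂ →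
             IsSignedPerm n x₁ → IsSignedPerm n x₂ →
             IsSignedPerm n y₁ → IsSignedPerm n y₂ →
             Θ x₁ x₂ → Θ y₁ y₂ → IsMeet n x₁ y₁ m₁ → IsMeet n x₂ y₂ m₂ → Θ m₁ m₂
    join′  : ∀ x₁ x₂ y₁ y₂ m₁ m₂ →
             IsSignedPerm n x₁ → IsSignedPerm n x₂ →
             IsSignedPerm n y₁ → IsSignedPerm n y₂ →
             Θ x₁ x₂ → Θ y₁ y₂ → IsJoin n x₁ y₁ m₁ → IsJoin n x₂ y₂ m₂ → Θ m₁ m₂

Contracts : (n : ℕ) → (Word n → Word n → Set) → Word n → Set
Contracts n Θ j = ∀ y → Cov n y j → Θ j y

Forces : (n : ℕ) → Word n → Word n → Set₁
Forces n j₁ j₂ = (Θ : Word n → Word n → Set) → IsCongruence n Θ →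
  Contracts n Θ j₁ → Contracts n Θ j₂

-- Arcs on the points Fin N (N = n + n).  An arc is given by its lower
-- endpoint, upper endpoint, and the Boolean vector `rs` marking the
-- points strictly between the endpoints lying to the RIGHT of the arc
-- (all other between-points lie to its left).

record Arc (N : ℕ) : Set where
  constructor arc
  field
    bot : Fin N
    top : Fin N
    rs  : Vec Bool N
open Arc public

Between : ∀ {N} → Fin N → Arc N → Set
Between x α = bot α F.< x × x F.< top α

-- well-formedness (canonical representative of the equivalence class)
WF : ∀ {N} → Arc N → Set
WF α = bot α F.< top α × (∀ x → lookup (rs α) x ≡ true → Between x α)

InR : ∀ {N} → Fin N → Arc N → Set
InR x α = Between x α × lookup (rs α) x ≡ true

InL : ∀ {N} → Fin N → Arc N → Set
InL x α = Between x α × lookup (rs α) x ≡ false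

inside? : ∀ {N} → Fin N → Fin N → Fin N → Bool
inside? y b t = ⌊ b <? y ⌋ ∧ ⌊ y <? t ⌋

-- image of an arc under the half-turn x ↦ -x (swaps left and right)
negArc : ∀ {N} → Arc N → Arc N
negArc (arc b t r) =
  arc (opposite t) (opposite b)
      (tabulate (λ x → inside? (opposite x) b t ∧ not (lookup r (opposite x))))

-- α lies weakly left of β (on the common range of heights)
LeftOf : ∀ {N} → Arc N → Arc N → Set
LeftOf α β =
  (∀ x → InL x α → InR x β → ⊥) ×
  (Between (bot β) α → InR (bot β) α) × (Between (top β) α → InR (top β) α) ×
  (Between (bot α) β → InL (bot α) β) × (Between (top α) β → InL (top α) β)

-- compatible: no crossing, no shared lower / upper endpoint
Compatible : ∀ {N} → Arc N → Arc N → Set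
Compatible α β = bot α ≢ bot β × top α ≢ top β × (LeftOf α β ⊎ LeftOf β α)

IsSymArc : ∀ {N} → Arc N → Set
IsSymArc α = WF α × α ≡ negArc α

IsSymPair : ∀ {N} → Arc N → Set
IsSymPair α = WF α × α ≢ negArc α × Compatible α (negArc α)

Positive : (n : ℕ) → Fin (n + n) → Set
Positive n x = n ℕ.≤ toℕ x

Overlapping : (n : ℕ) → Arc (n + n) → Set
Overlapping n α = ¬ Positive n (bot α) × Positive n (top α)

RightOfNeg : ∀ {N} → Arc N → Set
RightOfNeg α = LeftOf (negArc α) α

SameR : ∀ {N} → Arc N → Arc N → Set
SameR α′ α = ∀ x → (InR x α′ → InR x α × Between x α′) ×
                    (InR x α × Between x α′ → InR x α′)

InDelta : (n : ℕ) → Word n → Arc (n + n) → Set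
InDelta n π α = Σ (Fin (n + n)) λ a → Σ (Fin (n + n)) λ b →
  toℕ b ≡ suc (toℕ a) × lookup π b F.< lookup π a ×
  bot α ≡ lookup π b × top α ≡ lookup π a ×
  (∀ x → (lookup (rs α) x ≡ true →
            (lookup π b F.< x × x F.< lookup π a) ×
            Σ (Fin (n + n)) (λ c → b F.< c × lookup π c ≡ x)) ×
         ((lookup π b F.< x × x F.< lookup π a) ×
            Σ (Fin (n + n)) (λ c → b F.< c × lookup π c ≡ x) →
            lookup (rs α) x ≡ true))

-- a symmetric arc, or a symmetric pair {α, -α} given by a representative α
data Obj (N : ℕ) : Set where
  symO  : Arc N → Obj N
  pairO : Arc N → Obj N

Corr : (n : ℕ) → Word n → Obj (n + n) → Set
Corr n j (symO α) = IsSymArc α × InDelta n j α × (∀ γ → InDelta n j γ → γ ≡ α)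
Corr n j (pairO α) = IsSymPair α × InDelta n j α × InDelta n j (negArc α) ×
  (∀ γ → InDelta n j γ → γ ≡ α ⊎ γ ≡ negArc α)

OneOf : ∀ {N} → Arc N → Arc N → Set
OneOf β α = β ≡ α ⊎ β ≡ negArc α

Sub : (n : ℕ) → Obj (n + n) → Obj (n + n) → Set
Sub n (symO α′) (symO α) = IsSymArc α′ × top α′ F.≤ top α × SameR α′ α
-- subarc pair of a symmetric arc (non-overlapping, 0 < p' < q' ≤ p)
Sub n (pairO α′) (symO α) = Σ (Arc (n + n)) λ β → OneOf β α′ ×
  IsSymPair β × Positive n (bot β) × top β F.≤ top α × SameR β α
Sub n (symO α′) (pairO α) = IsSymArc α′ ×
  bot α F.≤ bot α′ × top α′ F.≤ top α × SameR α′ α × SameR α′ (negArc α)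
Sub n (pairO α′) (pairO α) = Σ (Arc (n + n)) λ β → OneOf β α ×
  (Overlapping n β → RightOfNeg β) ×
  Σ (Arc (n + n)) λ β′ → OneOf β′ α′ × IsSymPair β′ ×
  bot β F.≤ bot β′ × top β′ F.≤ top β × SameR β′ β ×
  (Overlapping n β′ → RightOfNeg β′)

{-# OPTIONS --safe #-}
module Submission where

-- On words, the weak order is inclusion of inversion sets, and every cover carries a label: the arc of
-- the exchanged pair of values, with the set S of values standing after the pair.
--
-- Forcing implies subarc: call j a bottom element if no descent label of j contains the arc e₁ of j₁,
-- and let x ≡ y when x and y lie above the same bottom elements. This respects meets at sight. If a
-- bottom element j is not below y, a maximal m ≥ y not above j has no ascent label containing e₁,
-- because the label of an ascent of m is a subarc of the label of some descent of j; together with the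
-- dual statement this shows that ≡ respects joins. It contracts j₁, and exactly what contains e₁.
--
-- Subarc implies forcing: a congruence contracts either all edges with a given label or none, since they
-- are all perspective to the same join-irreducible edge. In a hexagon or octagon, collapsing a bottom edge
-- collapses the side edges. Words realising such polygons are built by sorting the values by suitable
-- keys, and each subarc relation is a composition of such steps.
--
-- Everything is done for an abstract order on the values. Reversing that order reverses the weak order,
-- so each argument is also available in dual form.

-- Labels are read off in the right half: an edge at the middle carries a symmetric arc, any other
-- edge a member of a pair that lies right of its mirror image. Since the marks record positions and
-- not values, this choice survives the reversal of the value order, which only exchanges the two
-- ends. The obstacle is that a polygon exists only where its bottom word is signed. A hexagon
-- permutes three neighbours of the right half, so no two of them may be opposite, and the negative
-- of none may be required to stand after them. When an end of an arc moves outwards past the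
-- negative of the old end, this can fail. The octagon on `-t`, `-x`, `x`, `t` in the middle then
-- helps, but it demands that every other enclosed pair of opposite values lies on opposite sides of
-- the arc. Where that fails too, some enclosed pair has both members on the left, and its positive
-- member serves as an intermediate end for hexagons. The case distinctions in `Forcing` come from
-- this alternative.

open import Defs
open import Data.Nat as ℕ using (ℕ; zero; suc; _+_; _∸_; z≤n; s≤s)
import Data.Nat.Properties as ℕₚ
open import Data.Bool using (Bool; true; false; not; _∧_)
import Data.Bool.Properties as Boolₚ
open import Data.Fin as F using (Fin; zero; suc; toℕ; fromℕ<; opposite)
import Data.Fin.Properties as Fₚ
open import Data.Fin.Permutation.Components using (transpose)
open import Data.Vec using (lookup; tabulate)
open import Data.Vec.Properties using (lookup∘tabulate; tabulate∘lookup; tabulate-cong)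
open import Data.Product using (Σ; _×_; _,_; proj₁; proj₂)
open import Data.Sum as Sum using (_⊎_; inj₁; inj₂; [_,_]′)
open import Data.Empty using (⊥; ⊥-elim)
open import Data.Unit using (⊤; tt)
open import Function using (_∘_; flip; id)
open import Function.Bundles using (_⇔_; mk⇔)
open import Relation.Nullary using (¬_; Dec; yes; no; does; contradiction)
open import Relation.Nullary.Decidable using (_×-dec_; _⊎-dec_; _→-dec_; ¬?; map′; ⌊_⌋; decidable-stable; dec-true; dec-false)
open import Relation.Binary.PropositionalEquality
open import Relation.Binary.Definitions using (Tri; tri<; tri≈; tri>)
open import Relation.Binary.Construct.Closure.ReflexiveTransitive using (Star; ε; _◅_; _◅◅_)
open import Induction.WellFounded using (Acc; acc)
open import Data.Nat.Induction using (<-wellFounded)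

-- Counting, order reversal and monotone maps on finite ordinals.

count : ∀ {k} {P : Fin k → Set} → (∀ i → Dec (P i)) → ℕ
count {zero} P? = 0
count {suc k} P? with P? zero
... | yes _ = suc (count (P? ∘ suc))
... | no _ = count (P? ∘ suc)

count-mono : ∀ {k} {P Q : Fin k → Set} (P? : ∀ i → Dec (P i)) (Q? : ∀ i → Dec (Q i)) →
  (∀ i → P i → Q i) → count P? ℕ.≤ count Q?
count-mono {zero} P? Q? f = z≤n
count-mono {suc k} P? Q? f with P? zero | Q? zero
... | yes _ | yes _ = s≤s (count-mono (P? ∘ suc) (Q? ∘ suc) (f ∘ suc))
... | yes p | no ¬q = contradiction (f zero p) ¬q
... | no _ | yes _ = ℕₚ.m≤n⇒m≤1+n (count-mono (P? ∘ suc) (Q? ∘ suc) (f ∘ suc))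
... | no _ | no _ = count-mono (P? ∘ suc) (Q? ∘ suc) (f ∘ suc)

count-strict : ∀ {k} {P Q : Fin k → Set} (P? : ∀ i → Dec (P i)) (Q? : ∀ i → Dec (Q i)) →
  (∀ i → P i → Q i) → ∀ i → Q i → ¬ P i → count P? ℕ.< count Q?
count-strict {suc k} P? Q? f zero q ¬p with P? zero | Q? zero
... | yes p | _ = contradiction p ¬p
... | no _ | yes _ = s≤s (count-mono (P? ∘ suc) (Q? ∘ suc) (f ∘ suc))
... | no _ | no ¬q = contradiction q ¬q
count-strict {suc k} P? Q? f (suc i) q ¬p with P? zero | Q? zero
... | yes _ | yes _ = s≤s (count-strict (P? ∘ suc) (Q? ∘ suc) (f ∘ suc) i q ¬p)
... | yes p | no ¬q = contradiction (f zero p) ¬q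
... | no _ | yes _ = ℕₚ.m≤n⇒m≤1+n (count-strict (P? ∘ suc) (Q? ∘ suc) (f ∘ suc) i q ¬p)
... | no _ | no _ = count-strict (P? ∘ suc) (Q? ∘ suc) (f ∘ suc) i q ¬p

count≤ : ∀ {k} {P : Fin k → Set} (P? : ∀ i → Dec (P i)) → count P? ℕ.≤ k
count≤ {zero} P? = z≤n
count≤ {suc k} P? with P? zero
... | yes _ = s≤s (count≤ (P? ∘ suc))
... | no _ = ℕₚ.m≤n⇒m≤1+n (count≤ (P? ∘ suc))

opp-involutive : ∀ {k} (i : Fin k) → opposite (opposite i) ≡ i
opp-involutive = Fₚ.opposite-involutive

opp-anti : ∀ {k} {i j : Fin k} → i F.< j → opposite j F.< opposite i
opp-anti {k} {i} {j} i<j = subst₂ ℕ._<_ (sym (Fₚ.opposite-prop j)) (sym (Fₚ.opposite-prop i))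
  (ℕₚ.∸-monoʳ-< (s≤s i<j) (Fₚ.toℕ<n j))

opp-anti-≤ : ∀ {k} {i j : Fin k} → i F.≤ j → opposite j F.≤ opposite i
opp-anti-≤ {k} {i} {j} i≤j = subst₂ ℕ._≤_ (sym (Fₚ.opposite-prop j)) (sym (Fₚ.opposite-prop i))
  (ℕₚ.∸-monoʳ-≤ k (s≤s i≤j))

opp-sum : ∀ {k} (i : Fin k) → suc (toℕ i + toℕ (opposite i)) ≡ k
opp-sum i = trans (cong (λ m → suc (toℕ i + m)) (Fₚ.opposite-prop i)) (ℕₚ.m+[n∸m]≡n (Fₚ.toℕ<n i))

Monotone : ∀ {k} → (Fin k → Fin k) → Set
Monotone h = ∀ {i j} → i F.< j → h i F.< h j

monotone⇒inflationary : ∀ {k} (h : Fin k → Fin k) → Monotone h → ∀ i → i F.≤ h i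
monotone⇒inflationary {k} h mono i = go (toℕ i) i refl
  where
  go : ∀ m (i : Fin k) → toℕ i ≡ m → m ℕ.≤ toℕ (h i)
  go zero i eq = z≤n
  go (suc m) i eq = ℕₚ.≤-<-trans (go m i′ (Fₚ.toℕ-fromℕ< m<k)) (mono i′<i)
    where
    m<i : m ℕ.< toℕ i
    m<i = subst (m ℕ.<_) (sym eq) ℕₚ.≤-refl
    m<k : m ℕ.< k
    m<k = ℕₚ.<-trans m<i (Fₚ.toℕ<n i)
    i′ : Fin k
    i′ = fromℕ< m<k
    i′<i : i′ F.< i
    i′<i = subst (ℕ._< toℕ i) (sym (Fₚ.toℕ-fromℕ< m<k)) m<i

-- Conjugation by `opposite` keeps monotonicity and turns the inflationary bound for the conjugate
-- into the upper bound for `h`.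
monotone⇒id : ∀ {k} (h : Fin k → Fin k) → Monotone h → ∀ i → h i ≡ i
monotone⇒id h mono i = Fₚ.≤-antisym (ℕₚ.≮⇒≥ above) (monotone⇒inflationary h mono i)
  where
  above : ¬ (i F.< h i)
  above lt = ℕₚ.<⇒≱ (opp-anti lt)
    (subst (λ j → opposite i F.≤ opposite (h j)) (opp-involutive i)
      (monotone⇒inflationary (opposite ∘ h ∘ opposite) (opp-anti ∘ mono ∘ opp-anti) (opposite i)))

abstract
  injective⇒surjective : ∀ {k} (f : Fin k → Fin k) → (∀ i j → f i ≡ f j → i ≡ j) →
    ∀ y → Σ (Fin k) λ x → f x ≡ y
  injective⇒surjective {suc k} f inj y with Fₚ.any? (λ x → f x Fₚ.≟ y)
  ... | yes p = p
  ... | no ¬p = contradiction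
    (Fₚ.injective⇒≤ {f = λ x → F.punchOut {i = y} {j = f x} (λ e → ¬p (x , sym e))}
      (λ {a} {b} e → inj a b (Fₚ.punchOut-injective (λ e′ → ¬p (a , sym e′)) (λ e′ → ¬p (b , sym e′)) e)))
    (ℕₚ.<⇒≱ ℕₚ.≤-refl)

abstract
  -- The discrete intermediate value principle, by which every neighbouring ascent or descent is
  -- extracted from a distant pair. The fuel `f` bounds the distance still to go to `l`.
  switch : ∀ {k} {P : Fin k → Set} → (∀ i → Dec (P i)) → ∀ {i l} → i F.< l → P i → ¬ P l →
    Σ (Fin k) λ a → Σ (Fin k) λ b → toℕ b ≡ suc (toℕ a) × i F.≤ a × b F.≤ l × P a × ¬ P b
  switch {k} {P} P? {i} {l} i<l pi ¬pl = go (toℕ l ∸ toℕ i) i ℕₚ.≤-refl i<l pi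
    where
    go : ∀ f (i : Fin k) → toℕ l ∸ toℕ i ℕ.≤ f → i F.< l → P i →
      Σ (Fin k) λ a → Σ (Fin k) λ b → toℕ b ≡ suc (toℕ a) × i F.≤ a × b F.≤ l × P a × ¬ P b
    go f i le i<l pi with fromℕ< (ℕₚ.≤-<-trans i<l (Fₚ.toℕ<n l)) in eq
    ... | i′ = step f le
      where
      i′≡ : toℕ i′ ≡ suc (toℕ i)
      i′≡ = trans (cong toℕ (sym eq)) (Fₚ.toℕ-fromℕ< _)
      i′≤l : i′ F.≤ l
      i′≤l = subst (ℕ._≤ toℕ l) (sym i′≡) i<l
      step : ∀ f → toℕ l ∸ toℕ i ℕ.≤ f →
        Σ (Fin k) λ a → Σ (Fin k) λ b → toℕ b ≡ suc (toℕ a) × i F.≤ a × b F.≤ l × P a × ¬ P b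
      step zero le = contradiction (ℕₚ.m<n⇒0<n∸m i<l) (ℕₚ.≤⇒≯ le)
      step (suc f) le with P? i′
      ... | no ¬p = i , i′ , i′≡ , ℕₚ.≤-refl , i′≤l , pi , ¬p
      ... | yes p with go f i′ le′ (Fₚ.≤∧≢⇒< i′≤l (λ e → ¬pl (subst P e p))) p
        where
        le′ : toℕ l ∸ toℕ i′ ℕ.≤ f
        le′ = subst (λ m → toℕ l ∸ m ℕ.≤ f) (sym i′≡)
          (ℕₚ.≤-pred (ℕₚ.≤-trans (ℕₚ.≤-reflexive (sym (ℕₚ.+-∸-assoc 1 i<l))) le))
      ... | a , b , e , i′≤a , rest = a , b , e , ℕₚ.≤-trans (ℕₚ.≤-trans (ℕₚ.n≤1+n _) (ℕₚ.≤-reflexive (sym i′≡))) i′≤a , rest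

-- Transpositions of positions.

private variable k : ℕ

transposeˡ : (i j : Fin k) → transpose i j i ≡ j
transposeˡ i j rewrite dec-true (i Fₚ.≟ i) refl = refl

transposeʳ : (i j : Fin k) → transpose i j j ≡ i
transposeʳ i j with j Fₚ.≟ i
... | yes e = e
... | no _ rewrite dec-true (j Fₚ.≟ j) refl = refl

transpose-other : (i j : Fin k) {l : Fin k} → l ≢ i → l ≢ j → transpose i j l ≡ l
transpose-other i j {l} l≢i l≢j rewrite dec-false (l Fₚ.≟ i) l≢i | dec-false (l Fₚ.≟ j) l≢j = refl

data TransposeView (i j l : Fin k) : Set where
  left : l ≡ i → transpose i j l ≡ j → TransposeView i j l
  right : l ≡ j → transpose i j l ≡ i → TransposeView i j l
  other : l ≢ i → l ≢ j → transpose i j l ≡ l → TransposeView i j l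

transposeView : (i j l : Fin k) → TransposeView i j l
transposeView i j l with l Fₚ.≟ i | l Fₚ.≟ j
... | yes refl | _ = left refl (transposeˡ i j)
... | no _ | yes refl = right refl (transposeʳ i j)
... | no p | no q = other p q (transpose-other i j p q)

transpose-involutive : (i j l : Fin k) → transpose i j (transpose i j l) ≡ l
transpose-involutive i j l with transposeView i j l
... | left refl e rewrite e = transposeʳ i j
... | right refl e rewrite e = transposeˡ i j
... | other p q e rewrite e = transpose-other i j p q

transpose-opposite : (i j l : Fin k) →
  transpose (opposite j) (opposite i) (opposite l) ≡ opposite (transpose i j l)
transpose-opposite i j l with transposeView i j l
... | left refl e rewrite e = transposeʳ (opposite j) (opposite i)
... | right refl e rewrite e = transposeˡ (opposite j) (opposite i)
... | other p q e rewrite e = transpose-other _ _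
  (λ e′ → q (opp-injective e′)) (λ e′ → p (opp-injective e′))
  where
  opp-injective : ∀ {k} {i j : Fin k} → opposite i ≡ opposite j → i ≡ j
  opp-injective {i = i} {j} e = trans (sym (opp-involutive i)) (trans (cong opposite e) (opp-involutive j))

-- No position lies strictly between `a` and `b`, so only this pair can change its order.
transpose-adjacent : (a b : Fin k) → toℕ b ≡ suc (toℕ a) → ∀ {i j} → i F.< j →
  (i ≡ a × j ≡ b) ⊎ transpose a b i F.< transpose a b j
transpose-adjacent a b b≡ {i} {j} i<j with transposeView a b i | transposeView a b j
... | left refl _ | left refl _ = contradiction i<j (ℕₚ.<-irrefl refl)
... | left refl _ | right refl _ = inj₁ (refl , refl)
... | left refl e | other p q e′ rewrite e | e′ = inj₂ (ℕₚ.≤∧≢⇒< (subst (ℕ._≤ _) (sym b≡) i<j) (λ e → q (sym (Fₚ.toℕ-injective e))))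
... | right refl _ | left refl _ = contradiction (ℕₚ.<-trans (ℕₚ.≤-reflexive (sym b≡)) i<j) (ℕₚ.<-irrefl refl)
... | right refl _ | right refl _ = contradiction i<j (ℕₚ.<-irrefl refl)
... | right refl e | other p q e′ rewrite e | e′ = inj₂ (ℕₚ.<-trans (ℕₚ.≤-reflexive (sym b≡)) i<j)
... | other p q e′ | left refl e rewrite e | e′ = inj₂ (ℕₚ.<-trans i<j (ℕₚ.≤-reflexive (sym b≡)))
... | other p q e′ | right refl e rewrite e | e′ = inj₂ (ℕₚ.≤∧≢⇒< (ℕₚ.≤-pred (subst (suc (toℕ i) ℕ.≤_) b≡ i<j)) (λ e → p (Fₚ.toℕ-injective e)))
... | other _ _ e | other _ _ e′ rewrite e | e′ = inj₂ i<j

-- Signed permutations as orders of their values, and edges between them.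

module SignedWords (n : ℕ) where

  V : Set
  V = Fin (n + n)

  neg : V → V
  neg = opposite

  neg-neg : ∀ v → neg (neg v) ≡ v
  neg-neg = opp-involutive

  neg-injective : ∀ {u v} → neg u ≡ neg v → u ≡ v
  neg-injective {u} {v} e = trans (sym (neg-neg u)) (trans (cong neg e) (neg-neg v))

  neg-swap : ∀ {u v} → u ≡ neg v → neg u ≡ v
  neg-swap {u} {v} e = trans (cong neg e) (neg-neg v)

  <n⇒≤neg : ∀ (k : V) → toℕ k ℕ.< n → n ℕ.≤ toℕ (neg k)
  <n⇒≤neg k k<n = ℕₚ.+-cancelˡ-≤ n n (toℕ (neg k)) (ℕₚ.≤-trans (ℕₚ.≤-reflexive (sym (opp-sum k))) (ℕₚ.+-monoˡ-≤ (toℕ (neg k)) k<n))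

  ≤n⇒neg<n : ∀ (k : V) → n ℕ.≤ toℕ k → toℕ (neg k) ℕ.< n
  ≤n⇒neg<n k n≤k = ℕₚ.+-cancelˡ-≤ n _ _
    (ℕₚ.≤-trans (ℕₚ.+-monoˡ-≤ _ n≤k) (ℕₚ.≤-reflexive (trans (ℕₚ.+-suc (toℕ k) _) (opp-sum k))))

  neg-mid : ∀ {a b : V} → suc (toℕ a) ≡ n → toℕ b ≡ n → a ≡ neg b
  neg-mid {a} {b} ea eb = Fₚ.toℕ-injective (ℕₚ.suc-injective (ℕₚ.+-cancelˡ-≡ n _ _
    (trans (cong (n +_) ea) (trans (sym (opp-sum b)) (trans (sym (ℕₚ.+-suc (toℕ b) _)) (cong (_+ suc (toℕ (neg b))) eb))))))

  nonneg≢neg : ∀ {c d : V} → n ℕ.≤ toℕ c → n ℕ.≤ toℕ d → c ≢ neg d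
  nonneg≢neg {c} {d} n≤c n≤d e = ℕₚ.<⇒≱ (≤n⇒neg<n d n≤d) (subst (λ v → n ℕ.≤ toℕ v) e n≤c)

  v≢neg : ∀ v → v ≢ neg v
  v≢neg v e with toℕ v ℕₚ.<? n
  ... | yes lt = ℕₚ.<⇒≱ lt (subst (λ w → n ℕ.≤ toℕ w) (sym e) (<n⇒≤neg v lt))
  ... | no ≥ = ≥ (subst (λ w → toℕ w ℕ.< n) (sym e) (≤n⇒neg<n v (ℕₚ.≮⇒≥ ≥)))

  adj-neg : ∀ {a b : V} → toℕ b ≡ suc (toℕ a) → toℕ (neg a) ≡ suc (toℕ (neg b))
  adj-neg {a} {b} e = ℕₚ.suc-injective (ℕₚ.+-cancelˡ-≡ (toℕ a) _ _
    (trans (ℕₚ.+-suc (toℕ a) _) (trans (opp-sum a) (trans (sym (opp-sum b))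
      (trans (cong (λ m → suc (m + toℕ (neg b))) e)
        (trans (cong suc (sym (ℕₚ.+-suc (toℕ a) (toℕ (neg b))))) (sym (ℕₚ.+-suc (toℕ a) _))))))))

  record SW : Set where
    constructor mk
    field
      word : Word n
      sp : IsSignedPerm n word

    at : V → V
    at = lookup word

    at-injective : ∀ {i j} → at i ≡ at j → i ≡ j
    at-injective = proj₁ sp _ _

    at-neg : ∀ k → at (neg k) ≡ neg (at k)
    at-neg = proj₂ sp

    abstract
      preimage : ∀ v → Σ V λ k → at k ≡ v
      preimage = injective⇒surjective at (proj₁ sp)

    pos : V → V
    pos v = proj₁ (preimage v)

    at-pos : ∀ v → at (pos v) ≡ v
    at-pos v = proj₂ (preimage v)

    pos-at : ∀ k → pos (at k) ≡ k
    pos-at k = at-injective (at-pos (at k))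

    pos≡ : ∀ {k v} → at k ≡ v → pos v ≡ k
    pos≡ refl = pos-at _

    pos-injective : ∀ {u v} → pos u ≡ pos v → u ≡ v
    pos-injective {u} {v} e = trans (sym (at-pos u)) (trans (cong at e) (at-pos v))

    pos-neg : ∀ v → pos (neg v) ≡ neg (pos v)
    pos-neg v = pos≡ (trans (at-neg (pos v)) (cong neg (at-pos v)))

  open SW public

  -- Almost everything below sees a word only through this order of its values; `bef-determines`
  -- shows that nothing is lost.
  bef : SW → V → V → Set
  bef x u v = pos x u F.< pos x v

  bef? : ∀ x u v → Dec (bef x u v)
  bef? x u v = pos x u Fₚ.<? pos x v

  bef-trans : ∀ x {u v w} → bef x u v → bef x v w → bef x u w
  bef-trans x = ℕₚ.<-trans

  bef-irrefl : ∀ x {u v} → u ≡ v → ¬ bef x u v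
  bef-irrefl x refl = ℕₚ.<-irrefl refl

  bef-asym : ∀ x {u v} → bef x u v → ¬ bef x v u
  bef-asym x = ℕₚ.<-asym

  bef⇒≢ : ∀ x {u v} → bef x u v → u ≢ v
  bef⇒≢ x b e = bef-irrefl x e b

  bef-total : ∀ x {u v} → u ≢ v → ¬ bef x u v → bef x v u
  bef-total x {u} {v} u≢v ¬b with Fₚ.<-cmp (pos x u) (pos x v)
  ... | tri< b _ _ = contradiction b ¬b
  ... | tri≈ _ e _ = contradiction (pos-injective x e) u≢v
  ... | tri> _ _ b = b

  bef-neg : ∀ x {u v} → bef x u v → bef x (neg v) (neg u)
  bef-neg x {u} {v} b = subst₂ F._<_ (sym (pos-neg x v)) (sym (pos-neg x u)) (opp-anti b)

  bef-neg⁻ : ∀ x {u v} → bef x (neg u) (neg v) → bef x v u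
  bef-neg⁻ x {u} {v} b = subst₂ (bef x) (neg-neg v) (neg-neg u) (bef-neg x b)

  bef-at : ∀ x {k l u v} → at x k ≡ u → at x l ≡ v → k F.< l → bef x u v
  bef-at x e e′ k<l = subst₂ F._<_ (sym (pos≡ x e)) (sym (pos≡ x e′)) k<l

  -- y arises from x by exchanging the neighbours p, q and their negatives; p may be larger than q.
  record Edge (x y : SW) (p q : V) : Set where
    field
      before : bef x p q
      after : bef y q p
      same : ∀ {c d} → bef x c d → bef y c d ⊎ (c ≡ p × d ≡ q) ⊎ (c ≡ neg q × d ≡ neg p)
  open Edge public

  edge-back : ∀ {x y p q c d} → Edge x y p q → bef y c d →
    bef x c d ⊎ (c ≡ q × d ≡ p) ⊎ (c ≡ neg p × d ≡ neg q)
  edge-back {x} {y} {p} {q} {c} {d} E b with bef? x c d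
  ... | yes b′ = inj₁ b′
  ... | no ¬b with same E (bef-total x (bef⇒≢ y b) ¬b)
  ... | inj₁ b″ = contradiction b″ (bef-asym y b)
  ... | inj₂ (inj₁ (e , e′)) = inj₂ (inj₁ (e′ , e))
  ... | inj₂ (inj₂ (e , e′)) = inj₂ (inj₂ (e′ , e))

  edge-flip : ∀ {x y p q} → Edge x y p q → Edge y x q p
  edge-flip E = record { before = after E ; after = before E ; same = edge-back E }

  edge-mirror : ∀ {x y p q} → Edge x y p q → Edge x y (neg q) (neg p)
  edge-mirror {x} {y} {p} {q} E = record
    { before = bef-neg x (before E)
    ; after = bef-neg y (after E)
    ; same = λ b → Sum.map₂ ([ (λ (e , e′) → inj₂ (trans e (sym (neg-neg p)) , trans e′ (sym (neg-neg q)))) , inj₁ ]′) (same E b) }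

  edge-≢ : ∀ {x y p q} → Edge x y p q → p ≢ q
  edge-≢ {x} E = bef⇒≢ x (before E)

  -- With `z` in between, both pairs would keep their order in `y` and put `p` before `q` there. The
  -- exceptional cases of `same` identify `z` with `p` or `q`.
  edge-adjacent : ∀ {x y p q z} → Edge x y p q → bef x p z → bef x z q → ⊥
  edge-adjacent {x} {y} {p} {q} {z} E b b′ with same E b | same E b′
  ... | inj₁ c | inj₁ c′ = bef-asym y (after E) (bef-trans y c c′)
  ... | inj₂ (inj₁ (_ , refl)) | _ = bef-irrefl x refl b′
  ... | inj₂ (inj₂ (e , e′)) | _ = bef-irrefl x (trans e′ (trans (cong neg e) (neg-neg q))) b′
  ... | _ | inj₂ (inj₁ (refl , _)) = bef-irrefl x refl b
  ... | _ | inj₂ (inj₂ (e , e′)) = bef-irrefl x (sym (trans e (neg-swap (trans e′ refl)))) b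

  edge-keep : ∀ {x y p q c d} → Edge x y p q → bef x c d →
    ¬ (c ≡ p × d ≡ q) → ¬ (c ≡ neg q × d ≡ neg p) → bef y c d
  edge-keep E b h h′ = [ id , [ (λ e → contradiction e h) , (λ e → contradiction e h′) ]′ ]′ (same E b)

  edge-before : ∀ {x y p q z} → Edge x y p q → bef x z q → z ≢ p → bef x z p
  edge-before {x} {y} {p} {q} {z} E b z≢p = bef-total x (z≢p ∘ sym) (λ b′ → edge-adjacent E b′ b)

  edge-after : ∀ {x y p q z} → Edge x y p q → bef x p z → z ≢ q → bef x q z
  edge-after {x} {y} {p} {q} {z} E b z≢q = bef-total x z≢q (λ b′ → edge-adjacent E b b′)

  edge-left : ∀ {x y p q z} → Edge x y p q → bef x z p → bef y z q
  edge-left {x} {y} {p} {q} {z} E b with same E (bef-trans x b (before E))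
  ... | inj₁ b′ = b′
  ... | inj₂ (inj₁ (refl , _)) = contradiction b (bef-irrefl x refl)
  ... | inj₂ (inj₂ (e , e′)) = contradiction b (bef-irrefl x (trans e (neg-swap e′)))

  edge-right : ∀ {x y p q z} → Edge x y p q → bef x q z → bef y p z
  edge-right {x} {y} {p} {q} {z} E b with same E (bef-trans x (before E) b)
  ... | inj₁ b′ = b′
  ... | inj₂ (inj₁ (_ , refl)) = contradiction b (bef-irrefl x refl)
  ... | inj₂ (inj₂ (e , e′)) = contradiction b (bef-irrefl x (sym (trans e′ (neg-swap e))))

  -- Sending a position to its entry in `x` and on to the place of that entry in `y` is monotone,
  -- hence the identity.
  bef-determines : ∀ x y → (∀ {u v} → bef x u v → bef y u v) → word x ≡ word y
  bef-determines x y h = trans (sym (tabulate∘lookup (word x))) (trans (tabulate-cong agree) (tabulate∘lookup (word y)))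
    where
    agree : ∀ k → at x k ≡ at y k
    agree k = trans (sym (at-pos y (at x k))) (cong (at y)
      (monotone⇒id (λ k → pos y (at x k)) (λ {i} {j} i<j → h (bef-at x refl refl i<j)) k))

  -- Exchanging neighbouring entries.

  relabel : (x : SW) (τ : V → V) → (∀ k → τ (τ k) ≡ k) → (∀ k → τ (neg k) ≡ neg (τ k)) →
    (y : Word n) → (∀ k → lookup y k ≡ at x (τ k)) → IsSignedPerm n y
  relabel x τ invol comm y eq =
    (λ i j e → trans (sym (invol i)) (trans (cong τ (at-injective x (trans (sym (eq i)) (trans e (eq j))))) (invol j))) ,
    (λ k → trans (eq (neg k)) (trans (cong (at x) (comm k)) (trans (at-neg x (τ k)) (cong neg (sym (eq k))))))

  relabel-pos : (x y : SW) (τ : V → V) → (∀ k → τ (τ k) ≡ k) → (∀ k → at y k ≡ at x (τ k)) →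
    ∀ v → pos y v ≡ τ (pos x v)
  relabel-pos x y τ invol eq v = pos≡ y (trans (eq (τ (pos x v))) (trans (cong (at x) (invol _)) (at-pos x v)))

  -- The positions left alone are listed for the right half only: the left half mirrors it and may
  -- contain a second exchanged pair.
  record Swapped (x : SW) (a b : V) : Set where
    field
      target : SW
      edge : Edge x target (at x a) (at x b)
      at-a : at target a ≡ at x b
      at-b : at target b ≡ at x a
      at-other : ∀ {c} → n ℕ.≤ toℕ c → c ≢ a → c ≢ b → at target c ≡ at x c
      cov-up : at x a F.< at x b → Cov n (word x) (word target)
      cov-down : at x b F.< at x a → Cov n (word target) (word x)
  open Swapped public
  
  module SwapMid (x : SW) (a b : V) (ea : suc (toℕ a) ≡ n) (eb : toℕ b ≡ n) where
    a≡ : a ≡ neg b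
    a≡ = neg-mid ea eb

    τ : V → V
    τ = transpose a b

    comm : ∀ k → τ (neg k) ≡ neg (τ k)
    comm k = trans (cong₂ (λ a b → transpose a b (neg k)) a≡ (sym (neg-swap a≡))) (transpose-opposite a b k)

    w : Word n
    w = swap n (word x) a b

    at-w : ∀ k → lookup w k ≡ at x (τ k)
    at-w k = lookup∘tabulate (λ c → at x (τ c)) k

    y : SW
    y = mk w (relabel x τ (transpose-involutive a b) comm w at-w)

    adj : toℕ b ≡ suc (toℕ a)
    adj = trans eb (sym ea)

    at-y-a : at y a ≡ at x b
    at-y-a = trans (at-w a) (cong (at x) (transposeˡ a b))

    at-y-b : at y b ≡ at x a
    at-y-b = trans (at-w b) (cong (at x) (transposeʳ a b))

    pos-y : ∀ v → pos y v ≡ τ (pos x v)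
    pos-y = relabel-pos x y τ (transpose-involutive a b) at-w

    edge-y : Edge x y (at x a) (at x b)
    edge-y = record
      { before = bef-at x refl refl (ℕₚ.≤-reflexive (sym adj))
      ; after = bef-at y at-y-a at-y-b (ℕₚ.≤-reflexive (sym adj))
      ; same = λ {c} {d} b → helper {c} {d} (transpose-adjacent a _ adj b) }
      where
      helper : ∀ {c d} → (pos x c ≡ a × pos x d ≡ b) ⊎ τ (pos x c) F.< τ (pos x d) →
        bef y c d ⊎ (c ≡ at x a × d ≡ at x b) ⊎ (c ≡ neg (at x b) × d ≡ neg (at x a))
      helper {c} {d} (inj₁ (e , e′)) = inj₂ (inj₁ (trans (sym (at-pos x c)) (cong (at x) e) , trans (sym (at-pos x d)) (cong (at x) e′)))
      helper {c} {d} (inj₂ lt) = inj₁ (subst₂ F._<_ (sym (pos-y c)) (sym (pos-y d)) lt)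

    back : swap n w a b ≡ word x
    back = trans (tabulate-cong (λ c → trans (at-w (τ c)) (cong (at x) (transpose-involutive a b c)))) (tabulate∘lookup (word x))

    swapped : Swapped x a b
    swapped = record
      { target = y ; edge = edge-y ; at-a = at-y-a ; at-b = at-y-b
      ; at-other = λ {c} _ c≢a c≢b → trans (at-w c) (cong (at x) (transpose-other a b c≢a c≢b))
      ; cov-up = cov-mid a b ea eb
      ; cov-down = λ lt → subst (Cov n w) back (cov-mid a b ea eb (subst₂ F._<_ (sym at-y-a) (sym at-y-b) lt)) }

  module SwapPair (x : SW) (a b : V) (n≤a : n ℕ.≤ toℕ a) (adj : toℕ b ≡ suc (toℕ a)) where
    n≤b : n ℕ.≤ toℕ b
    n≤b = ℕₚ.≤-trans n≤a (ℕₚ.≤-trans (ℕₚ.n≤1+n _) (ℕₚ.≤-reflexive (sym adj)))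

    σ ρ τ : V → V
    σ = transpose a b
    ρ = transpose (neg b) (neg a)
    τ k = σ (ρ k)

    σρ : ∀ k → σ (ρ k) ≡ ρ (σ k)
    σρ k with transposeView a b k | transposeView (neg b) (neg a) k
    ... | left refl e | left e′ _ = contradiction e′ (nonneg≢neg n≤a n≤b)
    ... | left refl e | right e′ _ = contradiction e′ (nonneg≢neg n≤a n≤a)
    ... | left refl e | other _ _ e′ = trans (cong σ e′) (trans e (sym (trans (cong ρ e) (transpose-other _ _ (nonneg≢neg n≤b n≤b) (nonneg≢neg n≤b n≤a)))))
    ... | right refl e | left e′ _ = contradiction e′ (nonneg≢neg n≤b n≤b)
    ... | right refl e | right e′ _ = contradiction e′ (nonneg≢neg n≤b n≤a)
    ... | right refl e | other _ _ e′ = trans (cong σ e′) (trans e (sym (trans (cong ρ e) (transpose-other _ _ (nonneg≢neg n≤a n≤b) (nonneg≢neg n≤a n≤a)))))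
    ... | other _ _ e | left refl e′ = trans (cong σ e′) (trans (transpose-other _ _ (nonneg≢neg n≤a n≤a ∘ sym) (nonneg≢neg n≤b n≤a ∘ sym)) (sym (trans (cong ρ e) e′)))
    ... | other _ _ e | right refl e′ = trans (cong σ e′) (trans (transpose-other _ _ (nonneg≢neg n≤a n≤b ∘ sym) (nonneg≢neg n≤b n≤b ∘ sym)) (sym (trans (cong ρ e) e′)))
    ... | other _ _ e | other _ _ e′ = trans (cong σ e′) (trans e (sym (trans (cong ρ e) e′)))

    τ-involutive : ∀ k → τ (τ k) ≡ k
    τ-involutive k = trans (cong σ (sym (σρ (ρ k)))) (trans (transpose-involutive a b _) (transpose-involutive (neg b) (neg a) k))

    ρ-neg : ∀ k → ρ (neg k) ≡ neg (σ k)
    ρ-neg = transpose-opposite a b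

    σ-neg : ∀ k → σ (neg k) ≡ neg (ρ k)
    σ-neg k = trans (cong₂ (λ a b → transpose a b (neg k)) (sym (neg-neg a)) (sym (neg-neg b))) (transpose-opposite (neg b) (neg a) k)

    comm : ∀ k → τ (neg k) ≡ neg (τ k)
    comm k = trans (cong σ (ρ-neg k)) (trans (σ-neg (σ k)) (cong neg (sym (σρ k))))

    w : Word n
    w = swap n (swap n (word x) a b) (neg b) (neg a)

    at-w : ∀ k → lookup w k ≡ at x (τ k)
    at-w k = trans (lookup∘tabulate (λ c → lookup (swap n (word x) a b) (ρ c)) k) (lookup∘tabulate (λ c → at x (σ c)) (ρ k))

    y : SW
    y = mk w (relabel x τ τ-involutive comm w at-w)

    τ-a : τ a ≡ b
    τ-a = trans (cong σ (transpose-other _ _ (nonneg≢neg n≤a n≤b) (nonneg≢neg n≤a n≤a))) (transposeˡ a b)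

    τ-b : τ b ≡ a
    τ-b = trans (cong σ (transpose-other _ _ (nonneg≢neg n≤b n≤b) (nonneg≢neg n≤b n≤a))) (transposeʳ a b)

    at-y-a : at y a ≡ at x b
    at-y-a = trans (at-w a) (cong (at x) τ-a)

    at-y-b : at y b ≡ at x a
    at-y-b = trans (at-w b) (cong (at x) τ-b)

    pos-y : ∀ v → pos y v ≡ τ (pos x v)
    pos-y = relabel-pos x y τ τ-involutive at-w

    edge-y : Edge x y (at x a) (at x b)
    edge-y = record
      { before = bef-at x refl refl (ℕₚ.≤-reflexive (sym adj))
      ; after = bef-at y at-y-a at-y-b (ℕₚ.≤-reflexive (sym adj))
      ; same = λ {c} {d} lt → helper {c} {d} (transpose-adjacent (neg b) (neg a) (adj-neg adj) lt) }
      where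
      value : ∀ {c k} → pos x c ≡ k → c ≡ at x k
      value {c} e = trans (sym (at-pos x c)) (cong (at x) e)
      ρ-a : ∀ {k} → ρ k ≡ a → k ≡ a
      ρ-a {k} e = trans (sym (transpose-involutive (neg b) (neg a) k)) (trans (cong ρ e) (transpose-other _ _ (nonneg≢neg n≤a n≤b) (nonneg≢neg n≤a n≤a)))
      ρ-b : ∀ {k} → ρ k ≡ b → k ≡ b
      ρ-b {k} e = trans (sym (transpose-involutive (neg b) (neg a) k)) (trans (cong ρ e) (transpose-other _ _ (nonneg≢neg n≤b n≤b) (nonneg≢neg n≤b n≤a)))
      helper : ∀ {c d} → (pos x c ≡ neg b × pos x d ≡ neg a) ⊎ ρ (pos x c) F.< ρ (pos x d) →
        bef y c d ⊎ (c ≡ at x a × d ≡ at x b) ⊎ (c ≡ neg (at x b) × d ≡ neg (at x a))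
      helper {c} {d} (inj₁ (e , e′)) = inj₂ (inj₂ (trans (value e) (at-neg x b) , trans (value e′) (at-neg x a)))
      helper {c} {d} (inj₂ lt) with transpose-adjacent a b adj lt
      ... | inj₁ (e , e′) = inj₂ (inj₁ (value (ρ-a e) , value (ρ-b e′)))
      ... | inj₂ lt′ = inj₁ (subst₂ F._<_ (sym (pos-y c)) (sym (pos-y d)) lt′)

    back : swap n (swap n w a b) (neg b) (neg a) ≡ word x
    back = trans (tabulate-cong (λ c → trans (lookup∘tabulate (λ c → lookup w (σ c)) (ρ c)) (trans (at-w (τ c)) (cong (at x) (τ-involutive c))))) (tabulate∘lookup (word x))

    swapped : Swapped x a b
    swapped = record
      { target = y ; edge = edge-y ; at-a = at-y-a ; at-b = at-y-b
      ; at-other = λ {c} n≤c c≢a c≢b → trans (at-w c) (cong (at x)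
          (trans (cong σ (transpose-other _ _ (nonneg≢neg n≤c n≤b) (nonneg≢neg n≤c n≤a))) (transpose-other a b c≢a c≢b)))
      ; cov-up = cov-pair a b n≤a adj
      ; cov-down = λ lt → subst (Cov n w) back (cov-pair a b n≤a adj (subst₂ F._<_ (sym at-y-a) (sym at-y-b) lt)) }

  abstract
    -- The case `toℕ b ≡ n` exchanges the two middle entries; any larger `b` exchanges two
    -- neighbours together with their mirror image. One adjacency condition thus covers both kinds
    -- of cover.
    exchange : ∀ x {a b} → toℕ b ≡ suc (toℕ a) → n ℕ.≤ toℕ b → Swapped x a b
    exchange x {a} {b} adj n≤b with n ℕₚ.≟ toℕ b
    ... | yes e = SwapMid.swapped x a b (trans (sym adj) (sym e)) (sym e)
    ... | no n≢b = SwapPair.swapped x a b (ℕₚ.≤-pred (subst (suc n ℕ.≤_) adj (ℕₚ.≤∧≢⇒< n≤b n≢b))) adj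

  cov⇒edge : ∀ {x : SW} {y} → Cov n (word x) y → Σ SW λ y′ → word y′ ≡ y × Σ V λ a → Σ V λ b →
    toℕ b ≡ suc (toℕ a) × n ℕ.≤ toℕ b × at x a F.< at x b × Edge x y′ (at x a) (at x b)
  cov⇒edge {x} (cov-mid a b ea eb lt) = SwapMid.y x a b ea eb , refl , a , b , SwapMid.adj x a b ea eb ,
    ℕₚ.≤-reflexive (sym eb) , lt , SwapMid.edge-y x a b ea eb
  cov⇒edge {x} (cov-pair a b n≤a adj lt) = SwapPair.y x a b n≤a adj , refl , a , b , adj ,
    SwapPair.n≤b x a b n≤a adj , lt , SwapPair.edge-y x a b n≤a adj

-- Orders on the values, and labels of edges.

module ValueOrders (n : ℕ) where
  open SignedWords n

  record VOrd : Set₁ where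
    infix 4 _≺_ _⪯_
    field
      _≺_ : V → V → Set
      ≺-trans : ∀ {u v w} → u ≺ v → v ≺ w → u ≺ w
      ≺-cmp : ∀ u v → Tri (u ≺ v) (u ≡ v) (v ≺ u)
      ≺-neg : ∀ {u v} → u ≺ v → neg v ≺ neg u

    _⪯_ : V → V → Set
    u ⪯ v = ¬ v ≺ u

    ≺-irrefl : ∀ {u v} → u ≡ v → ¬ u ≺ v
    ≺-irrefl {u} {v} e with ≺-cmp u v
    ... | tri< _ ne _ = contradiction e ne
    ... | tri≈ ¬lt _ _ = ¬lt
    ... | tri> ¬lt _ _ = ¬lt

    ≺⇒≢ : ∀ {u v} → u ≺ v → u ≢ v
    ≺⇒≢ lt e = ≺-irrefl e lt

    ≺-asym : ∀ {u v} → u ≺ v → ¬ v ≺ u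
    ≺-asym lt gt = ≺-irrefl refl (≺-trans lt gt)

    _≺?_ : ∀ u v → Dec (u ≺ v)
    u ≺? v with ≺-cmp u v
    ... | tri< lt _ _ = yes lt
    ... | tri≈ ¬lt _ _ = no ¬lt
    ... | tri> ¬lt _ _ = no ¬lt

    ≢∧⪯⇒≺ : ∀ {u v} → u ≢ v → u ⪯ v → u ≺ v
    ≢∧⪯⇒≺ {u} {v} ne le with ≺-cmp u v
    ... | tri< lt _ _ = lt
    ... | tri≈ _ e _ = contradiction e ne
    ... | tri> _ _ gt = contradiction gt le

    ≺-⪯-trans : ∀ {u v w} → u ≺ v → v ⪯ w → u ≺ w
    ≺-⪯-trans {u} {v} {w} lt le with v Fₚ.≟ w
    ... | yes refl = lt
    ... | no ne = ≺-trans lt (≢∧⪯⇒≺ ne le)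

    ⪯-≺-trans : ∀ {u v w} → u ⪯ v → v ≺ w → u ≺ w
    ⪯-≺-trans {u} {v} {w} le lt with u Fₚ.≟ v
    ... | yes refl = lt
    ... | no ne = ≺-trans (≢∧⪯⇒≺ ne le) lt

    ⪯-trans : ∀ {u v w} → u ⪯ v → v ⪯ w → u ⪯ w
    ⪯-trans le le′ gt = le (⪯-≺-trans le′ gt)

    ⪯-refl : ∀ {u} → u ⪯ u
    ⪯-refl = ≺-irrefl refl

    ≺⇒⪯ : ∀ {u v} → u ≺ v → u ⪯ v
    ≺⇒⪯ = ≺-asym

    ≡⇒⪯ : ∀ {u v} → u ≡ v → u ⪯ v
    ≡⇒⪯ e = ≺-irrefl (sym e)

    ≺-negˡ : ∀ {u v} → neg u ≺ v → neg v ≺ u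
    ≺-negˡ {u} {v} lt = subst (neg v ≺_) (neg-neg u) (≺-neg lt)

    ≺-negʳ : ∀ {u v} → u ≺ neg v → v ≺ neg u
    ≺-negʳ {u} {v} lt = subst (_≺ neg u) (neg-neg v) (≺-neg lt)

    ≺-neg⁻ : ∀ {u v} → neg u ≺ neg v → v ≺ u
    ≺-neg⁻ {u} {v} lt = subst (_≺ u) (neg-neg v) (≺-negˡ lt)

    ⪯-neg : ∀ {u v} → u ⪯ v → neg v ⪯ neg u
    ⪯-neg le lt = le (≺-neg⁻ lt)

  up : VOrd
  up = record { _≺_ = F._<_ ; ≺-trans = ℕₚ.<-trans ; ≺-cmp = Fₚ.<-cmp ; ≺-neg = opp-anti }

  op : VOrd → VOrd
  op O = record { _≺_ = flip _≺_ ; ≺-trans = flip ≺-trans ; ≺-cmp = λ u v → ≺-cmp-flip (≺-cmp u v) ; ≺-neg = ≺-neg }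
    where
    open VOrd O
    ≺-cmp-flip : ∀ {u v} → Tri (u ≺ v) (u ≡ v) (v ≺ u) → Tri (v ≺ u) (u ≡ v) (u ≺ v)
    ≺-cmp-flip (tri< a b c) = tri> c b a
    ≺-cmp-flip (tri≈ a b c) = tri≈ c b a
    ≺-cmp-flip (tri> a b c) = tri< c b a

  -- An arc with endpoints lo, hi; S marks the points to its right.
  record Label : Set where
    constructor mkL
    field
      lo hi : V
      S : V → Bool
  open Label public

  negL : Label → Label
  negL (mkL b t S) = mkL (neg t) (neg b) (λ z → not (S (neg z)))

  -- The same arc seen from the reversed order: the ends change roles, while the marks speak of
  -- positions and stay.
  revL : Label → Label
  revL (mkL b t S) = mkL t b S

  Mid : Label → Set
  Mid e = lo e ≡ neg (hi e)

  aft : SW → V → V → Bool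
  aft x b z = does (b Fₚ.<? pos x z)

  aft-true : ∀ x {b z} → b F.< pos x z → aft x b z ≡ true
  aft-true x {b} {z} lt = dec-true (b Fₚ.<? pos x z) lt

  aft-false : ∀ x {b z} → pos x z F.< b → aft x b z ≡ false
  aft-false x {b} {z} gt = dec-false (b Fₚ.<? pos x z) (ℕₚ.<-asym gt)

  aft-cases : ∀ x {b z} → z ≢ at x b → (b F.< pos x z) ⊎ (pos x z F.< b)
  aft-cases x {b} {z} ne with Fₚ.<-cmp b (pos x z)
  ... | tri< lt _ _ = inj₁ lt
  ... | tri≈ _ e _ = contradiction (trans (sym (at-pos x z)) (cong (at x) (sym e))) ne
  ... | tri> _ _ gt = inj₂ gt

  -- The mirror image of the pair at `a`, `b` occupies `neg b`, `neg a`. So standing after the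
  -- mirrored pair means standing after `neg a`, and for `neg z` this says that `z` stands before
  -- `a`. The two excluded values are the pair itself.
  aft-neg : ∀ x {a b z} → toℕ b ≡ suc (toℕ a) → z ≢ at x a → z ≢ at x b →
    aft x (neg a) (neg z) ≡ not (aft x b z)
  aft-neg x {a} {b} {z} adj z≢a z≢b with aft-cases x z≢b
  ... | inj₁ lt = trans (aft-false x (subst (F._< neg a) (sym (pos-neg x z)) (opp-anti a<z)))
                        (sym (cong not (aft-true x lt)))
    where
    a<z : a F.< pos x z
    a<z = ℕₚ.<-trans (ℕₚ.≤-reflexive (sym adj)) lt
  ... | inj₂ gt = trans (aft-true x (subst (neg a F.<_) (sym (pos-neg x z)) (opp-anti z<a)))
                        (sym (cong not (aft-false x gt)))
    where
    z<a : pos x z F.< a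
    z<a = ℕₚ.≤∧≢⇒< (ℕₚ.≤-pred (subst (toℕ (pos x z) ℕ.<_) adj gt))
      (λ e → z≢a (trans (sym (at-pos x z)) (cong (at x) (Fₚ.toℕ-injective e))))

  asc desc : SW → V → V → Label
  asc x a b = mkL (at x a) (at x b) (aft x b)
  desc x a b = mkL (at x b) (at x a) (aft x b)

-- The weak order as inclusion of inversion sets.

module Weak (n : ℕ) (O : ValueOrders.VOrd n) where
  open SignedWords n
  open ValueOrders n
  open VOrd O

  record Le (x y : SW) : Set where
    constructor incl
    field
      inv : ∀ {c d} → c ≺ d → bef x d c → bef y d c
  open Le public

  abstract
    Le? : ∀ x y → Dec (Le x y)
    Le? x y = map′ (λ h → incl (λ {c} {d} → h c d)) (λ h c d → inv h {c} {d})
      (Fₚ.all? λ c → Fₚ.all? λ d → (c ≺? d) →-dec (bef? x d c →-dec bef? y d c))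

  Le-refl : ∀ {x} → Le x x
  Le-refl = incl (λ _ b → b)

  Le-trans : ∀ {x y z} → Le x y → Le y z → Le x z
  Le-trans h h′ = incl (λ lt b → inv h′ lt (inv h lt b))

  abstract
    ¬Le⇒inversion : ∀ {x y} → ¬ Le x y → Σ V λ c → Σ V λ d → c ≺ d × bef x d c × bef y c d
    ¬Le⇒inversion {x} {y} ¬le with Fₚ.any? (λ c → Fₚ.any? λ d → (c ≺? d) ×-dec (bef? x d c ×-dec bef? y c d))
    ... | yes p = p
    ... | no ¬p = contradiction (incl (λ {c} {d} lt b → bef-total y (λ e → ≺⇒≢ lt e) (λ b′ → ¬p (c , d , lt , b , b′)))) ¬le

  edge⇒Le : ∀ {x y c d} → c ≺ d → Edge x y c d → Le x y
  edge⇒Le {x} {y} {c} {d} c≺d E = incl keep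
    where
    keep : ∀ {u v} → u ≺ v → bef x v u → bef y v u
    keep lt b with same E b
    ... | inj₁ b′ = b′
    ... | inj₂ (inj₁ (refl , refl)) = contradiction lt (≺-asym c≺d)
    ... | inj₂ (inj₂ (refl , refl)) = contradiction lt (≺-asym (≺-neg c≺d))

  -- Along an edge only `c`, `d` and the mirrored pair change their order, so this one pair decides
  -- whether a bound of `x` also bounds `y`. `edge-glb` does the same for lower bounds.
  edge-lub : ∀ {x y z c d} → Edge x y c d → Le x z → bef z d c → Le y z
  edge-lub {x} {y} {z} {c} {d} E le b = incl sub
    where
    sub : ∀ {u v} → u ≺ v → bef y v u → bef z v u
    sub lt b′ with edge-back E b′
    ... | inj₁ b″ = inv le lt b″
    ... | inj₂ (inj₁ (refl , refl)) = b
    ... | inj₂ (inj₂ (refl , refl)) = bef-neg z b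

  edge-glb : ∀ {x y z c d} → Edge x y c d → Le z y → bef z c d → Le z x
  edge-glb {x} {y} {z} {c} {d} E le b = incl sub
    where
    sub : ∀ {u v} → u ≺ v → bef z v u → bef x v u
    sub lt b′ with edge-back E (inv le lt b′)
    ... | inj₁ b″ = b″
    ... | inj₂ (inj₁ (refl , refl)) = contradiction b′ (bef-asym z b)
    ... | inj₂ (inj₂ (refl , refl)) = contradiction b′ (bef-asym z (bef-neg z b))

  edge-new : ∀ {x y z c d} → Edge x y c d → Le z y → ¬ Le z x → bef z d c
  edge-new {z = z} E le ¬le = bef-total z (edge-≢ E) (λ b → ¬le (edge-glb E le b))

  private
    N : ℕ
    N = n + n

    AscentAt : SW → V × V → Set
    AscentAt x (c , d) = c ≺ d × bef x c d

    Ascent : SW → Fin (N ℕ.* N) → Set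
    Ascent x i = AscentAt x (F.remQuot {N} N i)

    ascent? : ∀ x i → Dec (Ascent x i)
    ascent? x i = (_ ≺? _) ×-dec bef? x _ _

  -- The termination measure of `climb`. Pairs of values are coded as elements of a single finite
  -- ordinal so that `count` applies.
  ascents : SW → ℕ
  ascents x = count (ascent? x)

  ascents-edge : ∀ {x y c d} → c ≺ d → Edge x y c d → ascents y ℕ.< ascents x
  ascents-edge {x} {y} {c} {d} c≺d E = count-strict (ascent? y) (ascent? x) fewer (F.combine c d) new old
    where
    fewer : ∀ i → Ascent y i → Ascent x i
    fewer i (lt , b) = lt , bef-total x (λ e → ≺⇒≢ lt (sym e)) (λ b′ → bef-asym y b (inv (edge⇒Le c≺d E) lt b′))
    new : Ascent x (F.combine c d)
    new = subst (AscentAt x) (sym (Fₚ.remQuot-combine {N} {N} c d)) (c≺d , before E)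
    old : ¬ Ascent y (F.combine c d)
    old p = bef-asym y (proj₂ (subst (AscentAt y) (Fₚ.remQuot-combine {N} {N} c d) p)) (after E)

  -- Maximality is tested along single exchanges only, which is what a greedy climb delivers.
  Maximal : (SW → Set) → SW → Set
  Maximal P m = ∀ {a b} (adj : toℕ b ≡ suc (toℕ a)) (n≤b : n ℕ.≤ toℕ b) → at m a ≺ at m b →
    ¬ P (target (exchange m adj n≤b))

  data Step (x : SW) : SW → Set where
    step : ∀ {a b} (adj : toℕ b ≡ suc (toℕ a)) (n≤b : n ℕ.≤ toℕ b) → at x a ≺ at x b → Step x (target (exchange x adj n≤b))

  steps⇒Le : ∀ {x y} → Star Step x y → Le x y
  steps⇒Le ε = Le-refl
  steps⇒Le (step adj n≤b lt ◅ ss) = Le-trans (edge⇒Le lt (edge (exchange _ adj n≤b))) (steps⇒Le ss)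

  abstract
    climb : ∀ {P : SW → Set} → (∀ x → Dec (P x)) → ∀ x → P x → Σ SW λ m → Star Step x m × P m × Maximal P m
    climb {P} P? x px = go x (<-wellFounded (ascents x)) px
      where
      Next : SW → V → V → Set
      Next x a b = Σ (toℕ b ≡ suc (toℕ a)) λ adj → Σ (n ℕ.≤ toℕ b) λ n≤b → at x a ≺ at x b × P (target (exchange x adj n≤b))
      next? : ∀ x a b → Dec (Next x a b)
      next? x a b with toℕ b ℕₚ.≟ suc (toℕ a) | n ℕₚ.≤? toℕ b
      ... | no ¬p | _ = no (λ s → ¬p (proj₁ s))
      ... | yes _ | no ¬p = no (λ s → ¬p (proj₁ (proj₂ s)))
      ... | yes adj | yes n≤b = map′ (λ s → adj , n≤b , s) unique ((at x a ≺? at x b) ×-dec P? (target (exchange x adj n≤b)))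
        where
        unique : Next x a b → at x a ≺ at x b × P (target (exchange x adj n≤b))
        unique (adj′ , n≤b′ , lt , p) rewrite ℕₚ.≡-irrelevant adj′ adj | ℕₚ.≤-irrelevant n≤b′ n≤b = lt , p
      go : ∀ x → Acc ℕ._<_ (ascents x) → P x → Σ SW λ m → Star Step x m × P m × Maximal P m
      go x (acc rs) px with Fₚ.any? (λ a → Fₚ.any? (next? x a))
      ... | no ¬s = x , ε , px , λ adj n≤b lt p → ¬s (_ , _ , adj , n≤b , lt , p)
      ... | yes (a , b , adj , n≤b , lt , p) with go (target (exchange x adj n≤b)) (rs (ascents-edge lt (edge (exchange x adj n≤b)))) p
      ... | m , ss , rest = m , step adj n≤b lt ◅ ss , rest

  abstract
    -- On the way from `c` to `d` a value not above `c` is somewhere followed by a value above `c`.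
    -- If this happens in the left half, its mirror image is an ascent in the right half.
    adjacent-ascent : ∀ {x c d} → c ≺ d → bef x c d → Σ V λ a → Σ V λ b →
      toℕ b ≡ suc (toℕ a) × n ℕ.≤ toℕ b × at x a ≺ at x b
    adjacent-ascent {x} {c} {d} lt b with switch (λ k → ¬? (c ≺? at x k)) b (subst (λ v → ¬ c ≺ v) (sym (at-pos x c)) ⪯-refl)
                                            (λ h → h (subst (c ≺_) (sym (at-pos x d)) lt))
    ... | k , l , adj , _ , _ , k⪯ , ¬l⪯ with n ℕₚ.≤? toℕ l
    ... | yes n≤l = k , l , adj , n≤l , ⪯-≺-trans k⪯ (decidable-stable (c ≺? at x l) ¬l⪯)
    ... | no n≰l = neg l , neg k , adj-neg adj ,
          <n⇒≤neg k (ℕₚ.<-trans (ℕₚ.≤-reflexive (sym adj)) (ℕₚ.≰⇒> n≰l)) ,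
          subst₂ _≺_ (sym (at-neg x l)) (sym (at-neg x k)) (≺-neg (⪯-≺-trans k⪯ (decidable-stable (c ≺? at x l) ¬l⪯)))

  abstract
    -- Read `m` from `c` to `d` and watch the place of each entry in `y`: it starts at the place of
    -- `c` and ends before it. Two neighbours of `m` at which it drops from behind that threshold to
    -- before it are inverted in `y`, and `Le m y` then makes them an ascent of `m`.
    inverted-ascent : ∀ {m y} → Le m y → ¬ Le y m → Σ V λ a → Σ V λ b →
      toℕ b ≡ suc (toℕ a) × n ℕ.≤ toℕ b × at m a ≺ at m b × bef y (at m b) (at m a)
    inverted-ascent {m} {y} m≤y ¬y≤m with ¬Le⇒inversion ¬y≤m
    ... | c , d , c≺d , d-c , c-d with switch (λ k → pos y c Fₚ.≤? pos y (at m k)) c-d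
            (subst (λ v → pos y c F.≤ pos y v) (sym (at-pos m c)) ℕₚ.≤-refl)
            (λ h → ℕₚ.<⇒≱ d-c (subst (λ v → pos y c F.≤ pos y v) (at-pos m d) h))
    ... | k , l , adj , _ , _ , c≤k , c≰l = result (n ℕₚ.≤? toℕ l)
      where
      l-k : bef y (at m l) (at m k)
      l-k = ℕₚ.<-≤-trans (ℕₚ.≰⇒> c≰l) c≤k
      k-l : bef m (at m k) (at m l)
      k-l = bef-at m refl refl (ℕₚ.≤-reflexive (sym adj))
      k≺l : at m k ≺ at m l
      k≺l = ≢∧⪯⇒≺ (bef⇒≢ m k-l) (λ lt → bef-asym y l-k (inv m≤y lt k-l))
      result : Dec (n ℕ.≤ toℕ l) → Σ V λ a → Σ V λ b →
        toℕ b ≡ suc (toℕ a) × n ℕ.≤ toℕ b × at m a ≺ at m b × bef y (at m b) (at m a)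
      result (yes n≤l) = k , l , adj , n≤l , k≺l , l-k
      result (no n≰l) = neg l , neg k , adj-neg adj , <n⇒≤neg k (ℕₚ.<-trans (ℕₚ.≤-reflexive (sym adj)) (ℕₚ.≰⇒> n≰l)) ,
        subst₂ _≺_ (sym (at-neg m l)) (sym (at-neg m k)) (≺-neg k≺l) ,
        subst₂ (bef y) (sym (at-neg m k)) (sym (at-neg m l)) (bef-neg y l-k)

  abstract
    -- A maximal word below `y` must be `y` itself, since a missing inversion yields one more
    -- admissible step by `inverted-ascent`. Hence inclusion of inversion sets is generated by
    -- single exchanges.
    climb-to : ∀ {x y} → Le x y → Σ SW λ m → Star Step x m × word m ≡ word y
    climb-to {x} {y} x≤y with climb (λ z → Le? z y) x x≤y
    ... | m , ss , m≤y , maximal with Le? y m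
    ... | yes y≤m = m , ss , bef-determines m y agrees
      where
      agrees : ∀ {u v} → bef m u v → bef y u v
      agrees {u} {v} b with v ≺? u
      ... | yes lt = inv m≤y lt b
      ... | no v⊀u = bef-total y (bef⇒≢ m b ∘ sym) (λ b′ → bef-asym m b (inv y≤m (≢∧⪯⇒≺ (bef⇒≢ m b) v⊀u) b′))
    ... | no ¬y≤m with inverted-ascent m≤y ¬y≤m
    ... | a , b , adj , n≤b , lt , inverted = contradiction (edge-lub (edge (exchange m adj n≤b)) m≤y inverted) (maximal adj n≤b lt)

  module _ {j m m′ c d} (c≺d : c ≺ d) (E : Edge m m′ c d) (le : Le j m′) where
    -- `m′` has all inversions of `j`, and the edge places every `z` that stands before `c` before
    -- `d` as well.
    located-left : ∀ {z} → z ≺ d → bef m z c → bef j z d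
    located-left {z} z≺d b = bef-total j (≺⇒≢ z≺d ∘ sym) (λ b′ → bef-asym m′ (edge-left E b) (inv le z≺d b′))

    located-right : ∀ {z} → c ≺ z → bef m d z → bef j c z
    located-right {z} c≺z b = bef-total j (≺⇒≢ c≺z ∘ sym) (λ b′ → bef-asym m′ (edge-right E b) (inv le c≺z b′))

    -- No value strictly between c and d can stand between d and c in j,
    -- since it would stand between them in m′.
    abstract
      locate : bef j d c → Σ V λ k → Σ V λ l → toℕ l ≡ suc (toℕ k) × pos j d F.≤ k × l F.≤ pos j c ×
        d ⪯ at j k × at j l ⪯ c
      locate b with switch (λ k → ¬? (at j k ≺? d)) b (subst (λ v → ¬ v ≺ d) (sym (at-pos j d)) ⪯-refl)
                      (λ h → h (subst (_≺ d) (sym (at-pos j c)) c≺d))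
      ... | k , l , adj , d≤k , l≤c , d⪯ , ¬d⪯ = k , l , adj , d≤k , l≤c , d⪯ , l⪯c
        where
        l≺d : at j l ≺ d
        l≺d = decidable-stable (at j l ≺? d) ¬d⪯
        l⪯c : at j l ⪯ c
        l⪯c c≺l = edge-adjacent (edge-flip E) (inv le l≺d d-l) (inv le c≺l l-c)
          where
          d-l : bef j d (at j l)
          d-l = subst (pos j d F.<_) (sym (pos-at j l)) (ℕₚ.≤-<-trans d≤k (ℕₚ.≤-reflexive (sym adj)))
          l-c : bef j (at j l) c
          l-c = ℕₚ.≤∧≢⇒< (subst (F._≤ pos j c) (sym (pos-at j l)) l≤c)
                  (λ e → ≺⇒≢ c≺l (sym (pos-injective j (Fₚ.toℕ-injective e))))

  -- The subarc relation on labels, and how it arises from ascents.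

  record Asub (e e′ : Label) : Set where
    constructor asub
    field
      lo⪯ : lo e′ ⪯ lo e
      hi⪯ : hi e ⪯ hi e′
      agree : ∀ {z} → lo e ≺ z → z ≺ hi e → S e z ≡ S e′ z
  open Asub public

  Straddles : Label → Set
  Straddles e = lo e ≺ neg (lo e) × neg (hi e) ≺ hi e

  straddles? : ∀ e → Dec (Straddles e)
  straddles? e = (_ ≺? _) ×-dec (_ ≺? _)

  -- For e in the right half: either e itself or its mirror image is an arc inside e′. Only arcs whose ends
  -- have the same sign may be mirrored, and an overlapping pair is never below a symmetric arc.
  infix 4 _⊑_
  _⊑_ : Label → Label → Set
  e ⊑ e′ = (Asub e e′ × (Mid e′ → Straddles e → Mid e)) ⊎ (¬ Straddles e × Asub (negL e) e′)

  abstract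
    asub? : ∀ e e′ → Dec (Asub e e′)
    asub? e e′ = map′ (λ (p , q , r) → asub p q (λ {z} → r z)) (λ (asub p q r) → p , q , λ z → r {z})
      (¬? (_ ≺? _) ×-dec (¬? (_ ≺? _) ×-dec Fₚ.all? λ z → (_ ≺? _) →-dec ((_ ≺? _) →-dec (_ Boolₚ.≟ _))))

    _⊑?_ : ∀ e e′ → Dec (e ⊑ e′)
    e ⊑? e′ = (asub? e e′ ×-dec ((_ Fₚ.≟ _) →-dec (straddles? e →-dec (_ Fₚ.≟ _)))) ⊎-dec (¬? (straddles? e) ×-dec asub? (negL e) e′)

  asub-trans : ∀ {e f g} → Asub e f → Asub f g → Asub e g
  asub-trans (asub p q r) (asub p′ q′ r′) = asub (⪯-trans p′ p) (⪯-trans q q′)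
    (λ l h → trans (r l h) (r′ (⪯-≺-trans p l) (≺-⪯-trans h q)))

  asub-neg : ∀ {e f} → Asub e f → Asub (negL e) (negL f)
  asub-neg (asub p q r) = asub (⪯-neg q) (⪯-neg p)
    (λ l h → cong not (r (≺-negʳ h) (≺-negˡ l)))

  asub-neg⁻ : ∀ {e f} → Asub (negL e) f → Asub e (negL f)
  asub-neg⁻ {e} {f} (asub p q r) = asub
    (λ lt → q (≺-negʳ lt)) (λ lt → p (≺-negˡ lt))
    (λ {z} l h → trans (sym (trans (Boolₚ.not-involutive _) (cong (S e) (neg-neg z)))) (cong not (r (≺-neg h) (≺-neg l))))

  straddles-mono : ∀ {e f} → Asub e f → Straddles e → Straddles f
  straddles-mono (asub p q _) (s , s′) =
    ⪯-≺-trans p (≺-⪯-trans s (⪯-neg p)) , ⪯-≺-trans (⪯-neg q) (≺-⪯-trans s′ q)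

  straddles-neg : ∀ {e} → Straddles (negL e) → Straddles e
  straddles-neg (s , s′) = ≺-neg⁻ s′ , ≺-neg⁻ s

  ⊑-trans : ∀ {e f g} → e ⊑ f → f ⊑ g → e ⊑ g
  ⊑-trans (inj₁ (a , m)) (inj₁ (a′ , m′)) = inj₁ (asub-trans a a′ , λ mg s → m (m′ mg (straddles-mono a s)) s)
  ⊑-trans (inj₁ (a , m)) (inj₂ (¬s , a′)) = inj₂ ((λ s → ¬s (straddles-mono a s)) , asub-trans (asub-neg a) a′)
  ⊑-trans (inj₂ (¬s , a)) (inj₁ (a′ , m′)) = inj₂ (¬s , asub-trans a a′)
  ⊑-trans (inj₂ (¬s , a)) (inj₂ (¬s′ , a′)) = inj₁ (asub-trans (asub-neg⁻ a) a′ , λ _ s → contradiction s ¬s)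

  desc-mirror : ∀ {e} x {a b} → toℕ b ≡ suc (toℕ a) → at x b ⪯ lo e → hi e ⪯ at x a →
    Asub e (desc x a b) → Asub (negL e) (desc x (neg b) (neg a))
  desc-mirror {e} x {a} {b} adj lo⪯ hi⪯ (asub p q r) = asub
    (subst (_⪯ neg (hi e)) (sym (at-neg x a)) (⪯-neg q))
    (subst (neg (lo e) ⪯_) (sym (at-neg x b)) (⪯-neg p))
    (λ {z} l h → trans (cong not (r (≺-negʳ h) (≺-negˡ l)))
      (trans (sym (aft-neg x adj (λ e → ≺-irrefl e (≺-⪯-trans (≺-negˡ l) hi⪯)) (λ e → ≺-irrefl (sym e) (⪯-≺-trans lo⪯ (≺-negʳ h)))))
        (cong (aft x (neg a)) (neg-neg z))))

  abstract
    -- Being below `m′` but not below `m`, the word `j` inverts `c` and `d`, and `locate` finds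
    -- neighbours of `j` whose values enclose both. A value between `c` and `d` keeps its side in
    -- `j`, because `m′` has all inversions of `j`. It remains to mirror the descent found when it
    -- lies in the left half.
    label-forced : ∀ {j m a b} (adj : toℕ b ≡ suc (toℕ a)) (n≤b : n ℕ.≤ toℕ b) → at m a ≺ at m b →
      ∀ {m′} → Edge m m′ (at m a) (at m b) → Le j m′ → ¬ Le j m →
      Σ V λ k → Σ V λ l → toℕ l ≡ suc (toℕ k) × n ℕ.≤ toℕ l × at j l ≺ at j k × asc m a b ⊑ desc j k l
    label-forced {j} {m} {a} {b} adj n≤b c≺d {m′} E le ¬le with locate {j} c≺d E le (edge-new E le ¬le)
    ... | k , l , adj′ , d≤k , l≤c , d⪯t , b⪯c with n ℕₚ.≤? toℕ l
    ... | n≤l? = result n≤l?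
      where
      c d : V
      c = at m a
      d = at m b
      e : Label
      e = asc m a b
      l≺k : at j l ≺ at j k
      l≺k = ⪯-≺-trans b⪯c (≺-⪯-trans c≺d d⪯t)
      A : Asub e (desc j k l)
      A = asub b⪯c d⪯t side
        where
        side : ∀ {z} → c ≺ z → z ≺ d → aft m b z ≡ aft j l z
        side {z} c≺z z≺d with aft-cases m {b} {z} (≺⇒≢ z≺d)
        ... | inj₁ lt = trans (aft-true m lt) (sym (aft-true j
                (ℕₚ.≤-<-trans l≤c (located-right {j} c≺d E le c≺z (subst (F._< pos m z) (sym (pos-at m b)) lt)))))
        ... | inj₂ gt = trans (aft-false m gt) (sym (aft-false j
                (ℕₚ.<-trans (ℕₚ.<-≤-trans (located-left {j} c≺d E le z≺d
                  (edge-before E (subst (pos m z F.<_) (sym (pos-at m b)) gt) (λ e → ≺⇒≢ c≺z (sym e)))) d≤k) (ℕₚ.≤-reflexive (sym adj′)))))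
      -- Were `d` in the left half of `j`, having `d` before `neg d` would be an inversion of `j`,
      -- hence of `m′`. But `d` stands in the right half of `m`, and only an edge at the middle
      -- reverses `d` and `neg d`.
      right-half : Straddles e → ¬ Mid e → n ℕ.≤ toℕ k
      right-half (_ , s) ¬mid with n ℕₚ.≤? toℕ (pos j d)
      ... | yes n≤ = ℕₚ.≤-trans n≤ d≤k
      ... | no n≰ = contradiction (inv le s (subst (pos j d F.<_) (sym (pos-neg j d)) (ℕₚ.<-≤-trans (ℕₚ.≰⇒> n≰) (<n⇒≤neg _ (ℕₚ.≰⇒> n≰))))) not-in-m′
        where
        not-in-m′ : ¬ bef m′ d (neg d)
        not-in-m′ b′ with edge-back E b′
        ... | inj₁ b″ = ℕₚ.<-asym b″ (subst₂ F._<_ (sym (trans (pos-neg m d) (cong neg (pos-at m b)))) (sym (pos-at m b))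
                          (ℕₚ.<-≤-trans (≤n⇒neg<n b n≤b) n≤b))
        ... | inj₂ (inj₁ (_ , e)) = ¬mid (sym e)
        ... | inj₂ (inj₂ (e , _)) = ¬mid (sym (neg-swap e))
      result : Dec (n ℕ.≤ toℕ l) → Σ V λ k → Σ V λ l → toℕ l ≡ suc (toℕ k) × n ℕ.≤ toℕ l × at j l ≺ at j k × e ⊑ desc j k l
      result (yes n≤l) = k , l , adj′ , n≤l , l≺k , inj₁ (A , mid)
        where
        mid : Mid (desc j k l) → Straddles e → Mid e
        mid me s with c Fₚ.≟ neg d
        ... | yes p = p
        ... | no ¬p = contradiction n≤l (ℕₚ.<⇒≱ (subst (λ v → toℕ v ℕ.< n) (sym (at-injective j (trans me (sym (at-neg j k)))))
                        (≤n⇒neg<n k (right-half s ¬p))))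
      result (no n≰l) = neg l , neg k , adj-neg adj′ , <n⇒≤neg k k<n ,
          subst₂ _≺_ (sym (at-neg j k)) (sym (at-neg j l)) (≺-neg l≺k) , sub (straddles? e) (c Fₚ.≟ neg d)
        where
        k<n : toℕ k ℕ.< n
        k<n = ℕₚ.<-trans (ℕₚ.≤-reflexive (sym adj′)) (ℕₚ.≰⇒> n≰l)
        M : Asub (negL e) (desc j (neg l) (neg k))
        M = desc-mirror j adj′ b⪯c d⪯t A
        sub : Dec (Straddles e) → Dec (Mid e) → e ⊑ desc j (neg l) (neg k)
        sub (no ¬s) _ = inj₂ (¬s , M)
        sub (yes s) (no ¬mid) = contradiction (right-half s ¬mid) (ℕₚ.<⇒≱ k<n)
        -- The arc of a middle edge is its own mirror image, so the comparison `M` for the mirrored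
        -- arc is one for the arc itself.
        sub (yes s) (yes mid) = inj₁ (asub
            (subst (at j (neg k) ⪯_) (sym mid) (lo⪯ M))
            (subst (_⪯ at j (neg l)) (neg-swap mid) (hi⪯ M))
            (λ {z} l h → trans (sym-side l h) (agree M (subst (_≺ z) mid l) (subst (z ≺_) (sym (neg-swap mid)) h))) , λ _ _ → mid)
          where
          neg-a : neg a ≡ b
          neg-a = at-injective m (trans (at-neg m a) (neg-swap mid))
          sym-side : ∀ {z} → c ≺ z → z ≺ d → aft m b z ≡ not (aft m b (neg z))
          sym-side {z} l h = trans (cong₂ (aft m) (sym neg-a) (sym (neg-neg z)))
            (aft-neg m adj (λ q → ≺⇒≢ h (trans (sym (neg-neg z)) (neg-swap (trans q mid))))
                           (λ q → ≺⇒≢ l (trans mid (trans (cong neg (sym q)) (neg-neg z)))))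

-- 8 + (a - b); the subtraction is exact because all weights are at most 8.
κ : ℕ → ℕ → ℕ
κ a b = (8 + a) ∸ b

κ-sum : ∀ {a b} → a ℕ.≤ 8 → b ℕ.≤ 8 → κ a b + κ b a ≡ 16
κ-sum {a} {b} a≤ b≤ = trans (cong₂ _+_ (e b≤) (e a≤)) (trans (rearrange a (8 ∸ b) b (8 ∸ a))
    (cong₂ _+_ (ℕₚ.m+[n∸m]≡n a≤) (ℕₚ.m+[n∸m]≡n b≤)))
  where
  e : ∀ {a b} → b ℕ.≤ 8 → κ a b ≡ a + (8 ∸ b)
  e {a} {b} le = trans (cong (_∸ b) (ℕₚ.+-comm 8 a)) (ℕₚ.+-∸-assoc a le)
  rearrange : ∀ a b c d → (a + b) + (c + d) ≡ (a + d) + (c + b)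
  rearrange a b c d = trans (ℕₚ.+-assoc a b (c + d)) (trans (cong (a +_) (trans (ℕₚ.+-comm b (c + d))
    (trans (cong (_+ b) (ℕₚ.+-comm c d)) (ℕₚ.+-assoc d c b)))) (sym (ℕₚ.+-assoc a d (c + b))))

-- Signed words built by sorting.

module Words (n : ℕ) (O : ValueOrders.VOrd n) where
  open SignedWords n
  open ValueOrders n
  open VOrd O
  open Weak n O

  adjacent-pos : ∀ w {u v} → bef w u v → (∀ z → bef w u z → bef w z v → ⊥) →
    toℕ (pos w v) ≡ suc (toℕ (pos w u))
  adjacent-pos w {u} {v} b none with switch (λ k → k Fₚ.≤? pos w u) b ℕₚ.≤-refl (ℕₚ.<⇒≱ b)
  ... | a , c , adj , u≤a , c≤v , a≤u , c≰u with c Fₚ.≟ pos w v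
  ... | yes refl = trans adj (cong suc (ℕₚ.≤-antisym a≤u u≤a))
  ... | no ne = ⊥-elim (none (at w c)
          (subst (pos w u F.<_) (sym (pos-at w c)) (ℕₚ.≰⇒> c≰u))
          (subst (F._< pos w v) (sym (pos-at w c)) (Fₚ.≤∧≢⇒< c≤v ne)))

  -- The constant sum of the keys of `v` and `neg v` makes negation reverse the sorting order, so
  -- that the sorted word is signed. Ties are broken by `≺`, so values with equal keys appear in
  -- increasing order.
  module Sorted (f : V → ℕ) (M : ℕ) (f-sum : ∀ v → f v + f (neg v) ≡ M) where
    infix 4 _⊏_
    _⊏_ : V → V → Set
    u ⊏ v = f u ℕ.< f v ⊎ (f u ≡ f v × u ≺ v)

    private
      _⊏?_ : ∀ u v → Dec (u ⊏ v)
      u ⊏? v = (f u ℕₚ.<? f v) ⊎-dec ((f u ℕₚ.≟ f v) ×-dec (u ≺? v))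

      ⊏-trans : ∀ {u v w} → u ⊏ v → v ⊏ w → u ⊏ w
      ⊏-trans (inj₁ p) (inj₁ q) = inj₁ (ℕₚ.<-trans p q)
      ⊏-trans {u} (inj₁ p) (inj₂ (e , _)) = inj₁ (subst (f u ℕ.<_) e p)
      ⊏-trans {w = w} (inj₂ (e , _)) (inj₁ q) = inj₁ (subst (ℕ._< f w) (sym e) q)
      ⊏-trans (inj₂ (e , p)) (inj₂ (e′ , q)) = inj₂ (trans e e′ , ≺-trans p q)

      ⊏-irrefl : ∀ {u} → ¬ u ⊏ u
      ⊏-irrefl (inj₁ p) = ℕₚ.<-irrefl refl p
      ⊏-irrefl (inj₂ (_ , p)) = ≺-irrefl refl p

      ⊏-total : ∀ u v → u ⊏ v ⊎ u ≡ v ⊎ v ⊏ u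
      ⊏-total u v with ℕₚ.<-cmp (f u) (f v)
      ... | tri< p _ _ = inj₁ (inj₁ p)
      ... | tri> _ _ p = inj₂ (inj₂ (inj₁ p))
      ... | tri≈ _ e _ with ≺-cmp u v
      ... | tri< p _ _ = inj₁ (inj₂ (e , p))
      ... | tri≈ _ p _ = inj₂ (inj₁ p)
      ... | tri> _ _ p = inj₂ (inj₂ (inj₂ (sym e , p)))

      f-neg : ∀ v → f (neg v) ≡ M ∸ f v
      f-neg v = trans (sym (ℕₚ.m+n∸m≡n (f v) (f (neg v)))) (cong (_∸ f v) (f-sum v))

      f≤M : ∀ v → f v ℕ.≤ M
      f≤M v = ℕₚ.≤-trans (ℕₚ.m≤m+n (f v) (f (neg v))) (ℕₚ.≤-reflexive (f-sum v))

      ⊏-neg : ∀ {u v} → u ⊏ v → neg v ⊏ neg u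
      ⊏-neg {u} {v} (inj₁ p) = inj₁ (subst₂ ℕ._<_ (sym (f-neg v)) (sym (f-neg u)) (ℕₚ.∸-monoʳ-< p (f≤M v)))
      ⊏-neg {u} {v} (inj₂ (e , p)) = inj₂ (trans (f-neg v) (trans (cong (M ∸_) (sym e)) (sym (f-neg u))) , ≺-neg p)

      below : V → ℕ
      below v = count (λ u → u ⊏? v)

      below< : ∀ v → below v ℕ.< n + n
      below< v = ℕₚ.<-≤-trans (count-strict (λ u → u ⊏? v) (λ _ → yes tt) (λ _ _ → tt) v tt ⊏-irrefl) (count≤ {P = λ _ → ⊤} (λ _ → yes tt))

      rank : V → V
      rank v = fromℕ< (below< v)

      rank-mono : ∀ {u v} → u ⊏ v → rank u F.< rank v
      rank-mono {u} {v} p = subst₂ ℕ._<_ (sym (Fₚ.toℕ-fromℕ< (below< u))) (sym (Fₚ.toℕ-fromℕ< (below< v)))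
        (count-strict (λ w → w ⊏? u) (λ w → w ⊏? v) (λ w q → ⊏-trans q p) u p ⊏-irrefl)

      rank-injective : ∀ u v → rank u ≡ rank v → u ≡ v
      rank-injective u v e with ⊏-total u v
      ... | inj₁ p = contradiction (rank-mono p) (ℕₚ.<-irrefl (cong toℕ e))
      ... | inj₂ (inj₁ p) = p
      ... | inj₂ (inj₂ p) = contradiction (rank-mono p) (ℕₚ.<-irrefl (cong toℕ (sym e)))

      entry : V → V
      entry k = proj₁ (injective⇒surjective rank rank-injective k)

      rank-entry : ∀ k → rank (entry k) ≡ k
      rank-entry k = proj₂ (injective⇒surjective rank rank-injective k)

      entry-mono : ∀ {i j} → i F.< j → entry i ⊏ entry j
      entry-mono {i} {j} i<j with ⊏-total (entry i) (entry j)
      ... | inj₁ p = p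
      ... | inj₂ (inj₁ e) = contradiction (trans (sym (rank-entry i)) (trans (cong rank e) (rank-entry j))) (Fₚ.<⇒≢ i<j)
      ... | inj₂ (inj₂ p) = contradiction i<j (ℕₚ.<-asym (subst₂ F._<_ (rank-entry j) (rank-entry i) (rank-mono p)))

      -- Negation, `rank` and `entry` compose to a monotone map of positions, which must be the
      -- identity.
      entry-neg : ∀ k → entry (neg k) ≡ neg (entry k)
      entry-neg k = rank-injective _ _ (trans (rank-entry (neg k)) (neg-swap (sym
        (monotone⇒id (λ k → neg (rank (neg (entry k)))) (λ p → opp-anti (rank-mono (⊏-neg (entry-mono p)))) k))))

    abstract
      sorted : SW
      sorted = mk (tabulate entry)
        ( (λ i j e → trans (sym (rank-entry i)) (trans (cong rank (trans (sym (lookup∘tabulate entry i)) (trans e (lookup∘tabulate entry j)))) (rank-entry j)))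
        , (λ k → trans (lookup∘tabulate entry (neg k)) (trans (entry-neg k) (cong neg (sym (lookup∘tabulate entry k))))))

      sorted-bef : ∀ {u v} → u ⊏ v → bef sorted u v
      sorted-bef {u} {v} p = subst₂ F._<_ (sym (at-rank u)) (sym (at-rank v)) (rank-mono p)
        where
        at-rank : ∀ v → pos sorted v ≡ rank v
        at-rank v = pos≡ sorted (trans (lookup∘tabulate entry (rank v)) (rank-injective _ _ (rank-entry (rank v))))

    sorted-bef⁻ : ∀ {u v} → bef sorted u v → u ⊏ v
    sorted-bef⁻ {u} {v} b with ⊏-total u v
    ... | inj₁ p = p
    ... | inj₂ (inj₁ e) = contradiction b (bef-irrefl sorted e)
    ... | inj₂ (inj₂ p) = contradiction b (bef-asym sorted (sorted-bef p))

  -- Subtracting the weight of the negative antisymmetrises arbitrary weights: the keys of `v` and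
  -- `neg v` sum to 16, with 8 as the centre. The weights themselves can then be chosen without
  -- regard to symmetry.
  module Weighted (g : V → ℕ) (g≤8 : ∀ v → g v ℕ.≤ 8) where
    key : V → ℕ
    key v = κ (g v) (g (neg v))

    abstract
      key-sum : ∀ v → key v + key (neg v) ≡ 16
      key-sum v = trans (cong (λ w → key v + κ (g (neg v)) (g w)) (neg-neg v)) (κ-sum (g≤8 v) (g≤8 (neg v)))

    open Sorted key 16 key-sum public

    key≡ : ∀ {v a b} → g v ≡ a → g (neg v) ≡ b → key v ≡ κ a b
    key≡ p q = cong₂ κ p q

    key< : ∀ {u v k l} → key u ≡ k → key v ≡ l → k ℕ.< l → bef sorted u v
    key< p q lt = sorted-bef (inj₁ (subst₂ ℕ._<_ (sym p) (sym q) lt))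

    key= : ∀ {u v k} → key u ≡ k → key v ≡ k → u ≺ v → bef sorted u v
    key= p q lt = sorted-bef (inj₂ (trans p (sym q) , lt))

  -- Congruences and the labels that they contract.

  record Join (x y m : SW) : Set where
    constructor isJoin
    field
      upperˡ : Le x m
      upperʳ : Le y m
      least : ∀ {z} → Le x z → Le y z → Le m z
  open Join public

  record Meet (x y m : SW) : Set where
    constructor isMeet
    field
      lowerˡ : Le m x
      lowerʳ : Le m y
      greatest : ∀ {z} → Le z x → Le z y → Le z m
  open Meet public

  record Congruence (Θ : SW → SW → Set) : Set where
    field
      crefl : ∀ x → Θ x x
      csym : ∀ {x y} → Θ x y → Θ y x
      ctrans : ∀ {x y z} → Θ x y → Θ y z → Θ x z
      cjoin : ∀ {x₁ x₂ y₁ y₂ m₁ m₂} → Θ x₁ x₂ → Θ y₁ y₂ → Join x₁ y₁ m₁ → Join x₂ y₂ m₂ → Θ m₁ m₂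
      cmeet : ∀ {x₁ x₂ y₁ y₂ m₁ m₂} → Θ x₁ x₂ → Θ y₁ y₂ → Meet x₁ y₁ m₁ → Meet x₂ y₂ m₂ → Θ m₁ m₂

  join-≤ : ∀ {x y} → Le x y → Join x y y
  join-≤ le = isJoin le Le-refl (λ _ h → h)

  -- Only the order relative to the lower end is recorded. On an edge with this label the upper end
  -- is its neighbour, so the order relative to that end follows.
  record Sides (x : SW) (e : Label) : Set where
    constructor mkSides
    field
      toRight : ∀ {z} → lo e ≺ z → z ≺ hi e → S e z ≡ true → bef x (lo e) z
      toLeft : ∀ {z} → lo e ≺ z → z ≺ hi e → S e z ≡ false → bef x z (lo e)
  open Sides public

  Contracted : (SW → SW → Set) → Label → Set
  Contracted Θ e = ∀ {x y} → Edge x y (lo e) (hi e) → Sides x e → Θ x y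

  contracted-cong : ∀ {Θ e f} → lo e ≡ lo f → hi e ≡ hi f → (∀ {z} → lo e ≺ z → z ≺ hi e → S e z ≡ S f z) →
    Contracted Θ e → Contracted Θ f
  contracted-cong refl refl h c E s = c E (mkSides (λ l u p → toRight s l u (trans (sym (h l u)) p)) (λ l u p → toLeft s l u (trans (sym (h l u)) p)))

  sides-mirror : ∀ {x y e} → Edge x y (lo e) (hi e) → Sides x e → Sides x (negL e)
  sides-mirror {x} {y} {e} E s = mkSides
    (λ {z} l h p → subst (bef x (neg (hi e))) (neg-neg z) (bef-neg x
      (bef-trans x (toLeft s (≺-negʳ h) (≺-negˡ l) (not-true p)) (before E))))
    (λ {z} l h p → subst (λ v → bef x v (neg (hi e))) (neg-neg z) (bef-neg x
      (edge-after E (toRight s (≺-negʳ h) (≺-negˡ l) (not-false p)) (≺⇒≢ (≺-negˡ l)))))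
    where
    not-true : ∀ {b} → not b ≡ true → b ≡ false
    not-true {false} _ = refl
    not-false : ∀ {b} → not b ≡ false → b ≡ true
    not-false {true} _ = refl

  -- An edge exchanges the negatives of its two values along with the values, so it carries both
  -- labels.
  contracted-neg : ∀ {Θ e} → Contracted Θ e → Contracted Θ (negL e)
  contracted-neg {Θ} {e} c {x} {y} E s = c (subst₂ (Edge x y) (neg-neg (lo e)) (neg-neg (hi e)) (edge-mirror E)) (mkSides
      (λ {z} l h p → subst (λ v → bef x v z) (neg-neg (lo e)) (toRight s′ (l′ l) (h′ h) (trans (nn z) p)))
      (λ {z} l h p → subst (bef x z) (neg-neg (lo e)) (toLeft s′ (l′ l) (h′ h) (trans (nn z) p))))
    where
    s′ : Sides x (negL (negL e))
    s′ = sides-mirror E s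
    nn : ∀ z → not (not (S e (neg (neg z)))) ≡ S e z
    nn z = trans (Boolₚ.not-involutive _) (cong (S e) (neg-neg z))
    l′ : ∀ {z} → lo e ≺ z → neg (neg (lo e)) ≺ z
    l′ {z} = subst (_≺ z) (sym (neg-neg (lo e)))
    h′ : ∀ {z} → z ≺ hi e → z ≺ neg (neg (hi e))
    h′ {z} = subst (z ≺_) (sym (neg-neg (hi e)))

  module _ {Θ : SW → SW → Set} (C : Congruence Θ) where
    open Congruence C

    -- Joining the congruent pair `u`, `w` with `v` gives `v` and `w`.
    convex : ∀ {u v w} → Le u v → Le v w → Θ u w → Θ u v
    convex u≤v v≤w θ = ctrans θ (csym (cjoin θ (crefl _) (join-≤ u≤v) (isJoin Le-refl v≤w (λ h _ → h))))

  private
    module Op = Weak n (op O)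

  -- j is the least element of the interval below Y having t before b; it lies below
  -- the top of every edge with the same label, so such an edge is perspective to (j*, j).
  module Transfer {x y X Y b t S} (b≺t : b ≺ t)
    (E : Edge x y b t) (s : Sides x (mkL b t S)) (E′ : Edge X Y b t) (s′ : Sides X (mkL b t S)) where

    abstract
      climbed : Σ SW λ m → Star Op.Step y m × bef m t b × Op.Maximal (λ z → bef z t b) m
      climbed = Op.climb (λ z → bef? z t b) y (after E)

    private
      j : SW
      j = proj₁ climbed

      j≤y : ∀ {c d} → c ≺ d → bef j d c → bef y d c
      j≤y lt b′ = bef-total y (≺⇒≢ lt) (λ b″ → bef-asym j b′ (Op.inv (Op.steps⇒Le (proj₁ (proj₂ climbed))) lt b″))

      t-b : bef j t b
      t-b = proj₁ (proj₂ (proj₂ climbed))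

      -- Undoing any other descent would keep `t` before `b`, against the minimality of `j`.
      descent-right : ∀ {k l} (adj : toℕ l ≡ suc (toℕ k)) (n≤l : n ℕ.≤ toℕ l) → at j l ≺ at j k →
        (at j k ≡ t × at j l ≡ b) ⊎ (at j k ≡ neg b × at j l ≡ neg t)
      descent-right {k} {l} adj n≤l lt with same (edge (exchange j adj n≤l)) t-b
      ... | inj₁ b′ = contradiction b′ (proj₂ (proj₂ (proj₂ climbed)) adj n≤l lt)
      ... | inj₂ (inj₁ (p , q)) = inj₁ (sym p , sym q)
      ... | inj₂ (inj₂ (p , q)) = inj₂ (sym (neg-swap q) , sym (neg-swap p))

      descent : ∀ {k l} → toℕ l ≡ suc (toℕ k) → at j l ≺ at j k →
        (at j k ≡ t × at j l ≡ b) ⊎ (at j k ≡ neg b × at j l ≡ neg t)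
      descent {k} {l} adj lt with n ℕₚ.≤? toℕ l
      ... | yes n≤l = descent-right adj n≤l lt
      ... | no n≰l with descent-right {neg l} {neg k} (adj-neg adj) (<n⇒≤neg k (ℕₚ.<-trans (ℕₚ.≤-reflexive (sym adj)) (ℕₚ.≰⇒> n≰l)))
                      (subst₂ _≺_ (sym (at-neg j k)) (sym (at-neg j l)) (≺-neg lt))
      ... | inj₁ (p , q) = inj₂ (sym (neg-swap (trans (sym q) (at-neg j k))) , sym (neg-swap (trans (sym p) (at-neg j l))))
      ... | inj₂ (p , q) = inj₁ (neg-injective (trans (sym (at-neg j k)) q) , neg-injective (trans (sym (at-neg j l)) p))

      j-left : ∀ {z} → b ≺ z → z ≺ t → S z ≡ false → bef j z t
      j-left lb lt e = bef-total j (≺⇒≢ lt ∘ sym) (λ b′ → bef-asym y (j≤y lt b′) (edge-left E (toLeft s lb lt e)))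

      j-right : ∀ {z} → b ≺ z → z ≺ t → S z ≡ true → bef j b z
      j-right lb lt e = bef-total j (≺⇒≢ lb ∘ sym) (λ b′ → bef-asym y (j≤y lb b′)
        (edge-right E (edge-after E (toRight s lb lt e) (≺⇒≢ lt))))

      early : ∀ {d} → b ≺ d → d ⪯ t → pos j d F.≤ pos j t → d ≡ t ⊎ bef Y d t
      early {d} lb le p with d Fₚ.≟ t
      ... | yes e = inj₁ e
      ... | no ne with S d in eq
      ... | false = inj₂ (edge-left E′ (toLeft s′ lb (≢∧⪯⇒≺ ne le) eq))
      ... | true = contradiction (bef-trans j t-b (j-right lb (≢∧⪯⇒≺ ne le) eq)) (ℕₚ.≤⇒≯ p)

      late : ∀ {c} → c ≺ t → b ⪯ c → pos j b F.≤ pos j c → c ≡ b ⊎ bef Y b c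
      late {c} lt le p with c Fₚ.≟ b
      ... | yes e = inj₁ e
      ... | no ne with S c in eq
      ... | true = inj₂ (edge-right E′ (edge-after E′ (toRight s′ lb lt eq) (≺⇒≢ lt)))
        where
        lb : b ≺ c
        lb = ≢∧⪯⇒≺ (ne ∘ sym) le
      ... | false = contradiction (bef-trans j (j-left lb lt eq) t-b) (ℕₚ.≤⇒≯ p)
        where
        lb : b ≺ c
        lb = ≢∧⪯⇒≺ (ne ∘ sym) le

      inverted : ∀ {c d} → c ≺ d → b ⪯ c → d ⪯ t → pos j d F.≤ pos j t → pos j b F.≤ pos j c → bef Y d c
      inverted c≺d b⪯c d⪯t p q with early (⪯-≺-trans b⪯c c≺d) d⪯t p | late (≺-⪯-trans c≺d d⪯t) b⪯c q
      ... | inj₁ refl | inj₁ refl = after E′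
      ... | inj₁ refl | inj₂ v = bef-trans Y (after E′) v
      ... | inj₂ u | inj₁ refl = bef-trans Y u (after E′)
      ... | inj₂ u | inj₂ v = bef-trans Y u (bef-trans Y (after E′) v)

      -- Otherwise take `m` above `Y` maximal among the words not above `j`. Some ascent of `m`
      -- leads above `j`, and `locate` places its two values inside the only descent of `j`, up to
      -- mirroring. Then `early` and `late` show these values inverted in `Y`, although they are not
      -- inverted in `m`.
      j≤Y : Le j Y
      j≤Y with Le? j Y
      ... | yes le = le
      ... | no ¬le with climb (λ m → ¬? (Le? j m)) Y ¬le
      ... | m , ss , ¬j≤m , maximal with ¬Le⇒inversion ¬j≤m
      ... | u , v , u≺v , _ , asc-uv with adjacent-ascent u≺v asc-uv
      ... | a , a′ , adj , n≤a′ , c≺d with exchange m adj n≤a′ | decidable-stable (Le? j _) (maximal adj n≤a′ c≺d)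
      ... | sw | j≤m′ with locate c≺d (edge sw) j≤m′ (edge-new (edge sw) j≤m′ ¬j≤m)
      ... | k , l , adj′ , d≤k , l≤c , d⪯k , l⪯c = contradiction (inv (steps⇒Le ss) c≺d final) (bef-asym m (before (edge sw)))
        where
        final : bef Y (at m a′) (at m a)
        final with descent adj′ (⪯-≺-trans l⪯c (≺-⪯-trans c≺d d⪯k))
        ... | inj₁ (p , q) = inverted c≺d (subst (_⪯ at m a) q l⪯c) (subst (at m a′ ⪯_) p d⪯k)
               (subst (pos j (at m a′) F.≤_) (sym (pos≡ j p)) d≤k) (subst (F._≤ pos j (at m a)) (sym (pos≡ j q)) l≤c)
        ... | inj₂ (p , q) = bef-neg⁻ Y (inverted (≺-neg c≺d)
               (λ lt → d⪯k (subst (_≺ at m a′) (sym p) (≺-negˡ lt)))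
               (λ lt → l⪯c (subst (at m a ≺_) (sym q) (≺-negʳ lt)))
               (subst₂ F._≤_ (sym (pos-neg j (at m a))) (sym (pos≡ j (trans (at-neg j l) (neg-swap q)))) (opp-anti-≤ l≤c))
               (subst₂ F._≤_ (sym (pos≡ j (trans (at-neg j k) (neg-swap p)))) (sym (pos-neg j (at m a′))) (opp-anti-≤ d≤k)))

    j*-edge : Σ SW λ j* → Edge j* j b t
    j*-edge with Op.adjacent-ascent {j} b≺t t-b
    ... | a , a′ , adj , n≤a′ , lt with exchange j adj n≤a′ | descent-right adj n≤a′ lt
    ... | sw | inj₁ (p , q) = target sw , edge-flip (subst₂ (Edge j (target sw)) p q (edge sw))
    ... | sw | inj₂ (p , q) = target sw , edge-flip (subst₂ (Edge j (target sw)) (neg-swap q) (neg-swap p) (edge-mirror (edge sw)))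

    -- Meeting `X` and `Y` with `j` gives `j*` and `j`; joining `j*` and `j` with `x` gives `x` and
    -- `y`.
    transfer : ∀ {Θ} → Congruence Θ → Θ X Y → Θ x y
    transfer {Θ} C θ with j*-edge
    ... | j* , F = cjoin Θ-j (crefl x)
        (isJoin (edge-glb E (Le-trans (edge⇒Le b≺t F) j≤y′) (before F)) Le-refl (λ _ h → h))
        (isJoin j≤y′ (edge⇒Le b≺t E) (λ h h′ → edge-lub E h′ (inv h b≺t t-b)))
      where
      open Congruence C
      j≤y′ : Le j y
      j≤y′ = incl j≤y
      Θ-j : Θ j* j
      Θ-j = cmeet θ (crefl j)
        (isMeet (edge-glb E′ (Le-trans (edge⇒Le b≺t F) j≤Y) (before F)) (edge⇒Le b≺t F)
          (λ {z} h h′ → edge-glb F h′ (bef-total z (≺⇒≢ b≺t ∘ sym) (λ b′ → bef-asym X (before E′) (inv h b≺t b′)))))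
        (isMeet j≤Y Le-refl (λ _ h → h))

  contracted-by : ∀ {Θ e X Y} → Congruence Θ → lo e ≺ hi e → Edge X Y (lo e) (hi e) → Sides X e → Θ X Y → Contracted Θ e
  contracted-by C lt E′ s′ θ E s = Transfer.transfer lt E s E′ s′ C θ

-- Hexagons.

module Polygons (n : ℕ) (O : ValueOrders.VOrd n) where
  open SignedWords n
  open ValueOrders n
  open VOrd O
  open Weak n O
  open Words n O

  -- Satisfied by the labels of edges in the right half, because no value that stands after such an edge
  -- has a negative that stands after it too.
  record RightArc (e : Label) : Set where
    field
      lo≺hi : lo e ≺ hi e
      ¬mid : lo e ≢ neg (hi e)
      antisym : ∀ {z} → lo e ≺ z → z ≺ hi e → lo e ≺ neg z → neg z ≺ hi e → S e z ≡ true → S e (neg z) ≡ false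
      neg-lo : lo e ≺ neg (lo e) → neg (lo e) ≺ hi e → S e (neg (lo e)) ≡ false
      neg-hi : lo e ≺ neg (hi e) → neg (hi e) ≺ hi e → S e (neg (hi e)) ≡ false
  open RightArc public

  true≢false : ∀ {b} → b ≡ true → b ≡ false → ⊥
  true≢false refl ()

  -- In the bottom word `b`, `p`, `t` are neighbours in the right half. Their keys are 9, the
  -- negatives of these have key 7, other marked values have 10, and the other unmarked enclosed
  -- values have at most 8. The hypotheses keep the negatives of `b`, `p`, `t` out of the core and
  -- out of the values that must stand after it.
  module Hexagon {b p t : V} {S : V → Bool} (r : RightArc (mkL b t S)) (b≺p : b ≺ p) (p≺t : p ≺ t)
    (p≢-b : p ≢ neg b) (p≢-t : p ≢ neg t) (neg-p : b ≺ neg p → neg p ≺ t → S (neg p) ≡ false) where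

    private
      b≺t : b ≺ t
      b≺t = ≺-trans b≺p p≺t

      Core : V → Set
      Core v = v ≡ b ⊎ v ≡ p ⊎ v ≡ t

      core? : ∀ v → Dec (Core v)
      core? v = (v Fₚ.≟ b) ⊎-dec ((v Fₚ.≟ p) ⊎-dec (v Fₚ.≟ t))

      Late : V → Set
      Late v = b ≺ v × v ≺ t × S v ≡ true

      late? : ∀ v → Dec (Late v)
      late? v = (b ≺? v) ×-dec ((v ≺? t) ×-dec (S v Boolₚ.≟ true))

      g : V → ℕ
      g v with core? v
      ... | yes _ = 1
      ... | no _ with late? v
      ... | yes _ = 2
      ... | no _ = 0

      abstract
        g≤8 : ∀ v → g v ℕ.≤ 8
        g≤8 v with core? v
        ... | yes _ = s≤s z≤n
        ... | no _ with late? v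
        ... | yes _ = s≤s (s≤s z≤n)
        ... | no _ = z≤n

      g-core : ∀ {v} → Core v → g v ≡ 1
      g-core {v} c with core? v
      ... | yes _ = refl
      ... | no ¬c = contradiction c ¬c

      g-late : ∀ {v} → ¬ Core v → Late v → g v ≡ 2
      g-late {v} ¬c l with core? v
      ... | yes c = contradiction c ¬c
      ... | no _ with late? v
      ... | yes _ = refl
      ... | no ¬l = contradiction l ¬l

      g-else : ∀ {v} → ¬ Core v → ¬ Late v → g v ≡ 0
      g-else {v} ¬c ¬l with core? v
      ... | yes c = contradiction c ¬c
      ... | no _ with late? v
      ... | yes l = contradiction l ¬l
      ... | no _ = refl

      g-cases : ∀ v → (g v ≡ 1 × Core v) ⊎ (g v ≡ 2 × Late v × ¬ Core v) ⊎ (g v ≡ 0 × ¬ Late v × ¬ Core v)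
      g-cases v with core? v
      ... | yes c = inj₁ (refl , c)
      ... | no ¬c with late? v
      ... | yes l = inj₂ (inj₁ (refl , l , ¬c))
      ... | no ¬l = inj₂ (inj₂ (refl , ¬l , ¬c))

      open Weighted g g≤8

      ¬core-neg : ∀ {v} → Core v → ¬ Core (neg v)
      ¬core-neg (inj₁ refl) (inj₁ e) = v≢neg b (sym e)
      ¬core-neg (inj₁ refl) (inj₂ (inj₁ e)) = p≢-b (sym e)
      ¬core-neg (inj₁ refl) (inj₂ (inj₂ e)) = ¬mid r (sym (neg-swap (sym e)))
      ¬core-neg (inj₂ (inj₁ refl)) (inj₁ e) = p≢-b (sym (neg-swap (sym e)))
      ¬core-neg (inj₂ (inj₁ refl)) (inj₂ (inj₁ e)) = v≢neg p (sym e)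
      ¬core-neg (inj₂ (inj₁ refl)) (inj₂ (inj₂ e)) = p≢-t (sym (neg-swap (sym e)))
      ¬core-neg (inj₂ (inj₂ refl)) (inj₁ e) = ¬mid r (sym e)
      ¬core-neg (inj₂ (inj₂ refl)) (inj₂ (inj₁ e)) = p≢-t (sym e)
      ¬core-neg (inj₂ (inj₂ refl)) (inj₂ (inj₂ e)) = v≢neg t (sym e)

      ¬late-neg : ∀ {v} → Core v → ¬ Late (neg v)
      ¬late-neg (inj₁ refl) (l , h , e) = true≢false e (neg-lo r l h)
      ¬late-neg (inj₂ (inj₁ refl)) (l , h , e) = true≢false e (neg-p l h)
      ¬late-neg (inj₂ (inj₂ refl)) (l , h , e) = true≢false e (neg-hi r l h)

      ¬late-negL : ∀ {v} → Late v → ¬ Late (neg v)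
      ¬late-negL (l , h , e) (l′ , h′ , e′) = true≢false e′ (antisym r l h l′ h′ e)

      core-key : ∀ {v} → Core v → key v ≡ 9
      core-key c = key≡ (g-core c) (g-else (¬core-neg c) (¬late-neg c))

      late-key : ∀ {v} → ¬ Core v → Late v → key v ≡ 10
      late-key {v} ¬c l = key≡ (g-late ¬c l) (g-else (λ c → ¬late-neg c (subst Late (sym (neg-neg v)) l)) (¬late-negL l))

      κ0≤8 : ∀ b → κ 0 b ℕ.< 9
      κ0≤8 b = s≤s (ℕₚ.m∸n≤m 8 b)

      key-9 : ∀ {v} → key v ≡ 9 → Core v
      key-9 {v} e with g-cases v | g-cases (neg v)
      ... | inj₁ (_ , c) | _ = c
      ... | inj₂ (inj₂ (q , _)) | _ = contradiction (subst (ℕ._< 9) (trans (sym (key≡ q refl)) e) (κ0≤8 (g (neg v)))) (ℕₚ.<-irrefl refl)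
      -- A weight difference of 1 also arises as 2 minus 1, from a marked value whose negative is in
      -- the core; `¬late-neg` excludes it.
      ... | inj₂ (inj₁ (q , _)) | inj₁ (q′ , c) with trans (sym (key≡ {v} q q′)) e
      key-9 {v} e | inj₂ (inj₁ (q , l , _)) | inj₁ (q′ , c) | _ = contradiction (subst Late (sym (neg-neg v)) l) (¬late-neg c)
      key-9 {v} e | inj₂ (inj₁ (q , _)) | inj₂ (inj₁ (q′ , _)) with trans (sym (key≡ {v} q q′)) e
      ... | ()
      key-9 {v} e | inj₂ (inj₁ (q , _)) | inj₂ (inj₂ (q′ , _)) with trans (sym (key≡ {v} q q′)) e
      ... | ()

      W₀ : SW
      W₀ = sorted

      core-bef : ∀ {u v} → Core u → Core v → u ≺ v → bef W₀ u v
      core-bef c c′ = key= (core-key c) (core-key c′)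

      cb : Core b
      cb = inj₁ refl
      cp : Core p
      cp = inj₂ (inj₁ refl)
      ct : Core t
      ct = inj₂ (inj₂ refl)

      abstract
        between-core : ∀ {u v z} → Core u → Core v → bef W₀ u z → bef W₀ z v → Core z
        between-core {u} {v} {z} cu cv b₁ b₂ = key-9 (ℕₚ.≤-antisym
            (subst (key z ℕ.≤_) (core-key cv) (below (sorted-bef⁻ b₂)))
            (subst (ℕ._≤ key z) (core-key cu) (below (sorted-bef⁻ b₁))))
          where
          below : ∀ {x y} → x ⊏ y → key x ℕ.≤ key y
          below (inj₁ p) = ℕₚ.<⇒≤ p
          below (inj₂ (e , _)) = ℕₚ.≤-reflexive e

      b-p : toℕ (pos W₀ p) ≡ suc (toℕ (pos W₀ b))
      b-p = adjacent-pos W₀ (core-bef cb cp b≺p) none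
        where
        none : ∀ z → bef W₀ b z → bef W₀ z p → ⊥
        none z b₁ b₂ with between-core cb cp b₁ b₂
        ... | inj₁ refl = bef-irrefl W₀ refl b₁
        ... | inj₂ (inj₁ refl) = bef-irrefl W₀ refl b₂
        ... | inj₂ (inj₂ refl) = bef-asym W₀ b₂ (core-bef cp ct p≺t)

      p-t : toℕ (pos W₀ t) ≡ suc (toℕ (pos W₀ p))
      p-t = adjacent-pos W₀ (core-bef cp ct p≺t) none
        where
        none : ∀ z → bef W₀ p z → bef W₀ z t → ⊥
        none z b₁ b₂ with between-core cp ct b₁ b₂
        ... | inj₁ refl = bef-asym W₀ b₁ (core-bef cb cp b≺p)
        ... | inj₂ (inj₁ refl) = bef-irrefl W₀ refl b₁
        ... | inj₂ (inj₂ refl) = bef-irrefl W₀ refl b₂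

      core-neg-key : ∀ {v} → Core v → key (neg v) ≡ 7
      core-neg-key {v} c = key≡ {neg v} {0} {1} (g-else (¬core-neg c) (¬late-neg c)) (trans (cong g (neg-neg v)) (g-core c))

      abstract
        neg-b-first : bef W₀ (neg b) b
        neg-b-first = key< {neg b} {b} {7} {9} (core-neg-key cb) (core-key cb) (ℕₚ.n≤1+n 8)

      n≤b : n ℕ.≤ toℕ (pos W₀ b)
      n≤b with n ℕₚ.≤? toℕ (pos W₀ b)
      ... | yes le = le
      ... | no nle = contradiction
        (subst (pos W₀ b F.<_) (sym (pos-neg W₀ b)) (ℕₚ.<-≤-trans (ℕₚ.≰⇒> nle) (<n⇒≤neg _ (ℕₚ.≰⇒> nle))))
        (bef-asym W₀ neg-b-first)

      k₀ k₁ k₂ : V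
      k₀ = pos W₀ b
      k₁ = pos W₀ p
      k₂ = pos W₀ t

      k₀<k₁ : k₀ F.< k₁
      k₀<k₁ = core-bef cb cp b≺p
      k₁<k₂ : k₁ F.< k₂
      k₁<k₂ = core-bef cp ct p≺t

      n≤k₁ : n ℕ.≤ toℕ k₁
      n≤k₁ = ℕₚ.≤-trans n≤b (ℕₚ.<⇒≤ k₀<k₁)
      n≤k₂ : n ℕ.≤ toℕ k₂
      n≤k₂ = ℕₚ.≤-trans n≤k₁ (ℕₚ.<⇒≤ k₁<k₂)

      record Block (w : SW) (u v z : V) : Set where
        constructor block
        field
          at₀ : at w k₀ ≡ u
          at₁ : at w k₁ ≡ v
          at₂ : at w k₂ ≡ z

      swap₁ : ∀ {w u v z} → Block w u v z → Σ SW λ w′ → Edge w w′ u v × Block w′ v u z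
      swap₁ {w} (block refl refl refl) with exchange w b-p n≤k₁
      ... | s = target s , edge s , block (at-a s) (at-b s)
        (at-other s n≤k₂ (Fₚ.<⇒≢ (ℕₚ.<-trans k₀<k₁ k₁<k₂) ∘ sym) (Fₚ.<⇒≢ k₁<k₂ ∘ sym))

      swap₂ : ∀ {w u v z} → Block w u v z → Σ SW λ w′ → Edge w w′ v z × Block w′ u z v
      swap₂ {w} (block refl refl refl) with exchange w p-t n≤k₂
      ... | s = target s , edge s , block
        (at-other s n≤b (Fₚ.<⇒≢ k₀<k₁) (Fₚ.<⇒≢ (ℕₚ.<-trans k₀<k₁ k₁<k₂))) (at-a s) (at-b s)

      bef₁₂ : ∀ {w u v z} → Block w u v z → bef w v z
      bef₁₂ {w} B = bef-at w (Block.at₁ B) (Block.at₂ B) k₁<k₂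
      bef₀₁ : ∀ {w u v z} → Block w u v z → bef w u v
      bef₀₁ {w} B = bef-at w (Block.at₀ B) (Block.at₁ B) k₀<k₁
      bef₀₂ : ∀ {w u v z} → Block w u v z → bef w u z
      bef₀₂ {w} B = bef-at w (Block.at₀ B) (Block.at₂ B) (ℕₚ.<-trans k₀<k₁ k₁<k₂)

      B₀ : Block W₀ b p t
      B₀ = block (at-pos W₀ b) (at-pos W₀ p) (at-pos W₀ t)

      right₀ : ∀ {z} → b ≺ z → z ≺ t → z ≢ p → S z ≡ true → bef W₀ t z
      right₀ l h ne e = key< (core-key ct) (late-key (λ { (inj₁ q) → ≺⇒≢ l (sym q) ; (inj₂ (inj₁ q)) → ne q ; (inj₂ (inj₂ q)) → ≺⇒≢ h q }) (l , h , e)) ℕₚ.≤-refl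

      left₀ : ∀ {z} → b ≺ z → z ≺ t → z ≢ p → S z ≡ false → bef W₀ z b
      left₀ {z} l h ne e = key< (key≡ (g-else (λ { (inj₁ q) → ≺⇒≢ l (sym q) ; (inj₂ (inj₁ q)) → ne q ; (inj₂ (inj₂ q)) → ≺⇒≢ h q })
        (λ (_ , _ , e′) → true≢false e′ e)) refl) (core-key cb) (κ0≤8 (g (neg z)))

    module _ {Θ : SW → SW → Set} (C : Congruence Θ) where
      open Congruence C

      -- From `b p t` one chain runs through `p b t` and `p t b` to `t p b` (`W₁`, `W₃`, `W₄`), the
      -- other through `b t p` and `t b p` (`W₂`, `W₅`) to the same top. The middle edge of each
      -- chain exchanges `b` and `t`, with `p` before them in the first chain and after them in the
      -- second.
      module Chains {W₁ W₂ W₃ W₄ W₅ : SW}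
        (E₁ : Edge W₀ W₁ b p) (B₁ : Block W₁ p b t) (E₂ : Edge W₀ W₂ p t) (B₂ : Block W₂ b t p)
        (E₃ : Edge W₁ W₃ b t) (B₃ : Block W₃ p t b) (E₄ : Edge W₃ W₄ p t) (B₄ : Block W₄ t p b)
        (E₅ : Edge W₂ W₅ b t) where

        W₀≤W₁ : Le W₀ W₁
        W₀≤W₁ = edge⇒Le b≺p E₁
        W₁≤W₃ : Le W₁ W₃
        W₁≤W₃ = edge⇒Le b≺t E₃
        W₃≤W₄ : Le W₃ W₄
        W₃≤W₄ = edge⇒Le p≺t E₄
        W₁≤W₄ : Le W₁ W₄
        W₁≤W₄ = Le-trans W₁≤W₃ W₃≤W₄
        W₂≤W₄ : Le W₂ W₄
        W₂≤W₄ = edge-lub E₂ (Le-trans W₀≤W₁ W₁≤W₄) (bef₀₁ B₄)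
        W₅≤W₄ : Le W₅ W₄
        W₅≤W₄ = edge-lub E₅ W₂≤W₄ (bef₀₂ B₄)

        W₁∨W₂ : ∀ {z} → Le W₁ z → Le W₂ z → Le W₄ z
        W₁∨W₂ {z} h h′ = edge-lub E₄ (edge-lub E₃ h (bef-trans z t-p (inv h b≺p (bef₀₁ B₁)))) t-p
          where
          t-p : bef z t p
          t-p = inv h′ p≺t (bef₁₂ B₂)

        -- Joining the contracted edge from `W₀` to `W₂` with `W₁` identifies `W₁` with the top, and
        -- convexity contracts the side edge above `W₁`.
        left-side : Contracted Θ (mkL p t S) → S p ≡ false → Contracted Θ (mkL b t S)
        left-side c Sp = contracted-by C b≺t E₃ sides₁ (convex C W₁≤W₃ W₃≤W₄
            (cjoin (c E₂ sides₀) (crefl W₁) (join-≤ W₀≤W₁) (isJoin W₂≤W₄ W₁≤W₄ (λ h h′ → W₁∨W₂ h′ h))))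
          where
          sides₀ : Sides W₀ (mkL p t S)
          sides₀ = mkSides (λ l h e → bef-trans W₀ (bef₁₂ B₀) (right₀ (≺-trans b≺p l) h (≺⇒≢ l ∘ sym) e))
            (λ l h e → bef-trans W₀ (left₀ (≺-trans b≺p l) h (≺⇒≢ l ∘ sym) e) (bef₀₁ B₀))
          sides₁ : Sides W₁ (mkL b t S)
          sides₁ = mkSides
            (λ l h e → edge-keep E₁ (bef-trans W₀ (bef₀₂ B₀) (right₀ l h (λ { refl → true≢false e Sp }) e))
              (λ { (_ , refl) → true≢false e Sp }) (λ (q , _) → p≢-b (sym (neg-swap q))))
            toL
            where
            toL : ∀ {z} → b ≺ z → z ≺ t → S z ≡ false → bef W₁ z b
            toL {z} l h e with z Fₚ.≟ p
            ... | yes refl = bef₀₁ B₁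
            ... | no ne = edge-keep E₁ (left₀ l h ne e) (λ (_ , q) → ≺⇒≢ b≺p q) (λ (_ , q) → v≢neg b q)

        right-side : Contracted Θ (mkL b p S) → S p ≡ true → Contracted Θ (mkL b t S)
        right-side c Sp = contracted-by C b≺t E₅ sides₂ (convex C (edge⇒Le b≺t E₅) W₅≤W₄
            (cjoin (c E₁ sides₀) (crefl W₂) (join-≤ (edge⇒Le p≺t E₂)) (isJoin W₁≤W₄ W₂≤W₄ W₁∨W₂)))
          where
          sides₀ : Sides W₀ (mkL b p S)
          sides₀ = mkSides (λ l h e → bef-trans W₀ (bef₀₂ B₀) (right₀ l (≺-trans h p≺t) (≺⇒≢ h) e))
            (λ l h e → left₀ l (≺-trans h p≺t) (≺⇒≢ h) e)
          sides₂ : Sides W₂ (mkL b t S)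
          sides₂ = mkSides toR (λ l h e → edge-keep E₂ (left₀ l h (λ { refl → true≢false Sp e }) e)
              (λ (_ , q) → ≺⇒≢ b≺t q) (λ (_ , q) → p≢-b (sym (neg-swap q))))
            where
            toR : ∀ {z} → b ≺ z → z ≺ t → S z ≡ true → bef W₂ b z
            toR {z} l h e with z Fₚ.≟ p
            ... | yes refl = bef₀₂ B₂
            ... | no ne = edge-keep E₂ (bef-trans W₀ (bef₀₂ B₀) (right₀ l h ne e)) (λ (q , _) → ≺⇒≢ b≺p q) (λ (q , _) → ¬mid r q)

      hexagon-left : Contracted Θ (mkL p t S) → S p ≡ false → Contracted Θ (mkL b t S)
      hexagon-left with swap₁ B₀ | swap₂ B₀
      ... | W₁ , E₁ , B₁ | W₂ , E₂ , B₂ with swap₂ B₁ | swap₁ B₂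
      ... | W₃ , E₃ , B₃ | W₅ , E₅ , B₅ with swap₁ B₃
      ... | W₄ , E₄ , B₄ = Chains.left-side E₁ B₁ E₂ B₂ E₃ B₃ E₄ B₄ E₅

      hexagon-right : Contracted Θ (mkL b p S) → S p ≡ true → Contracted Θ (mkL b t S)
      hexagon-right with swap₁ B₀ | swap₂ B₀
      ... | W₁ , E₁ , B₁ | W₂ , E₂ , B₂ with swap₂ B₁ | swap₁ B₂
      ... | W₃ , E₃ , B₃ | W₅ , E₅ , B₅ with swap₁ B₃
      ... | W₄ , E₄ , B₄ = Chains.right-side E₁ B₁ E₂ B₂ E₃ B₃ E₄ B₄ E₅

-- Octagons.

module Octagons (n : ℕ) (O : ValueOrders.VOrd n) where
  open SignedWords n
  open ValueOrders n
  open VOrd O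
  open Weak n O
  open Words n O
  open Polygons n O using (true≢false)

  OctCore : V → V → V → Set
  OctCore x t v = (v ≡ x ⊎ v ≡ t) ⊎ (v ≡ neg x ⊎ v ≡ neg t)

  octCore-neg : ∀ {x t v} → OctCore x t (neg v) → OctCore x t v
  octCore-neg {v = v} (inj₁ (inj₁ e)) = inj₂ (inj₁ (sym (neg-swap (sym e))))
  octCore-neg (inj₁ (inj₂ e)) = inj₂ (inj₂ (sym (neg-swap (sym e))))
  octCore-neg (inj₂ (inj₁ e)) = inj₁ (inj₁ (neg-injective e))
  octCore-neg (inj₂ (inj₂ e)) = inj₁ (inj₂ (neg-injective e))

  -- The label `e` stays general because an octagon has side edges with different ends: `-x` and
  -- `t`, `-t` and `t`, `-t` and `x`. Each use fixes the ends, and the marks of `e` place the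
  -- remaining values; `antisymmetric` makes it possible to place a value and its negative at once.
  module Octagon {x t : V} {e : Label} (x>0 : neg x ≺ x) (x≺t : x ≺ t) (lo⪰ : neg t ⪯ lo e) (hi⪯t : hi e ⪯ t)
    (antisymmetric : ∀ {z} → ¬ OctCore x t z → lo e ≺ z → z ≺ hi e → lo e ≺ neg z → neg z ≺ hi e → S e (neg z) ≡ not (S e z)) where

    private
      Core : V → Set
      Core = OctCore x t

      core? : ∀ v → Dec (Core v)
      core? v = ((v Fₚ.≟ x) ⊎-dec (v Fₚ.≟ t)) ⊎-dec ((v Fₚ.≟ neg x) ⊎-dec (v Fₚ.≟ neg t))

      Within : V → Set
      Within v = lo e ≺ v × v ≺ hi e

      -- The weights are chosen so that κ (g v) (g (neg v)) is 8 exactly for ±x and ±t, and lies on the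
      -- side of 8 prescribed by S otherwise.
      data Kind (v : V) : ℕ → Set where
        core : Core v → Kind v 4
        later : ¬ Core v → Within v → S e v ≡ true → Kind v 8
        earlier : ¬ Core v → Within v → S e v ≡ false → Kind v 0
        positive : ¬ Core v → ¬ Within v → neg v ≺ v → Kind v 5
        negative : ¬ Core v → ¬ Within v → ¬ neg v ≺ v → Kind v 3

      classify : ∀ v → Σ ℕ (Kind v)
      classify v with core? v | (lo e ≺? v) ×-dec (v ≺? hi e) | S e v in eq | neg v ≺? v
      ... | yes c | _ | _ | _ = 4 , core c
      ... | no ¬c | yes w | true | _ = 8 , later ¬c w eq
      ... | no ¬c | yes w | false | _ = 0 , earlier ¬c w eq
      ... | no ¬c | no ¬w | _ | yes p = 5 , positive ¬c ¬w p
      ... | no ¬c | no ¬w | _ | no ¬p = 3 , negative ¬c ¬w ¬p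

      g : V → ℕ
      g v = proj₁ (classify v)

      kind : ∀ v → Kind v (g v)
      kind v = proj₂ (classify v)

      abstract
        g≤8 : ∀ v → g v ℕ.≤ 8
        g≤8 v with classify v
        ... | _ , core _ = ℕₚ.m≤m+n 4 4
        ... | _ , later _ _ _ = ℕₚ.≤-refl
        ... | _ , earlier _ _ _ = z≤n
        ... | _ , positive _ _ _ = ℕₚ.m≤m+n 5 3
        ... | _ , negative _ _ _ = ℕₚ.m≤m+n 3 5

      open Weighted g g≤8

      core-neg : ∀ {v} → Core v → Core (neg v)
      core-neg {v} c = octCore-neg (subst Core (sym (neg-neg v)) c)

      core-κ : ∀ {v a b} → Core v → Kind v a → Kind (neg v) b → κ a b ≡ 8
      core-κ c (core _) (core _) = refl
      core-κ c (core _) (later ¬c _ _) = contradiction (core-neg c) ¬c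
      core-κ c (core _) (earlier ¬c _ _) = contradiction (core-neg c) ¬c
      core-κ c (core _) (positive ¬c _ _) = contradiction (core-neg c) ¬c
      core-κ c (core _) (negative ¬c _ _) = contradiction (core-neg c) ¬c
      core-κ c (later ¬c _ _) _ = contradiction c ¬c
      core-κ c (earlier ¬c _ _) _ = contradiction c ¬c
      core-κ c (positive ¬c _ _) _ = contradiction c ¬c
      core-κ c (negative ¬c _ _) _ = contradiction c ¬c

      8-core : ∀ {v a b} → Kind v a → Kind (neg v) b → κ a b ≡ 8 → Core v
      8-core (core c) _ _ = c
      8-core (later ¬c (l , h) p) (later _ (l′ , h′) p′) _ = ⊥-elim (true≢false p′ (trans (antisymmetric ¬c l h l′ h′) (cong not p)))
      8-core (earlier ¬c (l , h) p) (earlier _ (l′ , h′) p′) _ = ⊥-elim (true≢false (trans (antisymmetric ¬c l h l′ h′) (cong not p)) p′)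
      8-core {v} (positive _ _ p) (positive _ _ p′) _ = contradiction (subst (_≺ neg v) (neg-neg v) p′) (≺-asym p)
      8-core {v} (negative _ _ p) (negative _ _ p′) _ = contradiction
        (≢∧⪯⇒≺ (v≢neg v) p) (λ lt → p′ (subst (_≺ neg v) (sym (neg-neg v)) lt))
      8-core _ (core c) _ = octCore-neg c
      8-core (later _ _ _) (earlier _ _ _) ()
      8-core (later _ _ _) (positive _ _ _) ()
      8-core (later _ _ _) (negative _ _ _) ()
      8-core (earlier _ _ _) (later _ _ _) ()
      8-core (earlier _ _ _) (positive _ _ _) ()
      8-core (earlier _ _ _) (negative _ _ _) ()
      8-core (positive _ _ _) (later _ _ _) ()
      8-core (positive _ _ _) (earlier _ _ _) ()
      8-core (positive _ _ _) (negative _ _ _) ()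
      8-core (negative _ _ _) (later _ _ _) ()
      8-core (negative _ _ _) (earlier _ _ _) ()
      8-core (negative _ _ _) (positive _ _ _) ()

      later-κ : ∀ {v a b} → ¬ Core v → Within v → S e v ≡ true → Kind v a → Kind (neg v) b → 8 ℕ.< κ a b
      later-κ ¬c _ _ _ (core c) = contradiction (octCore-neg c) ¬c
      later-κ ¬c _ _ (core c) _ = contradiction c ¬c
      later-κ ¬c _ p (earlier _ _ p′) _ = ⊥-elim (true≢false p p′)
      later-κ ¬c w _ (positive _ ¬w _) _ = contradiction w ¬w
      later-κ ¬c w _ (negative _ ¬w _) _ = contradiction w ¬w
      later-κ ¬c (l , h) p (later _ _ _) (later _ (l′ , h′) p′) = ⊥-elim (true≢false p′ (trans (antisymmetric ¬c l h l′ h′) (cong not p)))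
      later-κ _ _ _ (later _ _ _) (earlier _ _ _) = ℕₚ.m≤m+n 9 7
      later-κ _ _ _ (later _ _ _) (positive _ _ _) = ℕₚ.m≤m+n 9 2
      later-κ _ _ _ (later _ _ _) (negative _ _ _) = ℕₚ.m≤m+n 9 4

      earlier-κ : ∀ {v a b} → ¬ Core v → Within v → S e v ≡ false → Kind v a → Kind (neg v) b → κ a b ℕ.< 8
      earlier-κ ¬c _ _ _ (core c) = contradiction (octCore-neg c) ¬c
      earlier-κ ¬c _ _ (core c) _ = contradiction c ¬c
      earlier-κ ¬c _ p (later _ _ p′) _ = ⊥-elim (true≢false p′ p)
      earlier-κ ¬c w _ (positive _ ¬w _) _ = contradiction w ¬w
      earlier-κ ¬c w _ (negative _ ¬w _) _ = contradiction w ¬w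
      earlier-κ ¬c (l , h) p (earlier _ _ _) (earlier _ (l′ , h′) p′) = ⊥-elim (true≢false (trans (antisymmetric ¬c l h l′ h′) (cong not p)) p′)
      earlier-κ _ _ _ (earlier _ _ _) (later _ _ _) = ℕₚ.m≤m+n 1 7
      earlier-κ _ _ _ (earlier _ _ _) (positive _ _ _) = ℕₚ.m≤m+n 4 4
      earlier-κ _ _ _ (earlier _ _ _) (negative _ _ _) = ℕₚ.m≤m+n 6 2

      core-key : ∀ {v} → Core v → key v ≡ 8
      core-key {v} c = core-κ c (kind v) (kind (neg v))

      W₀ : SW
      W₀ = sorted

      cx : Core x
      cx = inj₁ (inj₁ refl)
      ct : Core t
      ct = inj₁ (inj₂ refl)
      c-x : Core (neg x)
      c-x = inj₂ (inj₁ refl)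
      c-t : Core (neg t)
      c-t = inj₂ (inj₂ refl)

      -t≺-x : neg t ≺ neg x
      -t≺-x = ≺-neg x≺t
      -x≺t : neg x ≺ t
      -x≺t = ≺-trans x>0 x≺t
      -t≺x : neg t ≺ x
      -t≺x = ≺-trans -t≺-x x>0
      -t≺t : neg t ≺ t
      -t≺t = ≺-trans -t≺x x≺t

      abstract
        core-bef : ∀ {u v} → Core u → Core v → u ≺ v → bef W₀ u v
        core-bef c c′ = key= (core-key c) (core-key c′)

        between-core : ∀ {u v z} → Core u → Core v → bef W₀ u z → bef W₀ z v → Core z
        between-core {u} {v} {z} cu cv b₁ b₂ = 8-core (kind z) (kind (neg z)) (ℕₚ.≤-antisym
            (subst (key z ℕ.≤_) (core-key cv) (below (sorted-bef⁻ b₂)))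
            (subst (ℕ._≤ key z) (core-key cu) (below (sorted-bef⁻ b₁))))
          where
          below : ∀ {x y} → x ⊏ y → key x ℕ.≤ key y
          below (inj₁ p) = ℕₚ.<⇒≤ p
          below (inj₂ (e , _)) = ℕₚ.≤-reflexive e

        right₀ : ∀ {z} → ¬ Core z → lo e ≺ z → z ≺ hi e → S e z ≡ true → bef W₀ t z
        right₀ {z} ¬c l h p = key< (core-key ct) refl (later-κ ¬c (l , h) p (kind z) (kind (neg z)))

        left₀ : ∀ {z} → ¬ Core z → lo e ≺ z → z ≺ hi e → S e z ≡ false → bef W₀ z (neg t)
        left₀ {z} ¬c l h p = key< refl (core-key c-t) (earlier-κ ¬c (l , h) p (kind z) (kind (neg z)))

      -x-x : toℕ (pos W₀ x) ≡ suc (toℕ (pos W₀ (neg x)))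
      -x-x = adjacent-pos W₀ (core-bef c-x cx x>0) none
        where
        none : ∀ z → bef W₀ (neg x) z → bef W₀ z x → ⊥
        none z b₁ b₂ with between-core c-x cx b₁ b₂
        ... | inj₁ (inj₁ refl) = bef-irrefl W₀ refl b₂
        ... | inj₁ (inj₂ refl) = bef-asym W₀ b₂ (core-bef cx ct x≺t)
        ... | inj₂ (inj₁ refl) = bef-irrefl W₀ refl b₁
        ... | inj₂ (inj₂ refl) = bef-asym W₀ b₁ (core-bef c-t c-x -t≺-x)

      x-t : toℕ (pos W₀ t) ≡ suc (toℕ (pos W₀ x))
      x-t = adjacent-pos W₀ (core-bef cx ct x≺t) none
        where
        none : ∀ z → bef W₀ x z → bef W₀ z t → ⊥
        none z b₁ b₂ with between-core cx ct b₁ b₂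
        ... | inj₁ (inj₁ refl) = bef-irrefl W₀ refl b₁
        ... | inj₁ (inj₂ refl) = bef-irrefl W₀ refl b₂
        ... | inj₂ (inj₁ refl) = bef-asym W₀ b₁ (core-bef c-x cx x>0)
        ... | inj₂ (inj₂ refl) = bef-asym W₀ b₁ (core-bef c-t cx -t≺x)

      k₀ k₁ : V
      k₀ = pos W₀ x
      k₁ = pos W₀ t

      k₀<k₁ : k₀ F.< k₁
      k₀<k₁ = core-bef cx ct x≺t

      n≤k₀ : n ℕ.≤ toℕ k₀
      n≤k₀ with n ℕₚ.≤? toℕ k₀
      ... | yes le = le
      ... | no nle = contradiction
        (subst (k₀ F.<_) (sym (pos-neg W₀ x)) (ℕₚ.<-≤-trans (ℕₚ.≰⇒> nle) (<n⇒≤neg k₀ (ℕₚ.≰⇒> nle))))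
        (bef-asym W₀ (core-bef c-x cx x>0))

      n≤k₁ : n ℕ.≤ toℕ k₁
      n≤k₁ = ℕₚ.≤-trans n≤k₀ (ℕₚ.<⇒≤ k₀<k₁)

      mid-adj : toℕ k₀ ≡ suc (toℕ (neg k₀))
      mid-adj = trans -x-x (cong (suc ∘ toℕ) (pos-neg W₀ x))

      record Block (w : SW) (u v : V) : Set where
        constructor block
        field
          at₀ : at w k₀ ≡ u
          at₁ : at w k₁ ≡ v

      swap-mid : ∀ {w u v} → Block w u v → Σ SW λ w′ → Edge w w′ (neg u) u × Block w′ (neg u) v
      swap-mid {w} (block refl refl) with exchange w mid-adj n≤k₀
      ... | s = target s , subst (λ c → Edge w (target s) c (at w k₀)) (at-neg w k₀) (edge s) ,
        block (trans (at-b s) (at-neg w k₀)) (at-other s n≤k₁ (Fₚ.<⇒≢ (ℕₚ.<-trans -k₀<k₀ k₀<k₁) ∘ sym) (Fₚ.<⇒≢ k₀<k₁ ∘ sym))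
        where
        -k₀<k₀ : neg k₀ F.< k₀
        -k₀<k₀ = ℕₚ.≤-reflexive (sym mid-adj)

      swap-right : ∀ {w u v} → Block w u v → Σ SW λ w′ → Edge w w′ u v × Block w′ v u
      swap-right {w} (block refl refl) with exchange w x-t n≤k₁
      ... | s = target s , edge s , block (at-a s) (at-b s)

      bef-uv : ∀ {w u v} → Block w u v → bef w u v
      bef-uv {w} (block p q) = bef-at w p q k₀<k₁

      bef₋uu : ∀ {w u v} → Block w u v → bef w (neg u) u
      bef₋uu {w} (block p q) = bef-at w (trans (at-neg w k₀) (cong neg p)) p (ℕₚ.≤-reflexive (sym mid-adj))

      bef₋uv : ∀ {w u v} → Block w u v → bef w (neg u) v
      bef₋uv {w} B = bef-trans w (bef₋uu B) (bef-uv B)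

      bef₋v-u : ∀ {w u v} → Block w u v → bef w (neg v) (neg u)
      bef₋v-u {w} B = bef-neg w (bef-uv B)

      bef₋vu : ∀ {w u v} → Block w u v → bef w (neg v) u
      bef₋vu {w} B = bef-trans w (bef₋v-u B) (bef₋uu B)

      bef₋vv : ∀ {w u v} → Block w u v → bef w (neg v) v
      bef₋vv {w} B = bef-trans w (bef₋vu B) (bef-uv B)

      B₀ : Block W₀ x t
      B₀ = block (at-pos W₀ x) (at-pos W₀ t)

      -- An edge between core values leaves every other value on its side of the core, so these
      -- sides need to be found only for `W₀`.
      record Outer (w : SW) : Set where
        field
          outerRight : ∀ {z c} → ¬ Core z → lo e ≺ z → z ≺ hi e → S e z ≡ true → Core c → bef w c z
          outerLeft : ∀ {z c} → ¬ Core z → lo e ≺ z → z ≺ hi e → S e z ≡ false → Core c → bef w z c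
      open Outer

      O₀ : Outer W₀
      O₀ = record
        { outerRight = λ ¬c l h p c → up-to-t c (right₀ ¬c l h p)
        ; outerLeft = λ ¬c l h p c → from--t c (left₀ ¬c l h p) }
        where
        up-to-t : ∀ {c z} → Core c → bef W₀ t z → bef W₀ c z
        up-to-t (inj₁ (inj₁ refl)) = bef-trans W₀ (bef-uv B₀)
        up-to-t (inj₁ (inj₂ refl)) b = b
        up-to-t (inj₂ (inj₁ refl)) = bef-trans W₀ (bef₋uv B₀)
        up-to-t (inj₂ (inj₂ refl)) = bef-trans W₀ (bef₋vv B₀)
        from--t : ∀ {c z} → Core c → bef W₀ z (neg t) → bef W₀ z c
        from--t (inj₁ (inj₁ refl)) b = bef-trans W₀ b (bef₋vu B₀)
        from--t (inj₁ (inj₂ refl)) b = bef-trans W₀ b (bef₋vv B₀)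
        from--t (inj₂ (inj₁ refl)) b = bef-trans W₀ b (bef₋v-u B₀)
        from--t (inj₂ (inj₂ refl)) b = b

      outer-edge : ∀ {w w′ u v} → Edge w w′ u v → Core u → Core v → Outer w → Outer w′
      outer-edge E cu cv o = record
        { outerRight = λ ¬c l h p c → edge-keep E (outerRight o ¬c l h p c)
            (λ { (_ , refl) → ¬c cv }) (λ { (_ , refl) → ¬c (core-neg cu) })
        ; outerLeft = λ ¬c l h p c → edge-keep E (outerLeft o ¬c l h p c)
            (λ { (refl , _) → ¬c cu }) (λ { (refl , _) → ¬c (core-neg cv) }) }

    module _ {Θ : SW → SW → Set} (C : Congruence Θ) where
      open Congruence C

      private
       -- By the two entries in the right half of the core, the words are `x t` at the bottom, then
       -- `-x t`, `t -x`, `-t -x`, `-x -t` along the `A` chain, and `t x`, `-t x`, `x -t` along the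
       -- `B` chain, whose top is again `A₄`.
       module Chains {A₁ A₂ A₃ A₄ B₁ B₂ B₃ : SW}
        (E₁ : Edge W₀ A₁ (neg x) x) (K₁ : Block A₁ (neg x) t)
        (E₂ : Edge A₁ A₂ (neg x) t) (K₂ : Block A₂ t (neg x))
        (E₃ : Edge A₂ A₃ (neg t) t) (K₃ : Block A₃ (neg t) (neg x))
        (E₄ : Edge A₃ A₄ (neg t) (neg x)) (K₄ : Block A₄ (neg x) (neg t))
        (F₁ : Edge W₀ B₁ x t) (L₁ : Block B₁ t x)
        (F₂ : Edge B₁ B₂ (neg t) t) (L₂ : Block B₂ (neg t) x)
        (F₃ : Edge B₂ B₃ (neg t) x) where

        W₀≤A₁ : Le W₀ A₁
        W₀≤A₁ = edge⇒Le x>0 E₁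
        A₁≤A₂ : Le A₁ A₂
        A₁≤A₂ = edge⇒Le -x≺t E₂
        A₂≤A₃ : Le A₂ A₃
        A₂≤A₃ = edge⇒Le -t≺t E₃
        A₃≤A₄ : Le A₃ A₄
        A₃≤A₄ = edge⇒Le -t≺-x E₄
        A₂≤A₄ : Le A₂ A₄
        A₂≤A₄ = Le-trans A₂≤A₃ A₃≤A₄
        A₁≤A₄ : Le A₁ A₄
        A₁≤A₄ = Le-trans A₁≤A₂ A₂≤A₄
        W₀≤B₁ : Le W₀ B₁
        W₀≤B₁ = edge⇒Le x≺t F₁
        B₁≤B₂ : Le B₁ B₂
        B₁≤B₂ = edge⇒Le -t≺t F₂
        B₂≤B₃ : Le B₂ B₃
        B₂≤B₃ = edge⇒Le -t≺x F₃
        B₁≤A₄ : Le B₁ A₄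
        B₁≤A₄ = edge-lub F₁ (Le-trans W₀≤A₁ A₁≤A₄) (subst₂ (bef A₄) (neg-neg t) (neg-neg x) (bef₋v-u K₄))
        B₂≤A₄ : Le B₂ A₄
        B₂≤A₄ = edge-lub F₂ B₁≤A₄ (subst (λ v → bef A₄ v (neg t)) (neg-neg t) (bef₋vv K₄))
        B₃≤A₄ : Le B₃ A₄
        B₃≤A₄ = edge-lub F₃ B₂≤A₄ (subst (λ v → bef A₄ v (neg t)) (neg-neg x) (bef₋uv K₄))

        A₁∨B₁ : ∀ {z} → Le A₁ z → Le B₁ z → Le A₄ z
        A₁∨B₁ {z} h h′ = edge-lub E₄ (edge-lub E₃ (edge-lub E₂ h t--x) (bef-trans z t--x -x--t)) -x--t
          where
          t-x : bef z t x
          t-x = inv h′ x≺t (bef-uv L₁)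
          x--x : bef z x (neg x)
          x--x = inv h x>0 (subst (λ v → bef A₁ v (neg x)) (neg-neg x) (bef₋uu K₁))
          -x--t : bef z (neg x) (neg t)
          -x--t = bef-neg z t-x
          t--x : bef z t (neg x)
          t--x = bef-trans z t-x x--x

        OA₁ : Outer A₁
        OA₁ = outer-edge E₁ c-x cx O₀
        OA₂ : Outer A₂
        OA₂ = outer-edge E₂ c-x ct OA₁
        OB₁ : Outer B₁
        OB₁ = outer-edge F₁ cx ct O₀
        OB₂ : Outer B₂
        OB₂ = outer-edge F₂ c-t ct OB₁

        sides-outer : ∀ {w b u} → Outer w → Core b → lo e ⪯ b → u ⪯ hi e →
          (∀ {z} → Core z → b ≺ z → z ≺ u → (S e z ≡ true → bef w b z) × (S e z ≡ false → bef w z b)) →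
          Sides w (mkL b u (S e))
        sides-outer {w} {b} {u} o cb l⪯ ⪯h inner = mkSides toR toL
          where
          toR : ∀ {z} → b ≺ z → z ≺ u → S e z ≡ true → bef w b z
          toR {z} l h p with core? z
          ... | yes c = proj₁ (inner c l h) p
          ... | no ¬c = outerRight o ¬c (⪯-≺-trans l⪯ l) (≺-⪯-trans h ⪯h) p cb
          toL : ∀ {z} → b ≺ z → z ≺ u → S e z ≡ false → bef w z b
          toL {z} l h p with core? z
          ... | yes c = proj₂ (inner c l h) p
          ... | no ¬c = outerLeft o ¬c (⪯-≺-trans l⪯ l) (≺-⪯-trans h ⪯h) p cb

        x-between : ∀ {z} → Core z → neg x ≺ z → z ≺ t → z ≡ x
        x-between (inj₁ (inj₁ q)) _ _ = q
        x-between (inj₁ (inj₂ q)) _ h = contradiction h (≺-irrefl q)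
        x-between (inj₂ (inj₁ q)) l _ = contradiction l (≺-irrefl (sym q))
        x-between (inj₂ (inj₂ refl)) l _ = contradiction l (≺-asym -t≺-x)

        -x-between : ∀ {z} → Core z → neg t ≺ z → z ≺ x → z ≡ neg x
        -x-between (inj₁ (inj₁ q)) _ h = contradiction h (≺-irrefl q)
        -x-between (inj₁ (inj₂ refl)) _ h = contradiction h (≺-asym x≺t)
        -x-between (inj₂ (inj₁ q)) _ _ = q
        -x-between (inj₂ (inj₂ q)) l _ = contradiction l (≺-irrefl (sym q))

        ±x-between : ∀ {z} → Core z → neg t ≺ z → z ≺ t → z ≡ x ⊎ z ≡ neg x
        ±x-between (inj₁ (inj₁ q)) _ _ = inj₁ q
        ±x-between (inj₁ (inj₂ q)) _ h = contradiction h (≺-irrefl q)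
        ±x-between (inj₂ (inj₁ q)) _ _ = inj₂ q
        ±x-between (inj₂ (inj₂ q)) l _ = contradiction l (≺-irrefl (sym q))

        none-between-xt : ∀ {z} → Core z → x ≺ z → z ≺ t → ⊥
        none-between-xt c l h with x-between c (≺-trans x>0 l) h
        ... | refl = ≺-irrefl refl l

        none-between--xx : ∀ {z} → Core z → neg x ≺ z → z ≺ x → ⊥
        none-between--xx c l h with x-between c l (≺-trans h x≺t)
        ... | refl = ≺-irrefl refl h

        -- Each bottom edge collapses the opposite chain: the middle edge `E₁` everything from `B₁`
        -- upwards, and in `Θ-A₁A₄` the edge `F₁` everything from `A₁` upwards.
        Θ-B₁A₄ : lo e ⪯ neg x → x ⪯ hi e → Contracted Θ (mkL (neg x) x (S e)) → Θ B₁ A₄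
        Θ-B₁A₄ l h c = cjoin (c E₁ (sides-outer O₀ c-x l h (λ c′ l h → ⊥-elim (none-between--xx c′ l h))))
          (crefl B₁) (join-≤ W₀≤B₁) (isJoin A₁≤A₄ B₁≤A₄ A₁∨B₁)

        Θ-A₁A₄ : lo e ⪯ x → t ⪯ hi e → Contracted Θ (mkL x t (S e)) → Θ A₁ A₄
        Θ-A₁A₄ l h c = cjoin (c F₁ (sides-outer O₀ cx l h (λ c′ l h → ⊥-elim (none-between-xt c′ l h))))
          (crefl A₁) (join-≤ W₀≤A₁) (isJoin B₁≤A₄ A₁≤A₄ (λ h h′ → A₁∨B₁ h′ h))

        -- Here and in the next three lemmas the required marks are read off the word below the side
        -- edge. Its core is `-t x -x t` in `A₁`, `x -t t -x` in `A₂`, `-x -t t x` in `B₁` and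
        -- `-x t -t x` in `B₂`.
        right→overlap : lo e ≡ neg x → hi e ≡ t → S e x ≡ false →
          Contracted Θ (mkL x t (S e)) → Contracted Θ (mkL (neg x) t (S e))
        right→overlap l≡ h≡ Sx c = contracted-by C -x≺t E₂ sides (convex C A₁≤A₂ A₂≤A₄
            (Θ-A₁A₄ (≡⇒⪯′ l≡ (≺⇒⪯ x>0)) (≡⇒⪯ (sym h≡)) c))
          where
          ≡⇒⪯′ : ∀ {u v w} → u ≡ v → v ⪯ w → u ⪯ w
          ≡⇒⪯′ refl p = p
          sides : Sides A₁ (mkL (neg x) t (S e))
          sides = sides-outer OA₁ c-x (≡⇒⪯ l≡) (≡⇒⪯ (sym h≡)) inner
            where
            inner : ∀ {z} → Core z → neg x ≺ z → z ≺ t → (S e z ≡ true → bef A₁ (neg x) z) × (S e z ≡ false → bef A₁ z (neg x))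
            inner c l h with x-between c l h
            ... | refl = (λ p → ⊥-elim (true≢false p Sx)) , (λ _ → subst (λ v → bef A₁ v (neg x)) (neg-neg x) (bef₋uu K₁))

        right→mid : lo e ≡ neg t → hi e ≡ t → S e x ≡ false → S e (neg x) ≡ true →
          Contracted Θ (mkL x t (S e)) → Contracted Θ (mkL (neg t) t (S e))
        right→mid l≡ h≡ Sx S-x c = contracted-by C -t≺t E₃ sides (convex C A₂≤A₃ A₃≤A₄
            (ctrans (csym (convex C A₁≤A₂ A₂≤A₄ θ)) θ))
          where
          θ : Θ A₁ A₄
          θ = Θ-A₁A₄ (subst (_⪯ x) (sym l≡) (≺⇒⪯ -t≺x)) (≡⇒⪯ (sym h≡)) c
          sides : Sides A₂ (mkL (neg t) t (S e))
          sides = sides-outer OA₂ c-t (≡⇒⪯ l≡) (≡⇒⪯ (sym h≡)) inner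
            where
            inner : ∀ {z} → Core z → neg t ≺ z → z ≺ t → (S e z ≡ true → bef A₂ (neg t) z) × (S e z ≡ false → bef A₂ z (neg t))
            inner c l h with ±x-between c l h
            ... | inj₁ refl = (λ p → ⊥-elim (true≢false p Sx)) , (λ _ → subst (λ v → bef A₂ v (neg t)) (neg-neg x) (bef₋v-u K₂))
            ... | inj₂ refl = (λ _ → bef₋uv K₂) , (λ p → ⊥-elim (true≢false S-x p))

        mid→mid : lo e ≡ neg t → hi e ≡ t → S e x ≡ true → S e (neg x) ≡ false →
          Contracted Θ (mkL (neg x) x (S e)) → Contracted Θ (mkL (neg t) t (S e))
        mid→mid l≡ h≡ Sx S-x c = contracted-by C -t≺t F₂ sides (convex C B₁≤B₂ B₂≤A₄ θ)
          where
          θ : Θ B₁ A₄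
          θ = Θ-B₁A₄ (subst (_⪯ neg x) (sym l≡) (≺⇒⪯ -t≺-x)) (subst (x ⪯_) (sym h≡) (≺⇒⪯ x≺t)) c
          sides : Sides B₁ (mkL (neg t) t (S e))
          sides = sides-outer OB₁ c-t (≡⇒⪯ l≡) (≡⇒⪯ (sym h≡)) inner
            where
            inner : ∀ {z} → Core z → neg t ≺ z → z ≺ t → (S e z ≡ true → bef B₁ (neg t) z) × (S e z ≡ false → bef B₁ z (neg t))
            inner c l h with ±x-between c l h
            ... | inj₁ refl = (λ _ → bef₋uv L₁) , (λ p → ⊥-elim (true≢false Sx p))
            ... | inj₂ refl = (λ p → ⊥-elim (true≢false p S-x)) , (λ _ → bef₋v-u L₁)

        mid→overlap : lo e ≡ neg t → hi e ≡ x → S e (neg x) ≡ false →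
          Contracted Θ (mkL (neg x) x (S e)) → Contracted Θ (mkL (neg t) x (S e))
        mid→overlap l≡ h≡ S-x c = contracted-by C -t≺x F₃ sides (convex C B₂≤B₃ B₃≤A₄
            (ctrans (csym (convex C B₁≤B₂ B₂≤A₄ θ)) θ))
          where
          θ : Θ B₁ A₄
          θ = Θ-B₁A₄ (subst (_⪯ neg x) (sym l≡) (≺⇒⪯ -t≺-x)) (≡⇒⪯ (sym h≡)) c
          sides : Sides B₂ (mkL (neg t) x (S e))
          sides = sides-outer OB₂ c-t (≡⇒⪯ l≡) (≡⇒⪯ (sym h≡)) inner
            where
            inner : ∀ {z} → Core z → neg t ≺ z → z ≺ x → (S e z ≡ true → bef B₂ (neg t) z) × (S e z ≡ false → bef B₂ z (neg t))
            inner c l h with -x-between c l h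
            ... | refl = (λ p → ⊥-elim (true≢false p S-x)) , (λ _ → bef₋vu L₂)

       record Elements : Set where
        field
          {A₁ A₂ A₃ A₄ B₁ B₂ B₃} : SW
          E₁ : Edge W₀ A₁ (neg x) x
          K₁ : Block A₁ (neg x) t
          E₂ : Edge A₁ A₂ (neg x) t
          K₂ : Block A₂ t (neg x)
          E₃ : Edge A₂ A₃ (neg t) t
          K₃ : Block A₃ (neg t) (neg x)
          E₄ : Edge A₃ A₄ (neg t) (neg x)
          K₄ : Block A₄ (neg x) (neg t)
          F₁ : Edge W₀ B₁ x t
          L₁ : Block B₁ t x
          F₂ : Edge B₁ B₂ (neg t) t
          L₂ : Block B₂ (neg t) x
          F₃ : Edge B₂ B₃ (neg t) x

       abstract
        elements : Elements
        elements with swap-mid B₀ | swap-right B₀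
        ... | A₁ , E₁ , K₁ | B₁ , F₁ , L₁ with swap-right K₁ | swap-mid L₁
        ... | A₂ , E₂ , K₂ | B₂ , F₂ , L₂ with swap-mid K₂ | swap-right L₂
        ... | A₃ , E₃ , K₃ | B₃ , F₃ , L₃ with swap-right K₃
        ... | A₄ , E₄ , K₄ = record { E₁ = E₁ ; K₁ = K₁ ; E₂ = E₂ ; K₂ = K₂ ; E₃ = E₃ ; K₃ = K₃ ; E₄ = E₄ ; K₄ = K₄
                                    ; F₁ = F₁ ; L₁ = L₁ ; F₂ = F₂ ; L₂ = L₂ ; F₃ = F₃ }

       open Elements elements

      open Chains E₁ K₁ E₂ K₂ E₃ K₃ E₄ K₄ F₁ L₁ F₂ L₂ F₃ public using (right→overlap; right→mid; mid→mid; mid→overlap)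

-- Passing to the reversed order.

module Duality (n : ℕ) (O : ValueOrders.VOrd n) where
  open SignedWords n
  open ValueOrders n
  open VOrd O
  open Weak n O
  open Words n O
  open Polygons n O using (RightArc)
  private
    module OpWeak = Weak n (op O)
    module OpWords = Words n (op O)
    module OpPolygons = Polygons n (op O)

  ≤⇒op : ∀ {x y} → Le x y → OpWeak.Le y x
  ≤⇒op {x} {y} h = OpWeak.incl λ lt b → bef-total x (≺⇒≢ lt ∘ sym) (λ b′ → bef-asym y b (inv h lt b′))

  op⇒≤ : ∀ {x y} → OpWeak.Le x y → Le y x
  op⇒≤ {x} {y} h = incl λ lt b → bef-total x (≺⇒≢ lt) (λ b′ → bef-asym y b (OpWeak.inv h lt b′))

  join⇒meet : ∀ {x y m} → OpWords.Join x y m → Meet x y m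
  join⇒meet (OpWords.isJoin p q r) = isMeet (op⇒≤ p) (op⇒≤ q) (λ h h′ → op⇒≤ (r (≤⇒op h) (≤⇒op h′)))

  meet⇒join : ∀ {x y m} → OpWords.Meet x y m → Join x y m
  meet⇒join (OpWords.isMeet p q r) = isJoin (op⇒≤ p) (op⇒≤ q) (λ h h′ → op⇒≤ (r (≤⇒op h) (≤⇒op h′)))

  congruence-op : ∀ {Θ} → Congruence Θ → OpWords.Congruence Θ
  congruence-op C = record
    { crefl = crefl ; csym = csym ; ctrans = ctrans
    ; cjoin = λ θ θ′ j j′ → cmeet θ θ′ (join⇒meet j) (join⇒meet j′)
    ; cmeet = λ θ θ′ m m′ → cjoin θ θ′ (meet⇒join m) (meet⇒join m′) }
    where open Congruence C

  rightArc-op : ∀ {e} → RightArc e → OpPolygons.RightArc (revL e)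
  rightArc-op r = record
    { lo≺hi = lo≺hi ; ¬mid = λ p → ¬mid (sym (neg-swap p))
    ; antisym = λ l h l′ h′ → antisym h l h′ l′
    ; neg-lo = λ l h → neg-hi h l ; neg-hi = λ l h → neg-lo h l }
    where open RightArc r

  module _ {Θ : SW → SW → Set} (C : Congruence Θ) where
    open Congruence C

    -- The edge is read backwards. Its lower end for the reversed order is the former upper end, so
    -- the sides have to be restated at the other member of the pair.
    contracted-op : ∀ {e} → Contracted Θ e → OpWords.Contracted Θ (revL e)
    contracted-op c {x} {y} E s = csym (c (edge-flip E) (mkSides
      (λ l h p → bef-trans y (after E) (edge-right E (edge-after E (OpWords.toRight s h l p) (≺⇒≢ l ∘ sym))))
      (λ l h p → edge-left E (OpWords.toLeft s h l p))))

    contracted-op⁻ : ∀ {e} → OpWords.Contracted Θ (revL e) → Contracted Θ e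
    contracted-op⁻ c {x} {y} E s = csym (c (edge-flip E) (OpWords.mkSides
      (λ l h p → bef-trans y (after E) (edge-right E (edge-after E (toRight s h l p) (≺⇒≢ l))))
      (λ l h p → edge-left E (toLeft s h l p))))

-- Enlarging a contracted arc by hexagons and octagons.

module Forcing (n : ℕ) (O : ValueOrders.VOrd n) where
  open SignedWords n
  open ValueOrders n
  open VOrd O
  open Weak n O
  open Words n O
  open Polygons n O
  open Octagons n O
  open Duality n O
  private
    module OpWords = Words n (op O)
    module OpPolygons = Polygons n (op O)
    module OpOctagons = Octagons n (op O)

  record MidArc (e : Label) : Set where
    field
      mid : Mid e
      hi>0 : neg (hi e) ≺ hi e
      antisymmetric : ∀ {z} → lo e ≺ z → z ≺ hi e → S e (neg z) ≡ not (S e z)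
  open MidArc public

  below-neg : ∀ {p z} → neg p ≺ p → p ≺ z → p ≺ neg z → ⊥
  below-neg p>0 l l′ = ≺-asym (≺-trans p>0 l) (≺-negʳ l′)

  -- No two opposite values lie above a positive `p`, so the conditions on negatives hold vacuously.
  positive-right : ∀ {p t S} → neg p ≺ p → p ≺ t → RightArc (mkL p t S)
  positive-right {p} {t} p>0 p≺t = record
    { lo≺hi = p≺t
    ; ¬mid = λ { refl → ≺-asym p>0 (subst (neg t ≺_) (sym (neg-neg t)) p≺t) }
    ; antisym = λ l _ l′ _ _ → ⊥-elim (below-neg p>0 l l′)
    ; neg-lo = λ l _ → contradiction p>0 (≺-asym l)
    ; neg-hi = λ l _ → ⊥-elim (below-neg p>0 p≺t l) }

  module _ {Θ : SW → SW → Set} (C : Congruence Θ) where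
    private
      T : V → V → (V → Bool) → Set
      T b t S = Contracted Θ (mkL b t S)

      Cᵒ : OpWords.Congruence Θ
      Cᵒ = congruence-op C

      T≡ : ∀ {b b′ t t′ S} → b ≡ b′ → t ≡ t′ → T b t S → T b′ t′ S
      T≡ p q = contracted-cong p q (λ _ _ → refl)

    module _ {b p t : V} {S : V → Bool} (r : RightArc (mkL b t S)) (b≺p : b ≺ p) (p≺t : p ≺ t)
      (p≢-b : p ≢ neg b) (p≢-t : p ≢ neg t) (neg-p : b ≺ neg p → neg p ≺ t → S (neg p) ≡ false) where
      private
        module H = Hexagon r b≺p p≺t p≢-b p≢-t neg-p
        module Hᵒ = OpPolygons.Hexagon (rightArc-op r) p≺t b≺p p≢-t p≢-b (λ l h → neg-p h l)

      -- The mark of `p` selects the side edge with ends `b`, `t`. For `p` on the left it lies on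
      -- the chain opposite to the bottom edge with ends `p`, `t`; for `p` on the right it lies
      -- opposite to the top edge with these ends, and reversing the order turns that top edge into
      -- a bottom edge.
      raise-lo : T p t S → T b t S
      raise-lo c with S p in eq
      ... | false = H.hexagon-left C c eq
      ... | true = contracted-op⁻ C (Hᵒ.hexagon-right Cᵒ (contracted-op C c) eq)

      raise-hi : T b p S → T b t S
      raise-hi c with S p in eq
      ... | true = H.hexagon-right C c eq
      ... | false = contracted-op⁻ C (Hᵒ.hexagon-left Cᵒ (contracted-op C c) eq)

    module _ {x t : V} (x>0 : neg x ≺ x) (x≺t : x ≺ t) where
      private
        x>0ᵒ : neg x ≺ neg (neg x)
        x>0ᵒ = subst (neg x ≺_) (sym (neg-neg x)) x>0

        core⇒-core : ∀ {v} → OctCore x t v → OctCore (neg x) (neg t) v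
        core⇒-core (inj₂ c) = inj₁ c
        core⇒-core (inj₁ (inj₁ e)) = inj₂ (inj₁ (trans e (sym (neg-neg x))))
        core⇒-core (inj₁ (inj₂ e)) = inj₂ (inj₂ (trans e (sym (neg-neg t))))

        Anti : V → V → (V → Bool) → Set
        Anti b u S = ∀ {z} → ¬ OctCore x t z → b ≺ z → z ≺ u → b ≺ neg z → neg z ≺ u → S (neg z) ≡ not (S z)

        not-false⁻ : ∀ {a b} → a ≡ not b → b ≡ false → a ≡ true
        not-false⁻ p refl = p
        not-true⁻ : ∀ {a b} → a ≡ not b → b ≡ true → a ≡ false
        not-true⁻ p refl = p

        -t≺x : neg t ≺ x
        -t≺x = ≺-trans (≺-neg x≺t) x>0
        -x≺t : neg x ≺ t
        -x≺t = ≺-trans x>0 x≺t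

      module _ {S : V → Bool} (m : MidArc (mkL (neg t) t S)) where
        private
          module P = Octagon {x} {t} {mkL (neg t) t S} x>0 x≺t ⪯-refl ⪯-refl (λ _ l h _ _ → antisymmetric m l h)
          module Pᵒ = OpOctagons.Octagon {neg x} {neg t} {mkL t (neg t) S} x>0ᵒ (≺-neg x≺t)
            (≡⇒⪯ (sym (neg-neg t))) ⪯-refl (λ _ l h _ _ → antisymmetric m h l)
          S-x : S (neg x) ≡ not (S x)
          S-x = antisymmetric m -t≺x x≺t

        -- The mark of `x` decides between the octagon and its dual. In the reversed order the
        -- negative values are the positive ones, so the dual octagon is built on `neg x` and
        -- `neg t`.
        mid⇒mid : T (neg x) x S → T (neg t) t S
        mid⇒mid c with S x in eq
        ... | true = P.mid→mid C refl refl eq (not-true⁻ S-x eq) c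
        ... | false = T≡ refl (neg-neg t) (contracted-op⁻ C (Pᵒ.mid→mid Cᵒ (sym (neg-neg t)) refl
                (not-false⁻ S-x eq) (trans (cong S (neg-neg x)) eq) (contracted-op C (T≡ refl (sym (neg-neg x)) c))))

        right⇒mid : T x t S → T (neg t) t S
        right⇒mid c with S x in eq
        ... | false = P.right→mid C refl refl eq (not-false⁻ S-x eq) c
        ... | true = T≡ refl (neg-neg t) (contracted-op⁻ C (Pᵒ.right→mid Cᵒ (sym (neg-neg t)) refl
                (not-true⁻ S-x eq) (trans (cong S (neg-neg x)) eq) (contracted-op C -c)))
          where
          -- The mirrored label is the one at the bottom of the dual octagon; antisymmetry of `S`
          -- undoes the complement of the marks.
          -c : T (neg t) (neg x) S
          -c = contracted-cong refl refl (λ {z} l h → trans (cong not (antisymmetric m l (≺-trans h -x≺t))) (Boolₚ.not-involutive (S z)))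
                 (contracted-neg c)

      module _ {S : V → Bool} (r : RightArc (mkL (neg x) t S)) (anti : ∀ {z} → neg x ≺ z → z ≺ x → S (neg z) ≡ not (S z)) where
        private
          Sx : S x ≡ false
          Sx = subst (λ v → S v ≡ false) (neg-neg x) (neg-lo r x>0ᵒ (subst (_≺ t) (sym (neg-neg x)) x≺t))
          anti′ : Anti (neg x) t S
          anti′ _ l _ l′ _ = anti l (≺-neg⁻ l′)
          module P = Octagon {x} {t} {mkL (neg x) t S} x>0 x≺t (≺⇒⪯ (≺-neg x≺t)) ⪯-refl anti′
          module Pᵒ = OpOctagons.Octagon {neg x} {neg t} {mkL t (neg x) S} x>0ᵒ (≺-neg x≺t)
            (≡⇒⪯ (sym (neg-neg t))) (≺⇒⪯ (≺-neg x≺t)) (λ ¬c l h l′ h′ → anti′ (¬c ∘ core⇒-core) h l h′ l′)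

        right⇒overlap : T x t S → T (neg x) t S
        right⇒overlap = P.right→overlap C refl refl Sx

        mid⇒overlap-hi : T (neg x) x S → T (neg x) t S
        mid⇒overlap-hi c = T≡ refl (neg-neg t) (contracted-op⁻ C (OpWords.contracted-cong refl refl (λ _ _ → refl)
          (Pᵒ.mid→overlap Cᵒ (sym (neg-neg t)) refl (trans (cong S (neg-neg x)) Sx) (contracted-op C (T≡ refl (sym (neg-neg x)) c)))))

      mid⇒overlap-lo : ∀ {S} → RightArc (mkL (neg t) x S) → (∀ {z} → neg x ≺ z → z ≺ x → S (neg z) ≡ not (S z)) →
        T (neg x) x S → T (neg t) x S
      mid⇒overlap-lo {S} r anti = Octagon.mid→overlap {x} {t} {mkL (neg t) x S} x>0 x≺t ⪯-refl (≺⇒⪯ x≺t)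
        (λ _ l h _ h′ → anti (subst (neg x ≺_) (neg-neg _) (≺-neg h′)) h) C refl refl (neg-hi r (≺-neg x≺t) x>0)

    raise-hi-positive : ∀ {p q t S} → neg p ≺ p → p ≺ q → q ⪯ t → T p q S → T p t S
    raise-hi-positive {p} {q} {t} p>0 p≺q q⪯t c with q Fₚ.≟ t
    ... | yes refl = c
    ... | no ne = raise-hi (positive-right p>0 (≺-⪯-trans p≺q q⪯t)) p≺q q≺t
            (λ { refl → ≺-asym p>0 p≺q })
            (λ { refl → below-neg p>0 p≺q (subst (p ≺_) (sym (neg-neg t)) (≺-trans p≺q q≺t)) })
            (λ l _ → ⊥-elim (below-neg p>0 p≺q l)) c
      where
      q≺t : q ≺ t
      q≺t = ≢∧⪯⇒≺ ne q⪯t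

    positive⇒mid : ∀ {p q t S} → MidArc (mkL (neg t) t S) → neg p ≺ p → p ≺ q → q ⪯ t → T p q S → T (neg t) t S
    positive⇒mid m p>0 p≺q q⪯t c = right⇒mid p>0 (≺-⪯-trans p≺q q⪯t) m (raise-hi-positive p>0 p≺q q⪯t c)

    -- The lower end p > 0 is brought down to b, avoiding the position of -p; when -p is in the way,
    -- an octagon is used if its interior is antisymmetric, and otherwise some z < p with ±z both
    -- to the left of the arc is a better intermediate end.
    raise-lo-positive : ∀ {b p t S} → RightArc (mkL b t S) → neg p ≺ p → b ≺ p → p ≺ t → T p t S → T b t S
    raise-lo-positive {b} {p} {t} {S} r p>0 b≺p p≺t c = result
      where
      p≢-t : ∀ {p} → neg p ≺ p → p ≺ t → p ≢ neg t
      p≢-t p>0 p≺t refl = ≺-asym p≺t (subst (_≺ neg t) (neg-neg t) p>0)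

      lower : ∀ {z} → neg z ≺ z → z ⪯ p → T z t S
      lower {z} z>0 z⪯p with z Fₚ.≟ p
      ... | yes refl = c
      ... | no ne = raise-lo (positive-right z>0 (⪯-≺-trans z⪯p p≺t)) (≢∧⪯⇒≺ ne z⪯p) p≺t
              (λ { refl → ≺-irrefl (neg-neg z) (≺-trans p>0 z>0) })
              (p≢-t p>0 p≺t)
              (λ l _ → ⊥-elim (below-neg z>0 (≢∧⪯⇒≺ ne z⪯p) l)) c

      finish : ∀ {z} → neg z ≺ z → z ⪯ p → b ≺ z → z ≢ neg b → (b ≺ neg z → neg z ≺ t → S (neg z) ≡ false) → T b t S
      finish z>0 z⪯p b≺z ne h = raise-lo r b≺z (⪯-≺-trans z⪯p p≺t) ne (p≢-t z>0 (⪯-≺-trans z⪯p p≺t)) h (lower z>0 z⪯p)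

      Free : V → Set
      Free z = neg z ≺ z × z ≺ p × b ≺ neg z × S z ≡ false × S (neg z) ≡ false

      free? : ∀ z → Dec (Free z)
      free? z = (neg z ≺? z) ×-dec ((z ≺? p) ×-dec ((b ≺? neg z) ×-dec ((S z Boolₚ.≟ false) ×-dec (S (neg z) Boolₚ.≟ false))))

      module Blocked (b⪯-p : b ⪯ neg p) where
        within : ∀ {z} → neg p ≺ z → z ≺ p → b ≺ z × z ≺ t
        within l h = ⪯-≺-trans b⪯-p l , ≺-trans h p≺t

        -- Two opposite values cannot both be marked by `RightArc`, and cannot both be unmarked in
        -- the absence of free values.
        anti-positive : (∀ z → ¬ Free z) → ∀ {z} → neg z ≺ z → z ≺ p → S (neg z) ≡ not (S z)
        anti-positive none {z} z>0 z≺p with S z in e | S (neg z) in e′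
        ... | true | false = refl
        ... | false | true = refl
        ... | false | false = contradiction (z>0 , z≺p , proj₁ (within (≺-neg z≺p) (≺-trans z>0 z≺p)) , e , e′) (none z)
        ... | true | true = ⊥-elim (true≢false e′ (antisym r l h l′ h′ e))
          where
          l : b ≺ z
          l = proj₁ (within (≺-trans (≺-neg z≺p) z>0) z≺p)
          h : z ≺ t
          h = ≺-trans z≺p p≺t
          l′ : b ≺ neg z
          l′ = proj₁ (within (≺-neg z≺p) (≺-trans z>0 z≺p))
          h′ : neg z ≺ t
          h′ = ≺-trans z>0 h

        anti : (∀ z → ¬ Free z) → ∀ {z} → neg p ≺ z → z ≺ p → S (neg z) ≡ not (S z)
        anti none {z} l h with neg z ≺? z
        ... | yes z>0 = anti-positive none z>0 h
        ... | no z≯0 = trans (sym (Boolₚ.not-involutive _)) (cong not (trans (sym (anti-positive none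
                (subst (_≺ neg z) (sym (neg-neg z)) (≢∧⪯⇒≺ (v≢neg z) z≯0)) (≺-negˡ l))) (cong S (neg-neg z))))

      result : T b t S
      result with ≺-cmp (neg p) b
      ... | tri< lt _ _ = finish p>0 ⪯-refl b≺p
              (λ { refl → ≺-irrefl (neg-neg b) lt }) (λ l _ → contradiction lt (≺-asym l))
      ... | tri≈ _ refl _ with Fₚ.any? free?
      ... | yes (z , z>0 , z≺p , l , _ , e) = finish z>0 (≺⇒⪯ z≺p) (≺-trans l z>0) (λ q → ≺⇒≢ z≺p (trans q (neg-neg p))) (λ _ _ → e)
      ... | no none = right⇒overlap p>0 p≺t r (Blocked.anti ⪯-refl (λ z f → none (z , f))) c
      result | tri> _ _ gt with S (neg p) in eq
      ... | false = finish p>0 ⪯-refl b≺p (λ q → ≺⇒≢ gt (sym (trans (cong neg q) (neg-neg b)))) (λ _ _ → eq)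
      ... | true with Fₚ.any? free?
      ... | yes (z , z>0 , z≺p , l , _ , e) = finish z>0 (≺⇒⪯ z≺p) (≺-trans l z>0) (λ q → ≺-irrefl (sym (trans (cong neg q) (neg-neg b))) l) (λ _ _ → e)
      -- The octagon brings the end down to `neg p`, and a hexagon takes it on to `b`. The negative
      -- of this intermediate end is `p`, which lies on the left because `neg p` lies on the right.
      ... | no none = raise-lo r gt (≺-trans p>0 p≺t) (λ q → ≺⇒≢ b≺p (neg-injective (sym q)))
                (λ q → ≺⇒≢ p≺t (neg-injective q)) (λ _ _ → subst (λ v → S v ≡ false) (sym (neg-neg p)) Sp)
                (right⇒overlap p>0 p≺t r′ (Blocked.anti (≺⇒⪯ gt) (λ z f → none (z , f))) c)
        where
        Sp : S p ≡ false
        Sp = subst (λ v → S v ≡ false) (neg-neg p) (antisym r gt (≺-trans p>0 p≺t)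
          (subst (b ≺_) (sym (neg-neg p)) b≺p) (subst (_≺ t) (sym (neg-neg p)) p≺t) eq)
        r′ : RightArc (mkL (neg p) t S)
        r′ = record
          { lo≺hi = ≺-trans p>0 p≺t
          ; ¬mid = λ q → ≺⇒≢ p≺t (neg-injective q)
          ; antisym = λ l h l′ h′ → antisym r (≺-trans gt l) h (≺-trans gt l′) h′
          ; neg-lo = λ _ _ → subst (λ v → S v ≡ false) (sym (neg-neg p)) Sp
          ; neg-hi = λ l _ → contradiction l (≺-asym (≺-neg p≺t)) }

    positive⇒right : ∀ {b p q t S} → RightArc (mkL b t S) → neg p ≺ p → b ⪯ p → p ≺ q → q ⪯ t → T p q S → T b t S
    positive⇒right {b} {p} r p>0 b⪯p p≺q q⪯t c with b Fₚ.≟ p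
    ... | yes refl = raise-hi-positive p>0 p≺q q⪯t c
    ... | no ne = raise-lo-positive r p>0 (≢∧⪯⇒≺ ne b⪯p) (≺-⪯-trans p≺q q⪯t) (raise-hi-positive p>0 p≺q q⪯t c)

    -- When both ends have to move, the mark of `q` dictates the order. With `q` on the left, the
    -- arc from `neg q` to `t` is a `RightArc` and the upper end moves first. With `q` on the right,
    -- `neg q` is on the left, the arc from `b` to `q` is a `RightArc`, and the lower end moves
    -- first.
    mid⇒right : ∀ {b q t S} → RightArc (mkL b t S) → neg q ≺ q → b ⪯ neg q → q ⪯ t →
      (∀ {z} → neg q ≺ z → z ≺ q → S (neg z) ≡ not (S z)) → T (neg q) q S → T b t S
    mid⇒right {b} {q} {t} {S} r q>0 b⪯-q q⪯t anti c with b Fₚ.≟ neg q | q Fₚ.≟ t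
    ... | yes refl | yes refl = contradiction refl (¬mid r)
    ... | yes refl | no q≢t = mid⇒overlap-hi q>0 (≢∧⪯⇒≺ q≢t q⪯t) r anti c
    ... | no b≢-q | yes refl = T≡ (neg-neg b) refl (mid⇒overlap-lo q>0 (≺-negʳ b≺-q)
            (subst (λ v → RightArc (mkL v q S)) (sym (neg-neg b)) r) anti c)
      where
      b≺-q : b ≺ neg q
      b≺-q = ≢∧⪯⇒≺ b≢-q b⪯-q
    ... | no b≢-q | no q≢t with S q in eq
    ... | false = raise-lo r b≺-q -q≺t (λ e → q≢-b′ e) (λ e → q≢t (neg-injective e))
            (λ _ _ → trans (cong S (neg-neg q)) eq) (mid⇒overlap-hi q>0 q≺t r′ anti c)
      where
      b≺-q : b ≺ neg q
      b≺-q = ≢∧⪯⇒≺ b≢-q b⪯-q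
      q≺t : q ≺ t
      q≺t = ≢∧⪯⇒≺ q≢t q⪯t
      -q≺t : neg q ≺ t
      -q≺t = ≺-trans q>0 q≺t
      q≢-b′ : neg q ≢ neg b
      q≢-b′ e = ≺⇒≢ (≺-trans b≺-q q>0) (sym (neg-injective e))
      r′ : RightArc (mkL (neg q) t S)
      r′ = record
        { lo≺hi = -q≺t ; ¬mid = λ e → q≢t (neg-injective e)
        ; antisym = λ l h l′ h′ → antisym r (≺-trans b≺-q l) h (≺-trans b≺-q l′) h′
        ; neg-lo = λ _ _ → trans (cong S (neg-neg q)) eq
        ; neg-hi = λ l _ → contradiction l (≺-asym (≺-neg q≺t)) }
    ... | true = raise-hi r b≺q q≺t (λ e → ≺⇒≢ b≺-q (sym (neg-swap e)))
            (λ e → ≺⇒≢ (≺-trans (≺-neg q≺t) q>0) (sym e))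
            (λ _ _ → S-q) (T≡ (neg-neg b) refl (mid⇒overlap-lo q>0 (≺-negʳ b≺-q)
              (subst (λ v → RightArc (mkL v q S)) (sym (neg-neg b)) r′) anti c))
      where
      b≺-q : b ≺ neg q
      b≺-q = ≢∧⪯⇒≺ b≢-q b⪯-q
      q≺t : q ≺ t
      q≺t = ≢∧⪯⇒≺ q≢t q⪯t
      b≺q : b ≺ q
      b≺q = ≺-trans b≺-q q>0
      S-q : S (neg q) ≡ false
      S-q = antisym r b≺q q≺t b≺-q (≺-trans q>0 q≺t) eq
      r′ : RightArc (mkL b q S)
      r′ = record
        { lo≺hi = b≺q ; ¬mid = b≢-q
        ; antisym = λ l h l′ h′ → antisym r l (≺-trans h q≺t) l′ (≺-trans h′ q≺t)
        ; neg-lo = λ l h → neg-lo r l (≺-trans h q≺t)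
        ; neg-hi = λ _ _ → S-q }

    -- A straddling arc is first extended at the end whose negative is not enclosed.
    overlap⇒right : ∀ {b p q t S} → RightArc (mkL p q S) → RightArc (mkL b t S) → p ≺ neg p → neg q ≺ q →
      b ⪯ p → q ⪯ t → T p q S → T b t S
    overlap⇒right {b} {p} {q} {t} {S} r₁ r p<0 q>0 b⪯p q⪯t c = result
      where
      p≺q : p ≺ q
      p≺q = lo≺hi r₁

      b≢-p : b ⪯ p → p ≢ neg b
      b≢-p b⪯p e = b⪯p (subst₂ _≺_ refl (trans (cong neg e) (neg-neg b)) p<0)

      q≢-t : q ⪯ t → q ≢ neg t
      q≢-t q⪯t e = q⪯t (subst (_≺ q) (trans (cong neg e) (neg-neg t)) q>0)

      up-from : ∀ {u} → RightArc (mkL u t S) → u ⪯ p → (u ≺ neg q → S (neg q) ≡ false) → q ≢ neg u → T u q S → T u t S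
      up-from {u} r u⪯p h ne c with q Fₚ.≟ t
      ... | yes refl = c
      ... | no q≢t = raise-hi r (⪯-≺-trans u⪯p p≺q) (≢∧⪯⇒≺ q≢t q⪯t) ne (q≢-t q⪯t) (λ l _ → h l) c

      down-from : ∀ {u} → RightArc (mkL b u S) → q ⪯ u → (neg p ≺ u → S (neg p) ≡ false) → p ≢ neg u → T p u S → T b u S
      down-from {u} r q⪯u h ne c with b Fₚ.≟ p
      ... | yes refl = c
      ... | no b≢p = raise-lo r (≢∧⪯⇒≺ b≢p b⪯p) (≺-⪯-trans p≺q q⪯u) (b≢-p b⪯p) ne (λ _ h′ → h h′) c

      result : T b t S
      result with ≺-cmp (neg p) q
      ... | tri≈ _ e _ = contradiction (sym (neg-swap (sym e))) (¬mid r₁)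
      ... | tri< -p≺q _ _ = down-from r q⪯t (λ _ → S-p) p≢-t (up-from r′ ⪯-refl
              (λ l → contradiction l (≺-asym (≺-negˡ -p≺q))) (λ e → ≺⇒≢ -p≺q (sym e)) c)
        where
        S-p : S (neg p) ≡ false
        S-p = neg-lo r₁ p<0 -p≺q
        p≢-t : p ≢ neg t
        p≢-t e = q⪯t (subst (_≺ q) (neg-swap e) -p≺q)
        r′ : RightArc (mkL p t S)
        r′ = record
          { lo≺hi = ≺-⪯-trans p≺q q⪯t ; ¬mid = p≢-t
          ; antisym = λ l h l′ h′ → antisym r (⪯-≺-trans b⪯p l) h (⪯-≺-trans b⪯p l′) h′
          ; neg-lo = λ _ _ → S-p
          ; neg-hi = λ l _ → contradiction (≺-trans (≺-negʳ l) -p≺q) q⪯t }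
      ... | tri> _ _ q≺-p = up-from r b⪯p (λ _ → S-q) q≢-b (down-from r′ ⪯-refl
              (λ l → contradiction l (≺-asym q≺-p)) (λ e → ≺⇒≢ q≺-p (sym (trans (cong neg e) (neg-neg q)))) c)
        where
        S-q : S (neg q) ≡ false
        S-q = neg-hi r₁ (≺-negʳ q≺-p) q>0
        q≢-b : q ≢ neg b
        q≢-b e = b⪯p (subst (p ≺_) (neg-swap e) (≺-negʳ q≺-p))
        r′ : RightArc (mkL b q S)
        r′ = record
          { lo≺hi = ⪯-≺-trans b⪯p p≺q ; ¬mid = λ e → q≢-b (sym (neg-swap e))
          ; antisym = λ l h l′ h′ → antisym r l (≺-⪯-trans h q⪯t) l′ (≺-⪯-trans h′ q⪯t)
          ; neg-lo = λ _ h → ⊥-elim (b⪯p (≺-trans (≺-negʳ q≺-p) (≺-negˡ h)))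
          ; neg-hi = λ _ _ → S-q }

-- Covers, the weak order and join-irreducible elements as defined in the statement.

module WeakOrder (n : ℕ) where
  open SignedWords n
  open ValueOrders n
  open VOrd up
  open Weak n up
  open Words n up
  open Polygons n up
  open Forcing n up
  open Duality n up
  private
    module OpWeak = Weak n (op up)
    module OpForcing = Forcing n (op up)

  word≡⇒bef : ∀ x y → word x ≡ word y → ∀ {c d} → bef x c d → bef y c d
  word≡⇒bef x y e b = subst₂ F._<_ (sym (same-pos _)) (sym (same-pos _)) b
    where
    same-pos : ∀ v → pos y v ≡ pos x v
    same-pos v = pos≡ y (trans (cong (λ w → lookup w (pos x v)) (sym e)) (at-pos x v))

  LeW⇒Le : ∀ {x y} → LeW n (word x) (word y) → Le x y
  LeW⇒Le {x} {y} = go x refl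
    where
    go : ∀ {u} x → word x ≡ u → LeW n u (word y) → Le x y
    go x e ε = incl (λ _ → word≡⇒bef x y e)
    go x refl (c ◅ cs) with cov⇒edge {x} c
    ... | x′ , e , _ , _ , _ , _ , lt , E = Le-trans (edge⇒Le lt E) (go x′ e cs)

  Le⇒LeW : ∀ {x y} → Le x y → LeW n (word x) (word y)
  Le⇒LeW {x} {y} h with climb-to h
  ... | m , ss , e = subst (LeW n (word x)) e (steps ss)
    where
    steps : ∀ {x m} → Star Step x m → LeW n (word x) (word m)
    steps ε = ε
    steps (step adj n≤b lt ◅ ss) = cov-up (exchange _ adj n≤b) lt ◅ steps ss

  -- `JoinIrr` does not assert that the covered word is signed, so the descent is read off the words
  -- themselves.
  cov⇒descent : ∀ {y w : Word n} → Cov n y w → Σ V λ a → Σ V λ b →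
    toℕ b ≡ suc (toℕ a) × n ℕ.≤ toℕ b × lookup w b F.< lookup w a
  cov⇒descent {y} (cov-mid a b ea eb lt) = a , b , trans eb (sym ea) , ℕₚ.≤-reflexive (sym eb) ,
    subst₂ F._<_ (sym (trans (lookup∘tabulate _ b) (cong (lookup y) (transposeʳ a b))))
                 (sym (trans (lookup∘tabulate _ a) (cong (lookup y) (transposeˡ a b)))) lt
  cov⇒descent {y} (cov-pair a b n≤a adj lt) = a , b , adj , n≤b ,
    subst₂ F._<_ (sym (entry n≤b (transposeʳ a b))) (sym (entry n≤a (transposeˡ a b))) lt
    where
    n≤b : n ℕ.≤ toℕ b
    n≤b = ℕₚ.≤-trans n≤a (ℕₚ.≤-trans (ℕₚ.n≤1+n _) (ℕₚ.≤-reflexive (sym adj)))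
    entry : ∀ {k l} → n ℕ.≤ toℕ k → transpose a b k ≡ l →
      lookup (swap n (swap n y a b) (neg b) (neg a)) k ≡ lookup y l
    entry {k} n≤k e = trans (lookup∘tabulate _ k) (trans
      (cong (lookup (swap n y a b)) (transpose-other (neg b) (neg a) (nonneg≢neg n≤k n≤b) (nonneg≢neg n≤k n≤a)))
      (trans (lookup∘tabulate _ k) (cong (lookup y) e)))

  record OneDescent (j : SW) : Set where
    field
      a b : V
      adj : toℕ b ≡ suc (toℕ a)
      n≤b : n ℕ.≤ toℕ b
      descent : at j b F.< at j a
      unique : ∀ {a′ b′} → toℕ b′ ≡ suc (toℕ a′) → n ℕ.≤ toℕ b′ → at j b′ F.< at j a′ → a′ ≡ a × b′ ≡ b
      j* : SW
      j*-a : at j* a ≡ at j b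
      j*-b : at j* b ≡ at j a
      covers : Cov n (word j*) (word j)
      covered : ∀ {y} → Cov n y (word j) → y ≡ word j*
      j-j* : Edge j j* (at j a) (at j b)

    label : Label
    label = desc j a b

    j*-j : Edge j* j (at j b) (at j a)
    j*-j = edge-flip j-j*

  -- Every descent in the right half gives a lower cover, so all of them lead to one word; two edges
  -- from `j` to the same word exchange the same pair up to mirroring.
  oneDescent : ∀ {w} (ji : JoinIrr n w) → OneDescent (mk w (proj₁ ji))
  oneDescent {w} (sp , w* , cov , only) with cov⇒descent cov
  ... | a , b , adj , n≤b , lt = record
    { a = a ; b = b ; adj = adj ; n≤b = n≤b ; descent = lt ; unique = unique ; j* = target s
    ; j*-a = at-a s ; j*-b = at-b s ; covers = cov-down s lt
    ; covered = λ c → trans (only _ c) (sym (only _ (cov-down s lt))) ; j-j* = edge s }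
    where
    j : SW
    j = mk w sp
    s : Swapped j a b
    s = exchange j adj n≤b
    ≤n : ∀ {c d : V} → toℕ d ≡ suc (toℕ c) → toℕ c ℕ.< n → toℕ d ℕ.≤ n
    ≤n e lt = ℕₚ.≤-trans (ℕₚ.≤-reflexive e) lt
    unique : ∀ {a′ b′} → toℕ b′ ≡ suc (toℕ a′) → n ℕ.≤ toℕ b′ → at j b′ F.< at j a′ → a′ ≡ a × b′ ≡ b
    unique {a′} {b′} adj′ n≤b′ lt′ with edge-back (edge s′) after′
      where
      s′ : Swapped j a′ b′
      s′ = exchange j adj′ n≤b′
      after′ : bef (target s′) (at j b) (at j a)
      after′ = word≡⇒bef (target s) (target s′) (trans (only _ (cov-down s lt)) (sym (only _ (cov-down s′ lt′)))) (after (edge s))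
    ... | inj₁ b-a = contradiction b-a (bef-asym j (before (edge s)))
    ... | inj₂ (inj₁ (p , q)) = at-injective j (sym q) , at-injective j (sym p)
    -- Two mirrored pairs of neighbours whose right members both stand in the right half can only be
    -- the middle pair.
    ... | inj₂ (inj₂ (p , q)) = Fₚ.toℕ-injective (ℕₚ.suc-injective (trans (sym adj′) (trans b′≡b adj))) , Fₚ.toℕ-injective b′≡b
      where
      a≡ : a ≡ neg b′
      a≡ = at-injective j (trans q (sym (at-neg j b′)))
      b≡ : b ≡ neg a′
      b≡ = at-injective j (trans p (sym (at-neg j a′)))
      a<n : toℕ a ℕ.< n
      a<n = subst (λ v → toℕ v ℕ.< n) (sym a≡) (≤n⇒neg<n b′ n≤b′)
      a′<n : toℕ a′ ℕ.< n
      a′<n = subst (λ v → toℕ v ℕ.< n) (neg-swap b≡) (≤n⇒neg<n b n≤b)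
      b′≡b : toℕ b′ ≡ toℕ b
      b′≡b = trans (ℕₚ.≤-antisym (≤n {c = a′} {b′} adj′ a′<n) n≤b′) (sym (ℕₚ.≤-antisym (≤n {c = a} {b} adj a<n) n≤b))

  ⊑-op : ∀ {e f} → OpWeak._⊑_ (revL e) (revL f) → e ⊑ f
  ⊑-op {e} {f} (inj₁ (A , m)) = inj₁ (asub-op A , λ p s → sym (neg-swap (m (sym (neg-swap p)) (proj₂ s , proj₁ s))))
    where
    asub-op : ∀ {e f} → OpWeak.Asub (revL e) (revL f) → Asub e f
    asub-op (OpWeak.asub p q r) = asub q p (λ l h → r h l)
  ⊑-op (inj₂ (¬s , OpWeak.asub p q r)) = inj₂ ((λ s → ¬s (proj₂ s , proj₁ s)) , asub q p (λ l h → r h l))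

  -- Forcing implies subarc.

  module Necessity (e₁ : Label) where
    Bottom : SW → Set
    Bottom j = ∀ {a b} → toℕ b ≡ suc (toℕ a) → n ℕ.≤ toℕ b → at j b F.< at j a → ¬ e₁ ⊑ desc j a b

    Top : SW → Set
    Top m = ∀ {a b} → toℕ b ≡ suc (toℕ a) → n ℕ.≤ toℕ b → at m a F.< at m b → ¬ e₁ ⊑ asc m a b

    abstract
      separate-above : ∀ {j y} → Bottom j → ¬ Le j y → Σ SW λ m → Le y m × ¬ Le j m × Top m
      separate-above {j} {y} isBottom ¬j≤y with climb (λ m → ¬? (Le? j m)) y ¬j≤y
      ... | m , ss , ¬j≤m , maximal = m , steps⇒Le ss , ¬j≤m , isTop
        where
        isTop : Top m
        isTop adj n≤b lt e with label-forced adj n≤b lt (edge (exchange m adj n≤b)) (decidable-stable (Le? j _) (maximal adj n≤b lt)) ¬j≤m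
        ... | _ , _ , adj′ , n≤l , lt′ , f = isBottom adj′ n≤l lt′ (⊑-trans e f)

    abstract
      separate-below : ∀ {m x} → Top m → ¬ Le x m → Σ SW λ j → Le j x × ¬ Le j m × Bottom j
      separate-below {m} {x} isTop ¬x≤m with OpWeak.climb (λ j → ¬? (OpWeak.Le? m j)) x (¬x≤m ∘ op⇒≤)
      ... | j , ss , ¬j≤m , maximal = j , op⇒≤ (OpWeak.steps⇒Le ss) , ¬j≤m ∘ ≤⇒op , isBottom
        where
        isBottom : Bottom j
        isBottom adj n≤b lt e with OpWeak.label-forced adj n≤b lt (edge (exchange j adj n≤b))
                                  (decidable-stable (OpWeak.Le? m _) (maximal adj n≤b lt)) ¬j≤m
        ... | _ , _ , adj′ , n≤l , lt′ , f = isTop adj′ n≤l lt′ (⊑-trans e (⊑-op f))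

    Θ : Word n → Word n → Set
    Θ x y = ∀ j → Bottom j → (LeW n (word j) x → LeW n (word j) y) × (LeW n (word j) y → LeW n (word j) x)

    Θ-sym : ∀ {x y} → Θ x y → Θ y x
    Θ-sym θ j b = proj₂ (θ j b) , proj₁ (θ j b)

    private
      -- If `j` is below `m₁` but not below `m₂`, let `m` above `m₂` come from `separate-above`.
      -- Were `x₁` not below `m`, then `separate-below` would give a bottom element below `x₁` and
      -- not below `m`; but being below `x₁` it is below `x₂`, hence below `m₂` and `m`. So `x₁`,
      -- likewise `y₁`, and therefore `m₁` and `j` are below `m`, a contradiction.
      half-join : ∀ {x₁ x₂ y₁ y₂ m₁ m₂} → IsSignedPerm n x₁ → IsSignedPerm n x₂ → IsSignedPerm n y₁ → IsSignedPerm n y₂ →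
        Θ x₁ x₂ → Θ y₁ y₂ → IsJoin n x₁ y₁ m₁ → IsJoin n x₂ y₂ m₂ →
        ∀ j → Bottom j → LeW n (word j) m₁ → LeW n (word j) m₂
      half-join {x₁} {x₂} {y₁} {y₂} {m₁} {m₂} sx₁ sx₂ sy₁ sy₂ θx θy (sm₁ , _ , _ , least) (sm₂ , x₂≤ , y₂≤ , _) j bj j≤m₁
        with Le? j (mk m₂ sm₂)
      ... | yes le = Le⇒LeW {j} {mk m₂ sm₂} le
      ... | no ¬le with separate-above bj ¬le
      ... | m , m₂≤m , ¬j≤m , isTop = contradiction
            (LeW⇒Le {j} {m} (j≤m₁ ◅◅ least (word m) (sp m) (below sx₁ sx₂ θx x₂≤) (below sy₁ sy₂ θy y₂≤))) ¬j≤m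
        where
        below : ∀ {x x′} → IsSignedPerm n x → IsSignedPerm n x′ → Θ x x′ → LeW n x′ m₂ → LeW n x (word m)
        below {x} {x′} sx sx′ θ x′≤ with Le? (mk x sx) m
        ... | yes le = Le⇒LeW {mk x sx} {m} le
        ... | no ¬le with separate-below isTop ¬le
        ... | i , i≤x , ¬i≤m , bi = contradiction
              (Le-trans (LeW⇒Le {i} {mk m₂ sm₂} (proj₁ (θ i bi) (Le⇒LeW {i} {mk x sx} i≤x) ◅◅ x′≤)) m₂≤m) ¬i≤m

      half-meet : ∀ {x₁ x₂ y₁ y₂ m₁ m₂} → Θ x₁ x₂ → Θ y₁ y₂ → IsMeet n x₁ y₁ m₁ → IsMeet n x₂ y₂ m₂ →
        ∀ j → Bottom j → LeW n (word j) m₁ → LeW n (word j) m₂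
      half-meet θx θy (_ , ≤x , ≤y , _) (_ , _ , _ , greatest) j bj j≤ =
        greatest (word j) (sp j) (proj₁ (θx j bj) (j≤ ◅◅ ≤x)) (proj₁ (θy j bj) (j≤ ◅◅ ≤y))

    Θ-congruence : IsCongruence n Θ
    Θ-congruence = record
      { refl′ = λ _ _ _ _ → id , id
      ; sym′ = λ _ _ _ _ → Θ-sym
      ; trans′ = λ _ _ _ _ _ _ θ θ′ j b → proj₁ (θ′ j b) ∘ proj₁ (θ j b) , proj₂ (θ j b) ∘ proj₂ (θ′ j b)
      ; meet′ = λ _ _ _ _ _ _ _ _ _ _ θ θ′ m m′ j b →
          half-meet θ θ′ m m′ j b , half-meet (Θ-sym θ) (Θ-sym θ′) m′ m j b
      ; join′ = λ _ _ _ _ _ _ s₁ s₂ s₃ s₄ θ θ′ m m′ j b →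
          half-join s₁ s₂ s₃ s₄ θ θ′ m m′ j b , half-join s₂ s₁ s₄ s₃ (Θ-sym θ) (Θ-sym θ′) m′ m j b }

    -- The edge from `j*` to `j₁` has the label `e₁`. By `label-forced`, whatever lies below `j₁`
    -- but not below `j*` has a descent whose label contains `e₁`, so it is no bottom element.
    Θ-contracts : ∀ {j₁} (d : OneDescent j₁) → OneDescent.label d ≡ e₁ → Contracts n Θ (word j₁)
    Θ-contracts {j₁} d refl y c j bj with OneDescent.covered d c
    ... | refl = down , λ le → le ◅◅ (OneDescent.covers d ◅ ε)
      where
      open OneDescent d using (a; b; adj; n≤b; descent; j*; j*-a; j*-b; j-j*; j*-j)
      label⊑ : e₁ ⊑ asc j* a b
      label⊑ = inj₁ (asub (≡⇒⪯ j*-a) (≡⇒⪯ (sym j*-b)) agrees ,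
                     λ m _ → trans (sym j*-a) (trans m (cong neg j*-b)))
        where
        agrees : ∀ {z} → at j₁ b F.< z → z F.< at j₁ a → aft j₁ b z ≡ aft j* b z
        agrees {z} l h with aft-cases j₁ {b} {z} (≺⇒≢ l ∘ sym)
        ... | inj₁ lt = trans (aft-true j₁ lt) (sym (aft-true j* (subst (F._< pos j* z) (pos≡ j* j*-b)
                (edge-right j-j* (subst (F._< pos j₁ z) (sym (pos-at j₁ b)) lt)))))
        ... | inj₂ gt = trans (aft-false j₁ gt) (sym (aft-false j* (ℕₚ.<-trans
                (subst (pos j* z F.<_) (pos≡ j* j*-a) (edge-left j-j* (edge-before j-j* (subst (pos j₁ z F.<_) (sym (pos-at j₁ b)) gt) (≺⇒≢ h))))
                (ℕₚ.≤-reflexive (sym adj)))))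
      down : LeW n (word j) (word j₁) → LeW n (word j) (word j*)
      down le with Le? j j*
      ... | yes p = Le⇒LeW p
      ... | no ¬p with label-forced {j} {j*} adj n≤b (subst₂ F._<_ (sym j*-a) (sym j*-b) descent)
                        (subst₂ (Edge j* j₁) (sym j*-a) (sym j*-b) j*-j) (LeW⇒Le le) ¬p
      ... | _ , _ , adj′ , n≤l , lt′ , f = contradiction (⊑-trans label⊑ f) (bj adj′ n≤l lt′)

    -- If its label did not contain `e₁`, then `j₂`, which has no other descent in the right half,
    -- would be a bottom element, and contraction would put it below its own `j*`.
    Θ-contracts⁻ : ∀ {j₂} (d : OneDescent j₂) → Contracts n Θ (word j₂) → e₁ ⊑ OneDescent.label d
    Θ-contracts⁻ {j₂} d c with e₁ ⊑? OneDescent.label d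
    ... | yes p = p
    ... | no ¬p = contradiction
        (inv (LeW⇒Le {j₂} {j*} (proj₁ (c (word j*) covers j₂ isBottom) ε)) descent (before j-j*))
        (bef-asym j* (after j-j*))
      where
      open OneDescent d
      isBottom : Bottom j₂
      isBottom adj′ n≤b′ lt′ with unique adj′ n≤b′ lt′
      ... | refl , refl = ¬p

  forces⇒⊑ : ∀ {j₁ j₂} (d₁ : OneDescent j₁) (d₂ : OneDescent j₂) → Forces n (word j₁) (word j₂) →
    OneDescent.label d₁ ⊑ OneDescent.label d₂
  forces⇒⊑ d₁ d₂ f = Θ-contracts⁻ d₂ (f Θ Θ-congruence (Θ-contracts d₁ refl))
    where open Necessity (OneDescent.label d₁)

  -- Subarc implies forcing.

  congruence⇒ : ∀ {Θ} → IsCongruence n Θ → Congruence (λ x y → Θ (word x) (word y))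
  congruence⇒ {Θ} C = record
    { crefl = λ x → refl′ (word x) (sp x)
    ; csym = λ {x} {y} → sym′ _ _ (sp x) (sp y)
    ; ctrans = λ {x} {y} {z} → trans′ _ _ _ (sp x) (sp y) (sp z)
    ; cjoin = λ {x₁} {x₂} {y₁} {y₂} θ θ′ j j′ → join′ _ _ _ _ _ _ (sp x₁) (sp x₂) (sp y₁) (sp y₂) θ θ′ (join⇒ j) (join⇒ j′)
    ; cmeet = λ {x₁} {x₂} {y₁} {y₂} θ θ′ m m′ → meet′ _ _ _ _ _ _ (sp x₁) (sp x₂) (sp y₁) (sp y₂) θ θ′ (meet⇒ m) (meet⇒ m′) }
    where
    open IsCongruence C
    join⇒ : ∀ {x y m} → Join x y m → IsJoin n (word x) (word y) (word m)
    join⇒ {x} {y} {m} (isJoin p q r) = sp m , Le⇒LeW p , Le⇒LeW q ,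
      λ z sz h h′ → Le⇒LeW {m} {mk z sz} (r (LeW⇒Le {x} {mk z sz} h) (LeW⇒Le {y} {mk z sz} h′))
    meet⇒ : ∀ {x y m} → Meet x y m → IsMeet n (word x) (word y) (word m)
    meet⇒ {x} {y} {m} (isMeet p q r) = sp m , Le⇒LeW p , Le⇒LeW q ,
      λ z sz h h′ → Le⇒LeW {mk z sz} {m} (r (LeW⇒Le {mk z sz} {x} h) (LeW⇒Le {mk z sz} {y} h′))

  -- A left member in the left half means the middle pair, where `aft-neg` gives the antisymmetry.
  -- Otherwise the negatives of the pair and of all values after it stand in the left half.
  descent-arc : ∀ j {a b} → toℕ b ≡ suc (toℕ a) → n ℕ.≤ toℕ b → at j b F.< at j a →
    MidArc (desc j a b) ⊎ RightArc (desc j a b)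
  descent-arc j {a} {b} adj n≤b lt with n ℕₚ.≤? toℕ a
  ... | no n≰a = inj₁ (record
    { mid = lo≡
    ; hi>0 = subst (F._< at j a) lo≡ lt
    ; antisymmetric = λ {z} l h → trans (cong (λ c → aft j c (neg z)) (sym (neg-swap a≡))) (aft-neg j adj (≺⇒≢ h) (≺⇒≢ l ∘ sym)) })
    where
    a≡ : a ≡ neg b
    a≡ = neg-mid (ℕₚ.≤-antisym (ℕₚ.≰⇒> n≰a) (ℕₚ.≤-trans n≤b (ℕₚ.≤-reflexive adj)))
                 (ℕₚ.≤-antisym (ℕₚ.≤-trans (ℕₚ.≤-reflexive adj) (ℕₚ.≰⇒> n≰a)) n≤b)
    lo≡ : at j b ≡ neg (at j a)
    lo≡ = trans (cong (at j) (sym (neg-swap a≡))) (at-neg j a)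
  ... | yes n≤a = inj₂ (record
    { lo≺hi = lt
    ; ¬mid = λ e → nonneg≢neg n≤b n≤a (at-injective j (trans e (sym (at-neg j a))))
    ; antisym = λ {z} _ _ _ _ e → early (subst (λ k → toℕ k ℕ.< n) (sym (pos-neg j z)) (≤n⇒neg<n (pos j z) (ℕₚ.≤-trans n≤b (ℕₚ.<⇒≤ (after-b z e)))))
    ; neg-lo = λ _ _ → early (subst (λ k → toℕ k ℕ.< n) (sym (pos≡ j (at-neg j b))) (≤n⇒neg<n b n≤b))
    ; neg-hi = λ _ _ → early (subst (λ k → toℕ k ℕ.< n) (sym (pos≡ j (at-neg j a))) (≤n⇒neg<n a n≤a)) })
    where
    early : ∀ {z} → toℕ (pos j z) ℕ.< n → aft j b z ≡ false
    early p = aft-false j (ℕₚ.<-≤-trans p n≤b)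
    after-b : ∀ z → aft j b z ≡ true → b F.< pos j z
    after-b z e with b Fₚ.<? pos j z
    ... | yes p = p
    ... | no ¬p = ⊥-elim (true≢false e (dec-false (b Fₚ.<? pos j z) ¬p))

  module _ {Θ : SW → SW → Set} (C : Congruence Θ) where

    private
      T : Label → Set
      T = Contracted Θ

    enlarge : ∀ {e f} → Asub e f → T e → T (mkL (lo e) (hi e) (S f))
    enlarge A = contracted-cong refl refl (agree A)

    mid-op : ∀ {e} → MidArc e → OpForcing.MidArc (mkL (neg (neg (hi e))) (neg (hi e)) (S e))
    mid-op {e} m = record
      { mid = refl
      ; hi>0 = subst (neg (hi e) F.<_) (sym (neg-neg (hi e))) (hi>0 m)
      ; antisymmetric = λ {z} l h → antisymmetric m (subst (F._< z) (sym (mid m)) h) (subst (z F.<_) (neg-neg (hi e)) l) }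

    -- Two negative ends are two positive ends in the reversed order, so the lemmas about positive
    -- ends cover both signs.
    same-sign⇒contracted : ∀ {e f} → MidArc f ⊎ RightArc f → lo e F.< hi e → ¬ Straddles e → Asub e f → T e → T f
    same-sign⇒contracted {e} {f} arc₁ lt ¬s A c with neg (lo e) ≺? lo e | arc₁
    ... | yes p | inj₁ m = subst (λ v → T (mkL v (hi f) (S f))) (sym (mid m))
            (positive⇒mid C (subst (λ v → MidArc (mkL v (hi f) (S f))) (mid m) m) p lt (hi⪯ A) (enlarge A c))
    ... | yes p | inj₂ r = positive⇒right C r p (lo⪯ A) lt (hi⪯ A) (enlarge A c)
    ... | no ¬p | arc₂ = negative arc₂
      where
      hi<0 : hi e F.< neg (hi e)
      hi<0 = ≢∧⪯⇒≺ (v≢neg (hi e)) (λ q → ¬s (≢∧⪯⇒≺ (v≢neg (lo e)) ¬p , q))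
      cᵒ : Words.Contracted n (op up) Θ (mkL (hi e) (lo e) (S f))
      cᵒ = contracted-op C (enlarge A c)
      negative : MidArc f ⊎ RightArc f → T f
      negative (inj₂ r) = contracted-op⁻ C (OpForcing.positive⇒right (congruence-op C) (rightArc-op r) hi<0 (hi⪯ A) lt (lo⪯ A) cᵒ)
      negative (inj₁ m) = contracted-op⁻ C (subst₂ (λ u v → Words.Contracted n (op up) Θ (mkL u v (S f))) (neg-neg (hi f)) (sym (mid m))
        (OpForcing.positive⇒mid (congruence-op C) (mid-op m) hi<0 lt (subst (_⪯ lo e) (mid m) (lo⪯ A)) cᵒ))

    ⊑⇒contracted : ∀ {e f} → MidArc e ⊎ RightArc e → MidArc f ⊎ RightArc f → lo e F.< hi e → e ⊑ f → T e → T f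
    ⊑⇒contracted {e} {f} arc₁ arc₂ lt (inj₂ (¬s , A)) c = same-sign⇒contracted {negL e} {f} arc₂ (≺-neg lt) (¬s ∘ straddles-neg {e}) A (contracted-neg c)
    ⊑⇒contracted {e} {f} arc₁ arc₂ lt (inj₁ (A , m⇒m)) c with straddles? e
    ... | no ¬s = same-sign⇒contracted {e} {f} arc₂ lt ¬s A c
    ... | yes (s , s′) = straddling arc₁ arc₂
      where
      c′ : T (mkL (lo e) (hi e) (S f))
      c′ = enlarge A c
      straddling : MidArc e ⊎ RightArc e → MidArc f ⊎ RightArc f → T f
      straddling (inj₁ m) arc₂ = from-mid arc₂
        where
        c″ : T (mkL (neg (hi e)) (hi e) (S f))
        c″ = subst (λ v → T (mkL v (hi e) (S f))) (mid m) c′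
        anti : ∀ {z} → neg (hi e) F.< z → z F.< hi e → S f (neg z) ≡ not (S f z)
        anti {z} l h = trans (sym (agree A (subst (F._< neg z) (sym (mid m)) (≺-neg h)) (≺-negˡ l)))
          (trans (antisymmetric m l′ h) (cong not (agree A l′ h)))
          where
          l′ : lo e F.< z
          l′ = subst (F._< z) (sym (mid m)) l
        from-mid : MidArc f ⊎ RightArc f → T f
        from-mid (inj₂ r) = mid⇒right C r (hi>0 m) (subst (lo f ⪯_) (mid m) (lo⪯ A)) (hi⪯ A) anti c″
        from-mid (inj₁ m′) with hi e Fₚ.≟ hi f
        ... | yes p = contracted-cong (trans (cong neg p) (sym (mid m′))) p (λ _ _ → refl) c″
        ... | no ne = subst (λ v → T (mkL v (hi f) (S f))) (sym (mid m′))
                (mid⇒mid C (hi>0 m) (≢∧⪯⇒≺ ne (hi⪯ A)) (subst (λ v → MidArc (mkL v (hi f) (S f))) (mid m′) m′) c″)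
      straddling (inj₂ r) (inj₁ m) = contradiction (m⇒m (mid m) (s , s′)) (¬mid r)
      straddling (inj₂ r) (inj₂ r′) = overlap⇒right C r″ r′ s s′ (lo⪯ A) (hi⪯ A) c′
        where
        r″ : RightArc (mkL (lo e) (hi e) (S f))
        r″ = record
          { lo≺hi = lt ; ¬mid = ¬mid r
          ; antisym = λ l h l′ h′ p → trans (sym (agree A l′ h′)) (antisym r l h l′ h′ (trans (agree A l h) p))
          ; neg-lo = λ l h → trans (sym (agree A l h)) (neg-lo r l h)
          ; neg-hi = λ l h → trans (sym (agree A l h)) (neg-hi r l h) }

  ⊑⇒forces : ∀ {j₁ j₂} (d₁ : OneDescent j₁) (d₂ : OneDescent j₂) →
    OneDescent.label d₁ ⊑ OneDescent.label d₂ → Forces n (word j₁) (word j₂)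
  ⊑⇒forces {j₁} {j₂} d₁ d₂ sub Θ isC contr y cov with D₂.covered cov
    where module D₂ = OneDescent d₂
  ... | refl = csym {D₂.j*} {j₂} (⊑⇒contracted C (descent-arc j₁ D₁.adj D₁.n≤b D₁.descent) (descent-arc j₂ D₂.adj D₂.n≤b D₂.descent)
        D₁.descent sub (contracted-by C D₁.descent D₁.j*-j (sides-of j₁ d₁) (csym {j₁} {D₁.j*} (contr (word D₁.j*) D₁.covers))) D₂.j*-j (sides-of j₂ d₂))
    where
    module D₁ = OneDescent d₁
    module D₂ = OneDescent d₂
    C : Congruence (λ x y → Θ (word x) (word y))
    C = congruence⇒ isC
    open Congruence C
    sides-of : ∀ j (d : OneDescent j) → Sides (OneDescent.j* d) (OneDescent.label d)
    sides-of j d = mkSides toR toL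
      where
      open OneDescent d
      toR : ∀ {z} → at j b F.< z → z F.< at j a → aft j b z ≡ true → bef j* (at j b) z
      toR {z} l h p with aft-cases j {b} {z} (≺⇒≢ l ∘ sym)
      ... | inj₁ lt = bef-trans j* (after j-j*) (edge-right j-j* (subst (F._< pos j z) (sym (pos-at j b)) lt))
      ... | inj₂ gt = ⊥-elim (true≢false p (aft-false j gt))
      toL : ∀ {z} → at j b F.< z → z F.< at j a → aft j b z ≡ false → bef j* z (at j b)
      toL {z} l h p with aft-cases j {b} {z} (≺⇒≢ l ∘ sym)
      ... | inj₁ lt = ⊥-elim (true≢false (aft-true j lt) p)
      ... | inj₂ gt = edge-left j-j* (edge-before j-j* (subst (pos j z F.<_) (sym (pos-at j b)) gt) (≺⇒≢ h))

-- Labels and the arcs of the statement.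

bool-ext : ∀ {a b} → (a ≡ true → b ≡ true) → (b ≡ true → a ≡ true) → a ≡ b
bool-ext {true} {true} _ _ = refl
bool-ext {false} {false} _ _ = refl
bool-ext {true} {false} f _ = sym (f refl)
bool-ext {false} {true} _ g = g refl

∧-true⁻ : ∀ {a b} → a ∧ b ≡ true → a ≡ true × b ≡ true
∧-true⁻ {true} {true} _ = refl , refl

not-true⁻ : ∀ {a} → not a ≡ true → a ≡ false
not-true⁻ {false} _ = refl

isYes-true⁻ : ∀ {P : Set} (d : Dec P) → ⌊ d ⌋ ≡ true → P
isYes-true⁻ (yes p) _ = p

isYes-true : ∀ {P : Set} (d : Dec P) → P → ⌊ d ⌋ ≡ true
isYes-true (yes _) _ = refl
isYes-true (no ¬p) p = contradiction p ¬p

module ArcLabels (n : ℕ) where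
  open SignedWords n
  open ValueOrders n
  open VOrd up
  open Weak n up
  open Polygons n up
  open Forcing n up
  open WeakOrder n

  -- The marks of an arc are false outside its range, while `S` is arbitrary there. So several
  -- labels may represent one arc (`rep-cong`), but a label represents at most one (`rep-unique`).
  record Rep (α : Arc (n + n)) (e : Label) : Set where
    field
      bot≡ : bot α ≡ lo e
      top≡ : top α ≡ hi e
      mark⇒ : ∀ {x} → lookup (rs α) x ≡ true → (lo e F.< x × x F.< hi e) × S e x ≡ true
      mark⇐ : ∀ {x} → lo e F.< x → x F.< hi e → S e x ≡ true → lookup (rs α) x ≡ true
  open Rep

  rep-unique : ∀ {α β e} → Rep α e → Rep β e → α ≡ β
  rep-unique {arc _ _ r} {arc _ _ r′} {e} p q = arc-cong (trans (bot≡ p) (sym (bot≡ q))) (trans (top≡ p) (sym (top≡ q)))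
    (trans (sym (tabulate∘lookup r)) (trans (tabulate-cong (λ x → bool-ext (same-mark p q) (same-mark q p))) (tabulate∘lookup r′)))
    where
    arc-cong : ∀ {b b′ t t′ : V} {r r′} → b ≡ b′ → t ≡ t′ → r ≡ r′ → arc b t r ≡ arc b′ t′ r′
    arc-cong refl refl refl = refl
    same-mark : ∀ {α β x} → Rep α e → Rep β e → lookup (rs α) x ≡ true → lookup (rs β) x ≡ true
    same-mark p q m with mark⇒ p m
    ... | (l , h) , s = mark⇐ q l h s

  rep-cong : ∀ {α e f} → lo e ≡ lo f → hi e ≡ hi f → (∀ {z} → lo e F.< z → z F.< hi e → S e z ≡ S f z) → Rep α e → Rep α f
  rep-cong refl refl s p = record
    { bot≡ = bot≡ p ; top≡ = top≡ p
    ; mark⇒ = λ m → let ((l , h) , q) = mark⇒ p m in (l , h) , trans (sym (s l h)) q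
    ; mark⇐ = λ l h q → mark⇐ p l h (trans (s l h) q) }

  rep-neg : ∀ {α e} → Rep α e → Rep (negArc α) (negL e)
  rep-neg {arc b t r} {e} p = record
    { bot≡ = cong neg (top≡ p) ; top≡ = cong neg (bot≡ p)
    ; mark⇒ = marked ∘ trans (sym (lookup∘tabulate entry _)) ; mark⇐ = λ {x} l h s → trans (lookup∘tabulate entry x) (marked⁻ l h s) }
    where
    entry : V → Bool
    entry x = inside? (neg x) b t ∧ not (lookup r (neg x))
    marked : ∀ {x} → entry x ≡ true → (neg (hi e) F.< x × x F.< neg (lo e)) × not (S e (neg x)) ≡ true
    marked {x} m with ∧-true⁻ m
    ... | i , nr with ∧-true⁻ i
    ... | l , h = (≺-negˡ h′ , ≺-negʳ l′) , cong not s
      where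
      l′ : lo e F.< neg x
      l′ = subst (F._< neg x) (bot≡ p) (isYes-true⁻ (b Fₚ.<? neg x) l)
      h′ : neg x F.< hi e
      h′ = subst (neg x F.<_) (top≡ p) (isYes-true⁻ (neg x Fₚ.<? t) h)
      s : S e (neg x) ≡ false
      s = trans (bool-ext (mark⇐ p l′ h′) (λ q → proj₂ (mark⇒ p q))) (not-true⁻ nr)
    marked⁻ : ∀ {x} → neg (hi e) F.< x → x F.< neg (lo e) → not (S e (neg x)) ≡ true → entry x ≡ true
    marked⁻ {x} l h s = cong₂ _∧_ (cong₂ _∧_
        (isYes-true (b Fₚ.<? neg x) (subst (F._< neg x) (sym (bot≡ p)) (≺-negʳ h)))
        (isYes-true (neg x Fₚ.<? t) (subst (neg x F.<_) (sym (top≡ p)) (≺-negˡ l))))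
      (cong not (trans (bool-ext (λ q → proj₂ (mark⇒ p q)) (mark⇐ p (≺-negʳ h) (≺-negˡ l))) (not-true⁻ s)))

  rep-neg-neg : ∀ {α e} → Rep α (negL (negL e)) → Rep α e
  rep-neg-neg {e = e} = rep-cong (neg-neg (lo e)) (neg-neg (hi e))
    (λ {z} _ _ → trans (Boolₚ.not-involutive _) (cong (S e) (neg-neg z)))

  negArc-involutive : ∀ {α e} → Rep α e → negArc (negArc α) ≡ α
  negArc-involutive p = rep-unique (rep-neg-neg (rep-neg (rep-neg p))) p

  rep-descent : ∀ (j : SW) {α} (δ : InDelta n (word j) α) → Rep α (desc j (proj₁ δ) (proj₁ (proj₂ δ)))
  rep-descent j (a , b , adj , lt , eb , et , marks) = record
    { bot≡ = eb ; top≡ = et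
    ; mark⇒ = λ {x} m → let (w , c , b<c , e) = proj₁ (marks x) m in w , aft-true j (subst (b F.<_) (sym (pos≡ j e)) b<c)
    ; mark⇐ = λ {x} l h s → proj₂ (marks x) ((l , h) , pos j x , isAfter l s , at-pos j x) }
    where
    isAfter : ∀ {x} → at j b F.< x → aft j b x ≡ true → b F.< pos j x
    isAfter l s with aft-cases j (≺⇒≢ l ∘ sym)
    ... | inj₁ p = p
    ... | inj₂ p = ⊥-elim (true≢false s (aft-false j p))

  -- `InDelta` admits descents in both halves. One in the left half mirrors the only descent of the
  -- right half, so its arc represents the mirrored label.
  normalise : ∀ {j α} (d : OneDescent j) → InDelta n (word j) α → let L = OneDescent.label d in
    (Rep α L × Rep (negArc α) (negL L)) ⊎ (Rep α (negL L) × Rep (negArc α) L)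
  normalise {j} {α} d δ@(a , b , adj , lt , _) with n ℕₚ.≤? toℕ b
  ... | yes n≤b with OneDescent.unique d adj n≤b lt
  ... | refl , refl = inj₁ (rep-descent j δ , rep-neg {α} (rep-descent j δ))
  normalise {j} {α} d δ@(a , b , adj , lt , _) | no n≰b with OneDescent.unique d (adj-neg adj)
        (<n⇒≤neg a (ℕₚ.<-trans (ℕₚ.≤-reflexive (sym adj)) (ℕₚ.≰⇒> n≰b))) (subst₂ F._<_ (sym (at-neg j a)) (sym (at-neg j b)) (≺-neg lt))
  ... | refl , refl = inj₂ (subst (λ β → Rep β (negL (desc j (neg b) (neg a)))) (negArc-involutive (rep-descent j δ)) (rep-neg mirrored) , mirrored)
    where
    mirrored : Rep (negArc α) (desc j (neg b) (neg a))
    mirrored = rep-cong (sym (at-neg j a)) (sym (at-neg j b))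
      (λ {z} l h → trans (sym (aft-neg j {z = neg z} adj (≺⇒≢ (≺-negˡ l)) (≺⇒≢ (≺-negʳ h) ∘ sym))) (cong (aft j (neg a)) (neg-neg z)))
      (rep-neg {α} (rep-descent j δ))

  mid-neg : ∀ {e} → MidArc e → ∀ {z} → lo e F.< z → z F.< hi e → S e z ≡ not (S e (neg z))
  mid-neg {e} m {z} l h = sym (trans (cong not (antisymmetric m l h)) (Boolₚ.not-involutive (S e z)))

  asub-midˡ : ∀ {e f} → MidArc e → Asub e f → Asub (negL e) f
  asub-midˡ {e} {f} m A = asub (subst (lo f ⪯_) (mid m) (lo⪯ A)) (subst (_⪯ hi f) (sym (neg-swap (mid m))) (hi⪯ A))
    (λ l h → let l′ = subst (F._< _) (sym (mid m)) l ; h′ = subst (_ F.<_) (neg-swap (mid m)) h in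
      trans (sym (mid-neg m l′ h′)) (agree A l′ h′))

  asub-midʳ : ∀ {e f} → MidArc f → Asub e (negL f) → Asub e f
  asub-midʳ {e} {f} m A = asub (subst (_⪯ lo e) (sym (mid m)) (lo⪯ A)) (subst (hi e ⪯_) (neg-swap (mid m)) (hi⪯ A))
    (λ l h → trans (agree A l h) (sym (mid-neg m (subst (F._< _) (sym (mid m)) (⪯-≺-trans (lo⪯ A) l))
      (subst (_ F.<_) (neg-swap (mid m)) (≺-⪯-trans h (hi⪯ A))))))

  asub-neg-neg : ∀ {e f} → Asub e (negL (negL f)) → Asub e f
  asub-neg-neg {e} {f} A = asub (subst (_⪯ lo e) (neg-neg (lo f)) (lo⪯ A)) (subst (hi e ⪯_) (neg-neg (hi f)) (hi⪯ A))
    (λ {z} l h → trans (agree A l h) (trans (Boolₚ.not-involutive _) (cong (S f) (neg-neg z))))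

  between⇒ : ∀ {α e x} → Rep α e → Between x α → lo e F.< x × x F.< hi e
  between⇒ p (l , h) = subst (F._< _) (bot≡ p) l , subst (_ F.<_) (top≡ p) h

  between⇐ : ∀ {α e x} → Rep α e → lo e F.< x → x F.< hi e → Between x α
  between⇐ p l h = subst (F._< _) (sym (bot≡ p)) l , subst (_ F.<_) (sym (top≡ p)) h

  inR⇒ : ∀ {α e x} → Rep α e → InR x α → S e x ≡ true
  inR⇒ p (_ , m) = proj₂ (mark⇒ p m)

  inR⇐ : ∀ {α e x} → Rep α e → lo e F.< x → x F.< hi e → S e x ≡ true → InR x α
  inR⇐ p l h s = between⇐ p l h , mark⇐ p l h s

  inL⇒ : ∀ {α e x} → Rep α e → InL x α → S e x ≡ false
  inL⇒ p (w , m) = let (l , h) = between⇒ p w in trans (bool-ext (mark⇐ p l h) (λ q → proj₂ (mark⇒ p q))) m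

  inL⇐ : ∀ {α e x} → Rep α e → lo e F.< x → x F.< hi e → S e x ≡ false → InL x α
  inL⇐ p l h s = between⇐ p l h , trans (bool-ext (λ q → proj₂ (mark⇒ p q)) (mark⇐ p l h)) s

  toAsub : ∀ {α β e f} → Rep α e → Rep β f → bot β F.≤ bot α → top α F.≤ top β → SameR α β → Asub e f
  toAsub {α} {β} {e} {f} p q b≤ t≤ same = asub lo≤ hi≤ agrees
    where
    lo≤ : lo f ⪯ lo e
    lo≤ = subst₂ _⪯_ (bot≡ q) (bot≡ p) (ℕₚ.≤⇒≯ b≤)
    hi≤ : hi e ⪯ hi f
    hi≤ = subst₂ _⪯_ (top≡ p) (top≡ q) (ℕₚ.≤⇒≯ t≤)
    agrees : ∀ {z} → lo e F.< z → z F.< hi e → S e z ≡ S f z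
    agrees {z} l h = bool-ext
      (λ s → inR⇒ q (proj₁ (proj₁ (same z) (inR⇐ p l h s))))
      (λ s → inR⇒ p (proj₂ (same z) (inR⇐ q (⪯-≺-trans lo≤ l) (≺-⪯-trans h hi≤) s , between⇐ p l h)))

  fromAsub : ∀ {α β e f} → Rep α e → Rep β f → Asub e f → bot β F.≤ bot α × top α F.≤ top β × SameR α β
  fromAsub {α} {β} p q A = ℕₚ.≮⇒≥ (subst₂ _⪯_ (sym (bot≡ q)) (sym (bot≡ p)) (lo⪯ A)) ,
    ℕₚ.≮⇒≥ (subst₂ _⪯_ (sym (top≡ p)) (sym (top≡ q)) (hi⪯ A)) ,
    λ x → (λ r → let (l , h) = between⇒ p (proj₁ r) in
              inR⇐ q (⪯-≺-trans (lo⪯ A) l) (≺-⪯-trans h (hi⪯ A)) (trans (sym (agree A l h)) (inR⇒ p r)) , proj₁ r) ,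
          (λ (r , w) → let (l , h) = between⇒ p w in inR⇐ p l h (trans (agree A l h) (inR⇒ q r)))

  positive⇒ : ∀ {x} → Positive n x → neg x F.< x
  positive⇒ {x} p = ℕₚ.<-≤-trans (≤n⇒neg<n x p) p

  positive⇐ : ∀ {x} → neg x F.< x → Positive n x
  positive⇐ {x} lt with n ℕₚ.≤? toℕ x
  ... | yes p = p
  ... | no ¬p = contradiction (ℕₚ.<-≤-trans (ℕₚ.≰⇒> ¬p) (<n⇒≤neg x (ℕₚ.≰⇒> ¬p))) (≺-asym lt)

  overlapping⇒ : ∀ {α e} → Rep α e → Overlapping n α → Straddles e
  overlapping⇒ {e = e} p (¬b , t) = ≢∧⪯⇒≺ (v≢neg (lo e)) (λ q → ¬b (subst (Positive n) (sym (bot≡ p)) (positive⇐ q))) ,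
    positive⇒ (subst (Positive n) (top≡ p) t)

  overlapping⇐ : ∀ {α e} → Rep α e → Straddles e → Overlapping n α
  overlapping⇐ p (s , s′) = (λ q → ≺-asym s (positive⇒ (subst (Positive n) (bot≡ p) q))) , subst (Positive n) (sym (top≡ p)) (positive⇐ s′)

  straddles-neg⁻ : ∀ {e} → Straddles e → Straddles (negL e)
  straddles-neg⁻ (s , s′) = ≺-neg s′ , ≺-neg s

  -- Each clause of `LeftOf` is one of the three conditions of `RightArc` on negatives, possibly
  -- complemented at the mirror image.
  right-of-neg : ∀ {α e} → RightArc e → Rep α e → Rep (negArc α) (negL e) → RightOfNeg α
  right-of-neg {α} {e} r p q =
    (λ x l r′ → let (l₁ , h₁) = between⇒ q (proj₁ l) ; (l₂ , h₂) = between⇒ p (proj₁ r′) in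
       true≢false (not-false⁻ (inL⇒ q l)) (antisym r l₂ h₂ (≺-negʳ h₁) (≺-negˡ l₁) (inR⇒ p r′))) ,
    (λ w → let (l , h) = between⇒ q (subst (λ v → Between v (negArc α)) (bot≡ p) w) in
       subst (λ v → InR v (negArc α)) (sym (bot≡ p)) (inR⇐ q l h (cong not (neg-lo r h (≺-negˡ l))))) ,
    (λ w → let (l , h) = between⇒ q (subst (λ v → Between v (negArc α)) (top≡ p) w) in
       subst (λ v → InR v (negArc α)) (sym (top≡ p)) (inR⇐ q l h (cong not (neg-hi r (≺-negʳ h) l)))) ,
    (λ w → let (l , h) = between⇒ p (subst (λ v → Between v α) (bot≡ q) w) in
       subst (λ v → InL v α) (sym (bot≡ q)) (inL⇐ p l h (neg-hi r l h))) ,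
    (λ w → let (l , h) = between⇒ p (subst (λ v → Between v α) (top≡ q) w) in
       subst (λ v → InL v α) (sym (top≡ q)) (inL⇐ p l h (neg-lo r l h)))
    where
    not-false⁻ : ∀ {a} → not a ≡ false → a ≡ true
    not-false⁻ {true} _ = refl

  -- Since `e` straddles and is not symmetric, it encloses the negative of one of its ends. That
  -- value is an end of `α`, and it would have to lie right of `negArc α`, whereas `RightArc` puts
  -- it on the left.
  ¬left-of-neg : ∀ {α e} → RightArc e → Straddles e → Rep α (negL e) → Rep (negArc α) e → ¬ RightOfNeg α
  ¬left-of-neg {α} {e} r (s , s′) p q (_ , bot-inR , top-inR , _) with ≺-cmp (lo e) (neg (hi e))
  ... | tri< l _ _ = true≢false (inR⇒ q (subst (λ v → InR v (negArc α)) (bot≡ p) (bot-inR (subst (λ v → Between v (negArc α)) (sym (bot≡ p)) (between⇐ q l s′))))) (neg-hi r l s′)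
  ... | tri≈ _ m _ = contradiction m (¬mid r)
  ... | tri> _ _ g = true≢false (inR⇒ q (subst (λ v → InR v (negArc α)) (top≡ p) (top-inR (subst (λ v → Between v (negArc α)) (sym (top≡ p)) (between⇐ q s (≺-negˡ g)))))) (neg-lo r s (≺-negˡ g))

  wf : ∀ {α e} → Rep α e → lo e F.< hi e → WF α
  wf p lt = subst₂ F._<_ (sym (bot≡ p)) (sym (top≡ p)) lt , λ x m → let ((l , h) , _) = mark⇒ p m in between⇐ p l h

  symPair-neg : ∀ {α e} → Rep α e → Rep (negArc α) (negL e) → lo e F.< hi e → IsSymPair α → IsSymPair (negArc α)
  symPair-neg {α} p q lt (_ , ne , b≢ , t≢ , sides) = wf q (≺-neg lt) , (λ e → ne (sym (trans e (negArc-involutive p)))) ,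
    subst (Compatible (negArc α)) (sym (negArc-involutive p)) (b≢ ∘ sym , t≢ ∘ sym , Sum.swap sides)

  record SymRep (α : Arc (n + n)) (e : Label) : Set where
    field
      symmetric : IsSymArc α
      isMid : MidArc e
      rep : Rep α e

  -- α⁺ represents the label e of the descent in the right half, α⁻ its mirror image.
  record PairRep (α : Arc (n + n)) (e : Label) : Set where
    field
      isRight : RightArc e
      α⁺ α⁻ : Arc (n + n)
      one⁺ : OneOf α⁺ α
      one⁻ : OneOf α⁻ α
      either : ∀ {β} → OneOf β α → β ≡ α⁺ ⊎ β ≡ α⁻
      rep⁺ : Rep α⁺ e
      rep⁻ : Rep α⁻ (negL e)
      neg⁺ : negArc α⁺ ≡ α⁻
      neg⁻ : negArc α⁻ ≡ α⁺
      pair⁺ : IsSymPair α⁺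
      pair⁻ : IsSymPair α⁻

  rep-mid : ∀ {e} → MidArc e → ∀ {α} → Rep α e → Rep α (negL e)
  rep-mid m = rep-cong (mid m) (sym (neg-swap (mid m))) (mid-neg m)

  symRep : ∀ {j α} (d : OneDescent j) → IsSymArc α → InDelta n (word j) α → SymRep α (OneDescent.label d)
  symRep {j} {α} d s@(_ , self) δ with normalise d δ
  ... | r = record { symmetric = s ; isMid = isMid (descent-arc j adj n≤b descent) ; rep = proj₁ (both r) }
    where
    open OneDescent d
    both : (Rep α label × Rep (negArc α) (negL label)) ⊎ (Rep α (negL label) × Rep (negArc α) label) → Rep α label × Rep α (negL label)
    both (inj₁ (p , q)) = p , subst (λ β → Rep β (negL label)) (sym self) q
    both (inj₂ (p , q)) = subst (λ β → Rep β label) (sym self) q , p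
    isMid : MidArc label ⊎ RightArc label → MidArc label
    isMid (inj₁ m) = m
    isMid (inj₂ r′) = contradiction (trans (sym (bot≡ (proj₁ (both r)))) (bot≡ (proj₂ (both r)))) (¬mid r′)

  pairRep : ∀ {j α} (d : OneDescent j) → IsSymPair α → InDelta n (word j) α → PairRep α (OneDescent.label d)
  pairRep {j} {α} d s@(_ , ne , _) δ = build (normalise d δ) (descent-arc j adj n≤b descent)
    where
    open OneDescent d
    build : (Rep α label × Rep (negArc α) (negL label)) ⊎ (Rep α (negL label) × Rep (negArc α) label) →
      MidArc label ⊎ RightArc label → PairRep α label
    build (inj₁ (p , q)) (inj₁ m) = contradiction (rep-unique (rep-mid m p) q) ne
    build (inj₂ (p , q)) (inj₁ m) = contradiction (rep-unique p (rep-mid m q)) ne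
    build (inj₁ (p , q)) (inj₂ r) = record
      { isRight = r ; α⁺ = α ; α⁻ = negArc α ; one⁺ = inj₁ refl ; one⁻ = inj₂ refl ; either = id
      ; rep⁺ = p ; rep⁻ = q ; neg⁺ = refl ; neg⁻ = negArc-involutive p ; pair⁺ = s ; pair⁻ = symPair-neg p q descent s }
    build (inj₂ (p , q)) (inj₂ r) = record
      { isRight = r ; α⁺ = negArc α ; α⁻ = α ; one⁺ = inj₂ refl ; one⁻ = inj₁ refl ; either = Sum.swap
      ; rep⁺ = q ; rep⁻ = p ; neg⁺ = negArc-involutive p ; neg⁻ = refl
      ; pair⁺ = symPair-neg p (rep-neg p) (≺-neg descent) s ; pair⁻ = s }

  ObjRep : Obj (n + n) → Label → Set
  ObjRep (symO α) = SymRep α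
  ObjRep (pairO α) = PairRep α

  objRep : ∀ {j} (d : OneDescent j) o → Corr n (word j) o → ObjRep o (OneDescent.label d)
  objRep d (symO α) (s , δ , _) = symRep d s δ
  objRep d (pairO α) (s , δ , _) = pairRep d s δ

  mid-straddles : ∀ {e} → MidArc e → Straddles e
  mid-straddles {e} m = subst (λ v → v F.< neg v) (sym (mid m)) (subst (neg (hi e) F.<_) (sym (neg-neg (hi e))) (hi>0 m)) , hi>0 m

  positive⇒¬straddles : ∀ {e} → neg (lo e) F.< lo e → ¬ Straddles e
  positive⇒¬straddles p (s , _) = ≺-asym p s

  -- For two pairs the representatives `β′` and `β` may be mirror images of the oriented ones. If
  -- the smaller arc overlaps, so does the larger, and the orientation conditions force `α⁺` in
  -- both. Otherwise two mirrorings cancel, and a single one is the second alternative of `⊑`.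
  sub⇒⊑ : ∀ o₁ o₂ {e₁ e₂} → ObjRep o₁ e₁ → ObjRep o₂ e₂ → Sub n o₁ o₂ → e₁ ⊑ e₂
  sub⇒⊑ (symO α′) (symO α) {e₁} {e₂} r₁ r₂ (_ , t≤ , same) = inj₁ (toAsub R₁.rep R₂.rep b≤ t≤ same , λ _ _ → mid R₁.isMid)
    where
    module R₁ = SymRep r₁
    module R₂ = SymRep r₂
    b≤ : bot α F.≤ bot α′
    b≤ = subst₂ F._≤_ (sym (trans (bot≡ R₂.rep) (trans (mid R₂.isMid) (cong neg (sym (top≡ R₂.rep))))))
                      (sym (trans (bot≡ R₁.rep) (trans (mid R₁.isMid) (cong neg (sym (top≡ R₁.rep)))))) (opp-anti-≤ t≤)
  sub⇒⊑ (pairO α′) (symO α) {e₁} {e₂} r₁ r₂ (β , one , _ , pos , t≤ , same) = result (R₁.either one)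
    where
    module R₁ = PairRep r₁
    module R₂ = SymRep r₂
    b≤ : bot α F.≤ bot β
    b≤ = ℕₚ.<⇒≤ (ℕₚ.<-≤-trans bot<n pos)
      where
      bot<n : toℕ (bot α) ℕ.< n
      bot<n = subst (λ v → toℕ v ℕ.< n) (sym (trans (bot≡ R₂.rep) (mid R₂.isMid))) (≤n⇒neg<n (hi e₂) (positive⇐ (hi>0 R₂.isMid)))
    positive : ∀ {e} → Rep β e → ¬ Straddles e
    positive {e} p = positive⇒¬straddles {e} (positive⇒ (subst (Positive n) (bot≡ p) pos))
    result : β ≡ R₁.α⁺ ⊎ β ≡ R₁.α⁻ → e₁ ⊑ e₂
    result (inj₁ refl) = inj₁ (toAsub R₁.rep⁺ R₂.rep b≤ t≤ same , λ _ s → contradiction s (positive R₁.rep⁺))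
    result (inj₂ refl) = inj₂ (positive R₁.rep⁻ ∘ straddles-neg⁻ {e₁} , toAsub R₁.rep⁻ R₂.rep b≤ t≤ same)
  sub⇒⊑ (symO α′) (pairO α) {e₁} {e₂} r₁ r₂ (_ , b≤ , t≤ , same , same⁻) = result (R₂.either (inj₁ refl))
    where
    module R₁ = SymRep r₁
    module R₂ = PairRep r₂
    b′≡ : bot α′ ≡ neg (top α′)
    b′≡ = trans (bot≡ R₁.rep) (trans (mid R₁.isMid) (cong neg (sym (top≡ R₁.rep))))
    neg-b≤ : bot (negArc α) F.≤ bot α′
    neg-b≤ = subst (neg (top α) F.≤_) (sym b′≡) (opp-anti-≤ t≤)
    neg-t≤ : top α′ F.≤ top (negArc α)
    neg-t≤ = subst (F._≤ neg (bot α)) (neg-swap b′≡) (opp-anti-≤ b≤)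
    result : α ≡ R₂.α⁺ ⊎ α ≡ R₂.α⁻ → e₁ ⊑ e₂
    result (inj₁ e) = inj₁ (toAsub R₁.rep (subst (λ β → Rep β e₂) (sym e) R₂.rep⁺) b≤ t≤ same , λ _ _ → mid R₁.isMid)
    result (inj₂ e) = inj₁ (toAsub R₁.rep (subst (λ β → Rep β e₂) (sym (trans (cong negArc e) R₂.neg⁻)) R₂.rep⁺) neg-b≤ neg-t≤ same⁻ , λ _ _ → mid R₁.isMid)
  sub⇒⊑ (pairO α′) (pairO α) {e₁} {e₂} r₁ r₂ (β , one , β-right , β′ , one′ , _ , b≤ , t≤ , same , β′-right) =
    result (R₁.either one′) (R₂.either one) (straddles? e₁)
    where
    module R₁ = PairRep r₁
    module R₂ = PairRep r₂
    result : β′ ≡ R₁.α⁺ ⊎ β′ ≡ R₁.α⁻ → β ≡ R₂.α⁺ ⊎ β ≡ R₂.α⁻ → Dec (Straddles e₁) → e₁ ⊑ e₂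
    result (inj₁ refl) (inj₁ refl) _ = inj₁ (toAsub R₁.rep⁺ R₂.rep⁺ b≤ t≤ same , λ m → contradiction m (¬mid R₂.isRight))
    result (inj₁ refl) (inj₂ refl) (yes s) = contradiction (β-right (overlapping⇐ R₂.rep⁻ s₂))
        (¬left-of-neg R₂.isRight (straddles-neg {e₂} s₂) R₂.rep⁻ (subst (λ β → Rep β e₂) (sym R₂.neg⁻) R₂.rep⁺))
      where
      s₂ : Straddles (negL e₂)
      s₂ = straddles-mono {e₁} {negL e₂} (toAsub R₁.rep⁺ R₂.rep⁻ b≤ t≤ same) s
    result (inj₁ refl) (inj₂ refl) (no ¬s) = inj₂ (¬s , asub-neg-neg (asub-neg (toAsub R₁.rep⁺ R₂.rep⁻ b≤ t≤ same)))
    result (inj₂ refl) _ (yes s) = contradiction (β′-right (overlapping⇐ R₁.rep⁻ (straddles-neg⁻ {e₁} s)))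
        (¬left-of-neg R₁.isRight s R₁.rep⁻ (subst (λ β → Rep β e₁) (sym R₁.neg⁻) R₁.rep⁺))
    result (inj₂ refl) (inj₁ refl) (no ¬s) = inj₂ (¬s , toAsub R₁.rep⁻ R₂.rep⁺ b≤ t≤ same)
    result (inj₂ refl) (inj₂ refl) (no ¬s) = inj₁ (asub-neg-neg (asub-neg⁻ (toAsub R₁.rep⁻ R₂.rep⁻ b≤ t≤ same)) , λ m → contradiction m (¬mid R₂.isRight))

  ⊑⇒sub : ∀ o₁ o₂ {e₁ e₂} → ObjRep o₁ e₁ → ObjRep o₂ e₂ → e₁ ⊑ e₂ → Sub n o₁ o₂
  ⊑⇒sub (symO α′) (symO α) {e₁} r₁ r₂ (inj₁ (A , _)) = SymRep.symmetric r₁ , proj₂ (fromAsub (SymRep.rep r₁) (SymRep.rep r₂) A)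
  ⊑⇒sub (symO α′) (symO α) {e₁} r₁ r₂ (inj₂ (¬s , _)) = contradiction (mid-straddles {e₁} (SymRep.isMid r₁)) ¬s
  ⊑⇒sub (pairO α′) (symO α) {e₁} {e₂} r₁ r₂ sub = both sub
    where
    module R₁ = PairRep r₁
    module R₂ = SymRep r₂
    -- A symmetric arc contains the arc of `e₁` together with its mirror image, so the member with
    -- positive ends can be taken.
    choose : ¬ Straddles e₁ → Asub e₁ e₂ → Asub (negL e₁) e₂ → Sub n (pairO α′) (symO α)
    choose ¬s A A⁻ with neg (lo e₁) ≺? lo e₁
    ... | yes p = R₁.α⁺ , R₁.one⁺ , R₁.pair⁺ , subst (Positive n) (sym (bot≡ R₁.rep⁺)) (positive⇐ p) , proj₂ (fromAsub R₁.rep⁺ R₂.rep A)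
    ... | no ¬p = R₁.α⁻ , R₁.one⁻ , R₁.pair⁻ , subst (Positive n) (sym (bot≡ R₁.rep⁻)) (positive⇐ hi<0) , proj₂ (fromAsub R₁.rep⁻ R₂.rep A⁻)
      where
      hi<0 : neg (neg (hi e₁)) F.< neg (hi e₁)
      hi<0 = ≺-neg (≢∧⪯⇒≺ (v≢neg (hi e₁)) (λ q → ¬s (≢∧⪯⇒≺ (v≢neg (lo e₁)) ¬p , q)))
    both : e₁ ⊑ e₂ → Sub n (pairO α′) (symO α)
    both (inj₁ (A , m)) = choose (λ s → ¬mid R₁.isRight (m (mid R₂.isMid) s)) A (asub-midʳ R₂.isMid (asub-neg A))
    both (inj₂ (¬s , A)) = choose ¬s (asub-midʳ R₂.isMid (asub-neg⁻ A)) A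
  ⊑⇒sub (symO α′) (pairO α) {e₁} r₁ r₂ (inj₂ (¬s , _)) = contradiction (mid-straddles {e₁} (SymRep.isMid r₁)) ¬s
  ⊑⇒sub (symO α′) (pairO α) {e₁} {e₂} r₁ r₂ (inj₁ (A , _)) = result (R₂.either (inj₁ refl))
    where
    module R₁ = SymRep r₁
    module R₂ = PairRep r₂
    F⁺ : bot R₂.α⁺ F.≤ bot α′ × top α′ F.≤ top R₂.α⁺ × SameR α′ R₂.α⁺
    F⁺ = fromAsub R₁.rep R₂.rep⁺ A
    -- A symmetric subarc is its own mirror image, so it lies in both arcs of the pair.
    F⁻ : bot R₂.α⁻ F.≤ bot α′ × top α′ F.≤ top R₂.α⁻ × SameR α′ R₂.α⁻
    F⁻ = fromAsub R₁.rep R₂.rep⁻ (asub-neg⁻ (asub-midˡ R₁.isMid A))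
    result : α ≡ R₂.α⁺ ⊎ α ≡ R₂.α⁻ → Sub n (symO α′) (pairO α)
    result (inj₁ refl) = R₁.symmetric , proj₁ F⁺ , proj₁ (proj₂ F⁺) , proj₂ (proj₂ F⁺) ,
      subst (SameR α′) (sym R₂.neg⁺) (proj₂ (proj₂ F⁻))
    result (inj₂ refl) = R₁.symmetric , proj₁ F⁻ , proj₁ (proj₂ F⁻) , proj₂ (proj₂ F⁻) ,
      subst (SameR α′) (sym R₂.neg⁻) (proj₂ (proj₂ F⁺))
  ⊑⇒sub (pairO α′) (pairO α) {e₁} {e₂} r₁ r₂ sub = R₂.α⁺ , R₂.one⁺ ,
      (λ _ → right-of-neg R₂.isRight R₂.rep⁺ (subst (λ β → Rep β (negL e₂)) (sym R₂.neg⁺) R₂.rep⁻)) , result sub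
    where
    module R₁ = PairRep r₁
    module R₂ = PairRep r₂
    Subarc : Set
    Subarc = Σ (Arc (n + n)) λ β′ → OneOf β′ α′ × IsSymPair β′ × bot R₂.α⁺ F.≤ bot β′ × top β′ F.≤ top R₂.α⁺ ×
      SameR β′ R₂.α⁺ × (Overlapping n β′ → RightOfNeg β′)
    result : e₁ ⊑ e₂ → Subarc
    result (inj₁ (A , _)) with fromAsub R₁.rep⁺ R₂.rep⁺ A
    ... | b≤ , t≤ , same = R₁.α⁺ , R₁.one⁺ , R₁.pair⁺ , b≤ , t≤ , same ,
          (λ _ → right-of-neg R₁.isRight R₁.rep⁺ (subst (λ β → Rep β (negL e₁)) (sym R₁.neg⁺) R₁.rep⁻))
    result (inj₂ (¬s , A)) with fromAsub R₁.rep⁻ R₂.rep⁺ A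
    ... | b≤ , t≤ , same = R₁.α⁻ , R₁.one⁻ , R₁.pair⁻ , b≤ , t≤ , same ,
          (λ o → contradiction (straddles-neg {e₁} (overlapping⇒ R₁.rep⁻ o)) ¬s)

theorem4p9 : (n : ℕ) (j₁ j₂ : Word n) → JoinIrr n j₁ → JoinIrr n j₂ →
    (o₁ o₂ : Obj (n + n)) → Corr n j₁ o₁ → Corr n j₂ o₂ →
    Forces n j₁ j₂ ⇔ Sub n o₁ o₂
theorem4p9 n j₁ j₂ ji₁ ji₂ o₁ o₂ c₁ c₂ = mk⇔
    (λ f → ⊑⇒sub o₁ o₂ r₁ r₂ (forces⇒⊑ d₁ d₂ f))
    (λ s → ⊑⇒forces d₁ d₂ (sub⇒⊑ o₁ o₂ r₁ r₂ s))
  where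
  open SignedWords n
  open ValueOrders n
  open WeakOrder n
  open ArcLabels n
  d₁ : OneDescent (mk j₁ (proj₁ ji₁))
  d₁ = oneDescent ji₁
  d₂ : OneDescent (mk j₂ (proj₁ ji₂))
  d₂ = oneDescent ji₂
  r₁ : ObjRep o₁ (OneDescent.label d₁)
  r₁ = objRep d₁ o₁ c₁
  r₂ : ObjRep o₂ (OneDescent.label d₂)
  r₂ = objRep d₂ o₂ c₂
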